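{- Let $G$ be a graph that is bull-free, $4$-sunspot-free, and $t$-sun-free for all integers $t\geq 5$. Then $\chi(G)\leq \omega(G)^{37}$.
   Context: Graphs are finite, without loops or parallel edges; $\chi(G)$ is the chromatic number and $\omega(G)$ the clique number. For an integer $t\geq 4$, a $t$-sun is the graph obtained from a $t$-vertex cycle by adding, for each vertex of the cycle, a new vertex of degree one adjacent to it. A $t$-sunspot is the graph obtained from a $t$-sun by deleting a single degree-one vertex. A net is the graph obtained from a triangle by adding a new degree-one neighbor for each of its three vertices; a bull is the graph obtained from a net by deleting one degree-one vertex. A graph is $H$-free (for $H$ a bull, $t$-sun or $t$-sunspot) if no induced subgraph of it is isomorphic to $H$. -}

module Defs where

open import Data.Nat using (ℕ; zero; suc; _+_; _∸_; _<_; _≡ᵇ_; _<ᵇ_)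
open import Data.Fin using (Fin; toℕ)
open import Data.Bool using (Bool; true; false; _∨_; _∧_; not)
open import Data.Product using (Σ; _×_; ∃)
open import Relation.Binary.PropositionalEquality using (_≡_; _≢_)
open import Relation.Nullary using (¬_)
open import Function.Definitions using (Injective)

record Graph : Set where
  field
    n      : ℕ
    adj    : Fin n → Fin n → Bool
    sym    : ∀ u v → adj u v ≡ adj v u
    irrefl : ∀ v → adj v v ≡ false
open Graph public

InducedCopy : (k : ℕ) → (Fin k → Fin k → Bool) → Graph → Set
InducedCopy k h G =
  Σ (Fin k → Fin (n G)) λ f → Injective _≡_ _≡_ f × (∀ i j → h i j ≡ adj G (f i) (f j))

-- adjacency of the t-sun on ℕ-labels 0 .. 2t-1:
-- 0 .. t-1 form the cycle (i ~ i+1 mod t), and t+i is the pendant vertex of i.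
sunAdjℕ : ℕ → ℕ → ℕ → Bool
sunAdjℕ t a b =
  ((suc a ≡ᵇ b) ∨ (suc b ≡ᵇ a) ∨ ((suc a ≡ᵇ t) ∧ (b ≡ᵇ 0)) ∨ ((suc b ≡ᵇ t) ∧ (a ≡ᵇ 0)))
    ∧ (lt a ∧ lt b)
  ∨ (a ≡ᵇ b + t) ∨ (b ≡ᵇ a + t)
  where
    lt : ℕ → Bool
    lt x = x <ᵇ t

sun : (t : ℕ) → Fin (t + t) → Fin (t + t) → Bool
sun t i j = sunAdjℕ t (toℕ i) (toℕ j)

-- t-sunspot: the t-sun with its last vertex (label 2t-1, the pendant of
-- cycle vertex t-1) deleted, i.e. the induced subgraph on labels 0 .. 2t-2.
sunspot : (t : ℕ) → Fin (t + t ∸ 1) → Fin (t + t ∸ 1) → Bool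
sunspot t i j = sunAdjℕ t (toℕ i) (toℕ j)

-- net on labels 0..5: triangle 0,1,2; pendant 3+i of i (i < 3).
netAdjℕ : ℕ → ℕ → Bool
netAdjℕ a b =
  ((a <ᵇ 3) ∧ (b <ᵇ 3) ∧ not (a ≡ᵇ b))
  ∨ (a ≡ᵇ b + 3) ∨ (b ≡ᵇ a + 3)

-- bull: net with its last pendant (label 5) deleted.
bull : Fin 5 → Fin 5 → Bool
bull i j = netAdjℕ (toℕ i) (toℕ j)

Free : (k : ℕ) → (Fin k → Fin k → Bool) → Graph → Set
Free k h G = ¬ InducedCopy k h G

HasClique : Graph → ℕ → Set
HasClique G k =
  Σ (Fin k → Fin (n G)) λ f → Injective _≡_ _≡_ f × (∀ i j → i ≢ j → adj G (f i) (f j) ≡ true)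

IsCliqueNumber : Graph → ℕ → Set
IsCliqueNumber G w = HasClique G w × ¬ HasClique G (suc w)

Colourable : Graph → ℕ → Set
Colourable G m =
  Σ (Fin (n G) → Fin m) λ c → ∀ u v → adj G u v ≡ true → c u ≢ c v

{-# OPTIONS --safe #-}
-- A vertex-to-neighbourhood reduction carries most of the weight: if S is a maximal stable set of a
-- bull-free graph H, then the traces N(x) ∩ S of the other vertices order the edges so that χ(H) is
-- at most about ω(H) · max χ(N(v)) · k, where k bounds χ of the triangle-free induced subgraphs.
-- For triangle-free graphs one works inside a single BFS level: if no vertex is dominated and all
-- degrees are large, sunspots force the level to be C₄-free, and then a shortest cycle grows into a
-- sun; hence k = 16. In a prime graph, the non-neighbours of a vertex v are levelled from v through a
-- neighbour; neighbourhoods inside a level are unions of two sets all of whose prime pieces are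
-- split, hence perfect, so a prime graph has χ ≤ ω^10. Finally, substituting the maximal proper
-- modules back costs the exponent 37: modules with more than half of the total clique weight use
-- the bottom of the palette, the others disjoint slots at the top, one for each power of two.
module Submission where

open import Defs
open import Data.Bool using (Bool; true; false; not)
import Data.Bool.Properties as Bₚ
open import Data.Empty using (⊥; ⊥-elim)
open import Data.Fin as Fin using (Fin; toℕ)
import Data.Fin.Properties as Finₚ
open import Data.Fin.Subset using (Subset)
open import Data.Fin.Subset.Properties using (anySubset?)
open import Data.List using (List; []; _∷_; length; _++_; allFin; applyUpTo; filter; map)
import Data.List.Membership.DecPropositional as DecMembership
open import Data.List.Membership.Propositional using () renaming (_∈_ to _∈ₗ_; _∉_ to _∉ₗ_)
open import Data.List.Membership.Propositional.Properties using (∈-++⁻; ∈-allFin; ∈-applyUpTo⁺; ∈-filter⁺; ∈-map⁺)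
open import Data.List.Properties using (filter-notAll; length-++; length-applyUpTo; length-map; length-tabulate)
import Data.List.Relation.Unary.Any as Any
open import Data.List.Relation.Unary.Any using (here; there) renaming (any? to any?ₗ)
open import Data.Nat as ℕ using (ℕ; zero; suc; _+_; _*_; _∸_; _^_; _≤_; _<_; z≤n; s≤s)
open import Data.Nat.DivMod using (_%_; _/_; m%n<n; m≡m%n+[m/n]*n)
open import Data.Nat.Induction using (<-rec)
import Data.Nat.Properties as ℕₚ
open import Data.Nat.Solver using (module +-*-Solver)
open import Data.Product using (Σ; _×_; _,_; proj₁; proj₂; ∃; ∃-syntax)
open import Data.Sum using (_⊎_; inj₁; inj₂; [_,_]′)
open import Data.Unit using (⊤; tt)
open import Data.Vec using (lookup; tabulate) renaming (_∷_ to _∷ᵥ_; [] to []ᵥ)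
open import Data.Vec.Properties using (lookup∘tabulate)
open import Function using (_∘_; id; case_of_)
open import Relation.Binary.Definitions using (tri<; tri≈; tri>)
open import Relation.Binary.PropositionalEquality using (_≡_; _≢_; refl; trans; cong; cong₂; subst; subst₂; ≢-sym) renaming (sym to ≡sym)
open import Relation.Nullary using (¬_; Dec; yes; no; does)
open import Relation.Nullary.Decidable using (_×-dec_; _⊎-dec_; _→-dec_; ¬?; map′; decidable-stable; dec-true; from-yes)
open +-*-Solver using (solve; _:*_; _:+_; _:=_; con)

-- Most bulls below arise in one way. A vertex that sees part but not all of a connected set D
-- splits some edge of D; if D is connected in the complement, it splits some nonadjacent pair of D.
-- This pair completes a bull with the vertex and two others. So an outside vertex is uniform on D,
-- unless it comes with a neighbour anticomplete to D and a non-neighbour complete to D; such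
-- exceptional vertices are what the split structure of neighbourhoods is built from. Primeness
-- enters twice: it gives each nontrivial module of a neighbourhood a vertex that splits it, and it
-- gives each component of the non-neighbours of v a neighbour u of v that splits the component.
-- Levelling through this u alone keeps the first level a single vertex, on which the arguments
-- about common parents rely.

greatest : (P : ℕ → Set) → (∀ k → Dec (P k)) → P 0 → ∀ N → (∀ k → P k → k ≤ N) →
           ∃[ k ] P k × (∀ j → P j → j ≤ k)
greatest P P? p0 zero    bound = 0 , p0 , bound
greatest P P? p0 (suc N) bound with P? (suc N)
... | yes p = suc N , p , bound
... | no ¬p = greatest P P? p0 N λ k pk → ℕₚ.≤-pred (ℕₚ.≤∧≢⇒< (bound k pk) λ { refl → ¬p pk })

least : ∀ {n} (P : Fin n → Set) → (∀ i → Dec (P i)) → ∃ P →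
        Σ (Fin n) λ i → P i × (∀ j → P j → i Fin.≤ j)
least {zero} P P? (() , _)
least {suc n} P P? (i , pi) with P? Fin.zero
... | yes p = Fin.zero , p , λ _ _ → z≤n
... | no ¬p with i | pi
...   | Fin.zero  | p0 = ⊥-elim (¬p p0)
...   | Fin.suc j | pj with least (P ∘ Fin.suc) (P? ∘ Fin.suc) (j , pj)
...     | k , pk , min = Fin.suc k , pk , λ { Fin.zero q → ⊥-elim (¬p q) ; (Fin.suc l) q → s≤s (min l q) }

-- Vertex sets, cliques and connectedness

module VertexSets (G : Graph) where

  V : Set
  V = Fin (n G)

  A : V → V → Bool
  A = adj G

  infix 4 _~_ _≁_
  _~_ _≁_ : V → V → Set
  x ~ y = A x y ≡ true
  x ≁ y = A x y ≡ false

  A-sym : ∀ {b x y} → A x y ≡ b → A y x ≡ b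
  A-sym {x = x} {y} p = trans (sym G y x) p

  ~? : ∀ x y → (x ~ y) ⊎ (x ≁ y)
  ~? x y with A x y
  ... | true  = inj₁ refl
  ... | false = inj₂ refl

  clash : ∀ {b} → b ≡ true → b ≡ false → ⊥
  clash refl ()

  not~ : ∀ {b} → ¬ b ≡ true → b ≡ false
  not~ {true} h  = ⊥-elim (h refl)
  not~ {false} _ = refl

  irr : ∀ {x y} → x ≡ y → x ~ y → ⊥
  irr {x} refl p = clash p (irrefl G x)

  ~⇒≢ : ∀ {x y} → x ~ y → x ≢ y
  ~⇒≢ p e = irr e p

  sep : ∀ {x y z} → z ~ x → z ≁ y → x ≢ y
  sep p q refl = clash p q

  record Sub : Set₁ where
    constructor _∣_
    field
      _∋_ : V → Set
      mem : ∀ x → Dec (_∋_ x)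
  open Sub public using (mem) renaming (_∋_ to ⟦_⟧)

  infix 4 _∈_ _∉_ _⊆_ _∈?_
  _∈_ _∉_ : V → Sub → Set
  x ∈ U = ⟦ U ⟧ x
  x ∉ U = ¬ x ∈ U

  _∈?_ : ∀ x U → Dec (x ∈ U)
  x ∈? U = mem U x

  _⊆_ : Sub → Sub → Set
  U ⊆ W = ∀ {x} → x ∈ U → x ∈ W

  infixl 7 _∩_ _∖_
  infixl 6 _∪_
  _∩_ _∪_ _∖_ : Sub → Sub → Sub
  U ∩ W = (λ x → x ∈ U × x ∈ W) ∣ λ x → mem U x ×-dec mem W x
  U ∪ W = (λ x → x ∈ U ⊎ x ∈ W) ∣ λ x → mem U x ⊎-dec mem W x
  U ∖ W = (λ x → x ∈ U × x ∉ W) ∣ λ x → mem U x ×-dec ¬? (mem W x)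

  N : V → Sub
  N x = (λ y → x ~ y) ∣ λ y → A x y Bₚ.≟ true

  ｛_｝ : V → Sub
  ｛ x ｝ = (λ y → y ≡ x) ∣ λ y → y Finₚ.≟ x

  full : Sub
  full = (λ _ → ⊤) ∣ λ _ → yes tt

  inhab? : ∀ U → Dec (∃[ x ] x ∈ U)
  inhab? U = Finₚ.any? (mem U)

  two? : ∀ U → Dec (∃[ x ] ∃[ y ] x ∈ U × y ∈ U × x ≢ y)
  two? U = Finₚ.any? λ x → Finₚ.any? λ y → mem U x ×-dec mem U y ×-dec ¬? (x Finₚ.≟ y)

  one : ∀ {U} → ¬ (∃[ x ] ∃[ y ] x ∈ U × y ∈ U × x ≢ y) → ∀ {x y} → x ∈ U → y ∈ U → x ≡ y
  one ¬two {x} {y} xU yU = decidable-stable (x Finₚ.≟ y) λ x≢y → ¬two (x , y , xU , yU , x≢y)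

  -- At least k distinct members, as nested witnesses: this is decidable, monotone in P, and
  -- replaces cardinalities throughout.
  Many : ℕ → (V → Set) → Set
  Many zero    P = ⊤
  Many (suc k) P = ∃[ x ] P x × Many k (λ y → P y × y ≢ x)

  Many? : ∀ k {P} → (∀ x → Dec (P x)) → Dec (Many k P)
  Many? zero    P? = yes tt
  Many? (suc k) P? = Finₚ.any? λ x → P? x ×-dec Many? k (λ y → P? y ×-dec ¬? (y Finₚ.≟ x))

  Many-⊆ : ∀ k {P Q} → (∀ {x} → P x → Q x) → Many k P → Many k Q
  Many-⊆ zero    P⊆Q _ = tt
  Many-⊆ (suc k) P⊆Q (x , p , m) = x , P⊆Q p , Many-⊆ k (λ { (q , ne) → P⊆Q q , ne }) m

  remove : V → List V → List V
  remove x [] = []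
  remove x (y ∷ l) with x Finₚ.≟ y
  ... | yes _ = l
  ... | no  _ = y ∷ remove x l

  length-remove : ∀ {x l} → x ∈ₗ l → suc (length (remove x l)) ≤ length l
  length-remove {x} {y ∷ l} p with x Finₚ.≟ y | p
  ... | yes _  | _        = ℕₚ.≤-refl
  ... | no x≢y | here e   = ⊥-elim (x≢y e)
  ... | no _   | there p′ = s≤s (length-remove p′)

  ∉-remove : ∀ {x y l} → y ≢ x → y ∉ₗ remove x l → y ∉ₗ l
  ∉-remove {x} {y} {z ∷ l} y≢x h q with x Finₚ.≟ z
  ∉-remove y≢x h (here refl) | yes refl = y≢x refl
  ∉-remove y≢x h (there q)   | yes refl = h q
  ∉-remove y≢x h (here e)    | no _ = h (here e)
  ∉-remove y≢x h (there q)   | no _ = ∉-remove y≢x (h ∘ there) q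

  mem? : (x : V) (l : List V) → Dec (x ∈ₗ l)
  mem? x l = DecMembership._∈?_ Finₚ._≟_ x l

  avoid : ∀ k {P} (l : List V) → length l < k → Many k P → ∃[ x ] P x × x ∉ₗ l
  avoid (suc k) l lt (x , xU , m) with mem? x l
  ... | no x∉l  = x , xU , x∉l
  ... | yes x∈l with avoid k (remove x l) (ℕₚ.≤-trans (length-remove x∈l) (ℕₚ.≤-pred lt)) m
  ...   | y , (yU , y≢x) , h = y , yU , ∉-remove y≢x h

  few : ∀ k U → ¬ Many (suc k) ⟦ U ⟧ → ∃[ l ] length l ≤ k × (∀ x → x ∈ U → x ∈ₗ l)
  few zero    U ¬m = [] , z≤n , λ x xU → ⊥-elim (¬m (x , xU , tt))
  few (suc k) U ¬m with inhab? U
  ... | no empty    = [] , z≤n , λ x xU → ⊥-elim (empty (x , xU))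
  ... | yes (x , xU) with few k (U ∖ ｛ x ｝) (λ m → ¬m (x , xU , m))
  ...   | l , len , cover = x ∷ l , s≤s len , λ y yU → case y Finₚ.≟ x of λ where
           (yes y≡x) → here y≡x
           (no y≢x)  → there (cover y (yU , y≢x))

  infix 4 _≲_
  _≲_ : Sub → ℕ → Set
  U ≲ k = ¬ Many (suc k) ⟦ U ⟧

  full-bound : ∀ U → U ≲ n G
  full-bound U m with avoid (suc (n G)) (allFin (n G)) (ℕₚ.≤-reflexive (cong suc (length-tabulate id))) m
  ... | x , _ , x∉ = x∉ (∈-allFin x)

  shrink : ∀ U W {k} z → z ∈ W → z ∉ U → U ⊆ W → W ≲ suc k → U ≲ k
  shrink U W {k} z zW z∉U U⊆W W≤ m =
    W≤ (z , zW , Many-⊆ (suc k) (λ xU → U⊆W xU , λ { refl → z∉U xU }) m)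

  -- The recursion is on an upper bound for the size of U; the explicit missing vertex z is what
  -- lowers it.
  sub-induction : ∀ {ℓ} (P : Sub → Set ℓ) →
    (∀ U → (∀ U′ → U′ ⊆ U → (∃[ z ] z ∈ U × z ∉ U′) → P U′) → P U) → ∀ U → P U
  sub-induction P step U = go (n G) U (full-bound U)
    where
    go : ∀ k U → U ≲ k → P U
    go zero    U U≤ = step U λ U′ _ (z , zU , _) → ⊥-elim (U≤ (z , zU , tt))
    go (suc k) U U≤ = step U λ U′ U′⊆U (z , zU , z∉U′) → go k U′ (shrink U′ U z zU z∉U′ U′⊆U U≤)

  HasCl : ℕ → (V → Set) → Set
  HasCl zero    P = ⊤
  HasCl (suc k) P = ∃[ x ] P x × HasCl k (λ y → P y × x ~ y)

  HasCl? : ∀ k {P} → (∀ x → Dec (P x)) → Dec (HasCl k P)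
  HasCl? zero    P? = yes tt
  HasCl? (suc k) P? = Finₚ.any? λ x → P? x ×-dec HasCl? k (λ y → P? y ×-dec (A x y Bₚ.≟ true))

  HasCl-⊆ : ∀ k {P Q} → (∀ {x} → P x → Q x) → HasCl k P → HasCl k Q
  HasCl-⊆ zero    P⊆Q _ = tt
  HasCl-⊆ (suc k) P⊆Q (x , p , c) = x , P⊆Q p , HasCl-⊆ k (λ { (q , xy) → P⊆Q q , xy }) c

  HasCl⇒Many : ∀ k {P} → HasCl k P → Many k P
  HasCl⇒Many zero    _ = tt
  HasCl⇒Many (suc k) (x , p , c) =
    x , p , Many-⊆ k (λ { (q , xy) → q , ≢-sym (~⇒≢ xy) }) (HasCl⇒Many k c)

  HasCl-≤ : ∀ {j k P} → j ≤ k → HasCl k P → HasCl j P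
  HasCl-≤ z≤n c = tt
  HasCl-≤ (s≤s j≤k) (x , p , c) = x , p , HasCl-≤ j≤k c

  HasCl-join : ∀ a b {P Q R : V → Set} → (∀ {x y} → P x → Q y → x ~ y) →
               (∀ {x} → P x → R x) → (∀ {x} → Q x → R x) → HasCl a P → HasCl b Q → HasCl (a + b) R
  HasCl-join zero    b full P⊆ Q⊆ _ d = HasCl-⊆ b Q⊆ d
  HasCl-join (suc a) b full P⊆ Q⊆ (x , p , c) d =
    x , P⊆ p , HasCl-join a b (λ { (q , _) r → full q r }) (λ { (q , xy) → P⊆ q , xy })
                  (λ r → Q⊆ r , full p r) c d

  HasCl-split : ∀ k {P} (Q R : V → Set) → (∀ {x} → P x → Q x ⊎ R x) → HasCl k P →
                ∃[ a ] ∃[ b ] HasCl a (λ x → P x × Q x) × HasCl b (λ x → P x × R x) × k ≤ a + b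
  HasCl-split zero    Q R cover _ = 0 , 0 , tt , tt , z≤n
  HasCl-split (suc k) Q R cover (x , p , c)
    with HasCl-split k Q R (cover ∘ proj₁) c | cover p
  ... | a , b , ca , cb , le | inj₁ q =
    suc a , b , (x , (p , q) , HasCl-⊆ a (λ { ((y , xy) , z) → (y , z) , xy }) ca)
          , HasCl-⊆ b (λ { ((y , _) , z) → y , z }) cb , s≤s le
  ... | a , b , ca , cb , le | inj₂ r =
    a , suc b , HasCl-⊆ a (λ { ((y , _) , z) → y , z }) ca
      , (x , (p , r) , HasCl-⊆ b (λ { ((y , xy) , z) → (y , z) , xy }) cb)
      , ℕₚ.≤-trans (s≤s le) (ℕₚ.≤-reflexive (≡sym (ℕₚ.+-suc a b)))

  abstract
    clique-data : ∀ U → ∃[ k ] HasCl k ⟦ U ⟧ × (∀ j → HasCl j ⟦ U ⟧ → j ≤ k)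
    clique-data U = greatest (λ k → HasCl k ⟦ U ⟧) (λ k → HasCl? k (mem U)) tt (n G) λ k c →
      ℕₚ.≮⇒≥ λ n<k → full-bound U (HasCl⇒Many (suc (n G)) (HasCl-≤ n<k c))

    ω : Sub → ℕ
    ω U = proj₁ (clique-data U)

    ω-has : ∀ U → HasCl (ω U) ⟦ U ⟧
    ω-has U = proj₁ (proj₂ (clique-data U))

    ω-max : ∀ {k} U → HasCl k ⟦ U ⟧ → k ≤ ω U
    ω-max U = proj₂ (proj₂ (clique-data U)) _

  ω-mono : ∀ U W → U ⊆ W → ω U ≤ ω W
  ω-mono U W U⊆W = ω-max W (HasCl-⊆ (ω U) U⊆W (ω-has U))

  ω-join : ∀ U W X → (∀ {x y} → x ∈ U → y ∈ W → x ~ y) → U ⊆ X → W ⊆ X → ω U + ω W ≤ ω X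
  ω-join U W X full U⊆ W⊆ = ω-max X (HasCl-join (ω U) (ω W) full U⊆ W⊆ (ω-has U) (ω-has W))

  ω-pos : ∀ U {x} → x ∈ U → 1 ≤ ω U
  ω-pos U xU = ω-max U (_ , xU , tt)

  ω-split : ∀ X U W → (∀ {x} → x ∈ X → x ∈ U ⊎ x ∈ W) → ω X ≤ ω (X ∩ U) + ω (X ∩ W)
  ω-split X U W cover with HasCl-split (ω X) ⟦ U ⟧ ⟦ W ⟧ cover (ω-has X)
  ... | a , b , ca , cb , le = ℕₚ.≤-trans le (ℕₚ.+-mono-≤ (ω-max (X ∩ U) ca) (ω-max (X ∩ W) cb))

  -- Connectedness in the graph (b = true) or in its complement (b = false).
  Conn : Bool → Sub → Set₁
  Conn b D = ∀ (S : Sub) {x y} → x ∈ D → x ∈ S → y ∈ D → y ∉ S →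
             ∃[ x′ ] ∃[ y′ ] (x′ ∈ D × x′ ∈ S) × (y′ ∈ D × y′ ∉ S) × A x′ y′ ≡ b

  Split : Bool → Sub → Set₁
  Split b D = Σ Sub λ S → (∃[ x ] x ∈ D × x ∈ S) × (∃[ y ] y ∈ D × y ∉ S) ×
              (∀ {x y} → x ∈ D → x ∈ S → y ∈ D → y ∉ S → A x y ≡ not b)

  private
    fromVec : Subset (n G) → Sub
    fromVec s = (λ x → lookup s x ≡ true) ∣ λ x → lookup s x Bₚ.≟ true

    toVec : Sub → Subset (n G)
    toVec S = tabulate λ x → does (mem S x)

    toVec-∈ : ∀ S {x} → x ∈ S → x ∈ fromVec (toVec S)
    toVec-∈ S {x} xS = trans (lookup∘tabulate _ x) (dec-true (mem S x) xS)

    ∈-toVec : ∀ S {x} → x ∈ fromVec (toVec S) → x ∈ S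
    ∈-toVec S {x} e with mem S x | trans (≡sym (lookup∘tabulate (λ x → does (mem S x)) x)) e
    ... | yes xS | _ = xS
    ... | no _   | ()

  -- Predicates on vertices cannot be enumerated, but their bit vectors can; `resp` carries P from a
  -- predicate to the one read off its vector.
  search : (P : Sub → Set) → (∀ S → Dec (P S)) → (∀ S T → S ⊆ T → T ⊆ S → P S → P T) →
           Dec (Σ Sub P)
  search P P? resp with anySubset? (P? ∘ fromVec)
  ... | yes (s , p) = yes (fromVec s , p)
  ... | no h = no λ { (S , p) → h (toVec S , resp S (fromVec (toVec S)) (toVec-∈ S) (∈-toVec S) p) }

  split-or-conn : ∀ b D → Split b D ⊎ Conn b D
  split-or-conn b D with anySubset? P?
    where
    P : Subset (n G) → Set
    P s = let S = fromVec s in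
      (∃[ x ] x ∈ D × x ∈ S) × (∃[ y ] y ∈ D × y ∉ S) ×
      ¬ (∃[ x ] ∃[ y ] (x ∈ D × x ∈ S) × (y ∈ D × y ∉ S) × A x y ≡ b)
    P? : ∀ s → Dec (P s)
    P? s = let S = fromVec s in inhab? (D ∩ S) ×-dec inhab? (D ∖ S) ×-dec
      ¬? (Finₚ.any? λ x → Finₚ.any? λ y → mem (D ∩ S) x ×-dec mem (D ∖ S) y ×-dec (A x y Bₚ.≟ b))
  ... | yes (s , hx , hy , h) = inj₁ (fromVec s , hx , hy , λ xD xS yD yS →
          Bₚ.¬-not λ e → h (_ , _ , (xD , xS) , (yD , yS) , e))
  ... | no h = inj₂ λ S {x} {y} xD xS yD y∉S → decidable-stable
          (Finₚ.any? λ x → Finₚ.any? λ y → mem (D ∩ S) x ×-dec mem (D ∖ S) y ×-dec (A x y Bₚ.≟ b))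
          λ none → h (toVec S , (x , xD , toVec-∈ S xS) , (y , yD , λ q → y∉S (∈-toVec S q)) ,
            λ { (x′ , y′ , (x′D , x′S) , (y′D , y′S) , e) →
                none (x′ , y′ , (x′D , ∈-toVec S x′S) , (y′D , λ q → y′S (toVec-∈ S q)) , e) })

  -- Connectedness applied to the cut of D along the neighbourhood of q.
  mixed-pair : ∀ {b D} → Conn b D → ∀ q {x y} → x ∈ D → y ∈ D → q ~ x → q ≁ y →
               ∃[ e ] ∃[ f ] e ∈ D × f ∈ D × q ~ e × q ≁ f × A e f ≡ b
  mixed-pair conn q xD yD qx qy with conn (N q) xD qx yD (λ p → clash p qy)
  ... | e , f , (eD , qe) , (fD , qf) , ef = e , f , eD , fD , qe , not~ qf , ef

-- Colourings and ways to combine them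

encode-< : ∀ b {i j x} y → i < j → x < b → i * b + x < j * b + y
encode-< b {i} {j} y i<j x<b = ℕₚ.<-≤-trans
  (ℕₚ.<-≤-trans (ℕₚ.+-monoʳ-< (i * b) x<b) (ℕₚ.≤-reflexive (ℕₚ.+-comm (i * b) b)))
  (ℕₚ.≤-trans (ℕₚ.*-monoˡ-≤ b i<j) (ℕₚ.m≤m+n (j * b) y))

encode-injective : ∀ b {i j x y} → x < b → y < b → i * b + x ≡ j * b + y → i ≡ j × x ≡ y
encode-injective b {i} {j} {x} {y} x<b y<b e with ℕₚ.<-cmp i j
... | tri≈ _ refl _ = refl , ℕₚ.+-cancelˡ-≡ (i * b) x y e
... | tri< i<j _ _ = ⊥-elim (ℕₚ.<⇒≢ (encode-< b y i<j x<b) e)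
... | tri> _ _ j<i = ⊥-elim (ℕₚ.<⇒≢ (encode-< b x j<i y<b) (≡sym e))

encode-bound : ∀ {a b i x} → i < a → x < b → i * b + x < a * b
encode-bound {a} {b} {i} {x} i<a x<b = ℕₚ.<-≤-trans (ℕₚ.+-monoʳ-< (i * b) x<b)
  (ℕₚ.≤-trans (ℕₚ.≤-reflexive (ℕₚ.+-comm (i * b) b)) (ℕₚ.*-monoˡ-≤ b i<a))

module Colourings (G : Graph) where
  open VertexSets G public

  Proper : (V → Set) → (V → ℕ) → Set
  Proper P c = ∀ {x y} → P x → P y → x ~ y → c x ≢ c y

  -- The bound is a relation between vertices and colours. Besides a number of colours it can
  -- express a prescribed palette, or colours that avoid those of neighbours elsewhere, and one set
  -- of gluing lemmas serves all three.
  record ColP (P : V → Set) (Q : V → ℕ → Set) : Set where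
    constructor colouring
    field
      colour : V → ℕ
      within : ∀ {x} → P x → Q x (colour x)
      is-proper : Proper P colour
  open ColP public

  Col : (V → Set) → ℕ → Set
  Col P m = ColP P λ _ k → k < m

  col-⊆ : ∀ {P P′ Q} → (∀ {x} → P x → P′ x) → ColP P′ Q → ColP P Q
  col-⊆ P⊆ (colouring c q pr) = colouring c (q ∘ P⊆) λ x y → pr (P⊆ x) (P⊆ y)

  col-≤ : ∀ {P a b} → a ≤ b → Col P a → Col P b
  col-≤ a≤b (colouring c q pr) = colouring c (λ p → ℕₚ.<-≤-trans (q p) a≤b) pr

  col-empty : ∀ {P Q} → ¬ ∃ P → ColP P Q
  col-empty ¬p = colouring (λ _ → 0) (λ p → ⊥-elim (¬p (_ , p))) λ p → ⊥-elim (¬p (_ , p))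

  col-const : ∀ {P Q} k → (∀ {x} → P x → Q x k) → (∀ {x y} → P x → P y → x ≁ y) → ColP P Q
  col-const k qk stable = colouring (λ _ → k) qk λ px py xy → ⊥-elim (clash xy (stable px py))

  private
    merge : (S : Sub) → (V → ℕ) → (V → ℕ) → V → ℕ
    merge S c d x with mem S x
    ... | yes _ = c x
    ... | no  _ = d x

  col-∪ : ∀ {P a b} (S : Sub) → Col (λ x → P x × x ∈ S) a → Col (λ x → P x × x ∉ S) b → Col P (a + b)
  col-∪ {P} {a} {b} S (colouring c cb cp) (colouring d db dp) = colouring (merge S c (λ x → a + d x)) bound prop
    where
    bound : ∀ {x} → P x → merge S c (λ x → a + d x) x < a + b
    bound {x} px with mem S x
    ... | yes xS = ℕₚ.<-≤-trans (cb (px , xS)) (ℕₚ.m≤m+n a b)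
    ... | no x∉S = ℕₚ.+-monoʳ-< a (db (px , x∉S))
    prop : Proper P (merge S c (λ x → a + d x))
    prop {x} {y} px py xy with mem S x | mem S y
    ... | yes xS | yes yS = cp (px , xS) (py , yS) xy
    ... | yes xS | no y∉S = λ e → ℕₚ.<⇒≢ (ℕₚ.<-≤-trans (cb (px , xS)) (ℕₚ.m≤m+n a (d y))) e
    ... | no x∉S | yes yS = λ e → ℕₚ.<⇒≢ (ℕₚ.<-≤-trans (cb (py , yS)) (ℕₚ.m≤m+n a (d x))) (≡sym e)
    ... | no x∉S | no y∉S = dp (px , x∉S) (py , y∉S) xy ∘ ℕₚ.+-cancelˡ-≡ a _ _

  col-glue : ∀ {P Q} (S : Sub) (c : ColP (λ x → P x × x ∈ S) Q) (d : ColP (λ x → P x × x ∉ S) Q) →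
             (∀ {x y} → P x → x ∈ S → P y → y ∉ S → x ~ y → colour c x ≢ colour d y) → ColP P Q
  col-glue {P} {Q} S (colouring c cb cp) (colouring d db dp) across = colouring (merge S c d) bound prop
    where
    bound : ∀ {x} → P x → Q x (merge S c d x)
    bound {x} px with mem S x
    ... | yes xS = cb (px , xS)
    ... | no x∉S = db (px , x∉S)
    prop : Proper P (merge S c d)
    prop {x} {y} px py xy with mem S x | mem S y
    ... | yes xS | yes yS = cp (px , xS) (py , yS) xy
    ... | yes xS | no y∉S = across px xS py y∉S xy
    ... | no x∉S | yes yS = λ e → across py yS px x∉S (A-sym xy) (≡sym e)
    ... | no x∉S | no y∉S = dp (px , x∉S) (py , y∉S) xy

  col-apart : ∀ {P Q} (S : Sub) → (∀ {x y} → P x → x ∈ S → P y → y ∉ S → x ≁ y) →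
              ColP (λ x → P x × x ∈ S) Q → ColP (λ x → P x × x ∉ S) Q → ColP P Q
  col-apart S apart c d = col-glue S c d λ px xS py y∉S xy → ⊥-elim (clash xy (apart px xS py y∉S))

  col-classes : ∀ {P a b} (α : V → ℕ) → (∀ {x} → P x → α x < a) →
                (∀ i → Col (λ x → P x × α x ≡ i) b) → Col P (a * b)
  col-classes {P} {a} {b} α α< inner = colouring c bound prop
    where
    c : V → ℕ
    c x = α x * b + colour (inner (α x)) x
    inner< : ∀ {x} → P x → colour (inner (α x)) x < b
    inner< {x} px = within (inner (α x)) (px , refl)
    bound : ∀ {x} → P x → c x < a * b
    bound px = encode-bound (α< px) (inner< px)
    prop : Proper P c
    prop {x} {y} px py xy e with encode-injective b (inner< px) (inner< py) e
    ... | αe , ie = is-proper (inner (α x)) (px , refl) (py , ≡sym αe) xy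
                      (trans ie (cong (λ i → colour (inner i) y) (≡sym αe)))

  Closed : Sub → Sub → Set
  Closed C U = ∀ {x y} → x ∈ C → y ∈ U → y ∉ C → x ≁ y

  -- Components are taken in U while only the part in R is coloured, because what is known about a
  -- component need not survive intersection with R. The induction runs over unions of components.
  col-components : ∀ {Q} R U →
    (∀ C → C ⊆ U → Conn true C → Closed C U → ∃ ⟦ C ⟧ → ColP ⟦ C ∩ R ⟧ Q) → ColP ⟦ U ∩ R ⟧ Q
  col-components {Q} R U byComp =
    sub-induction (λ C → C ⊆ U → Closed C U → ColP ⟦ C ∩ R ⟧ Q) step U id λ _ yU y∉U → ⊥-elim (y∉U yU)
    where
    step : ∀ C → (∀ C′ → C′ ⊆ C → (∃[ z ] z ∈ C × z ∉ C′) → C′ ⊆ U → Closed C′ U → ColP ⟦ C′ ∩ R ⟧ Q) →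
           C ⊆ U → Closed C U → ColP ⟦ C ∩ R ⟧ Q
    step C ih C⊆U closed with split-or-conn true C
    ... | inj₁ (S , (x , xC , xS) , (y , yC , y∉S) , apart) =
      col-apart S (λ (x , _) xS (y , _) y∉S → apart x xS y y∉S)
        (col-⊆ (λ ((x , r) , s) → (x , s) , r) (ih (C ∩ S) proj₁ (y , yC , y∉S ∘ proj₂) (C⊆U ∘ proj₁) in-S))
        (col-⊆ (λ ((x , r) , s) → (x , s) , r) (ih (C ∖ S) proj₁ (x , xC , λ (_ , x∉S) → x∉S xS) (C⊆U ∘ proj₁) out-S))
      where
      in-S : Closed (C ∩ S) U
      in-S {_} {y} (xC , xS) yU y∉ with mem C y
      ... | yes yC = apart xC xS yC λ yS → y∉ (yC , yS)
      ... | no y∉C = closed xC yU y∉C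
      out-S : Closed (C ∖ S) U
      out-S {_} {y} (xC , x∉S) yU y∉ with mem C y | mem S y
      ... | yes yC | yes yS = A-sym (apart yC yS xC x∉S)
      ... | yes yC | no y∉S = ⊥-elim (y∉ (yC , y∉S))
      ... | no y∉C | _      = closed xC yU y∉C
    ... | inj₂ conn with inhab? C
    ...   | yes inh = byComp C C⊆U conn closed inh
    ...   | no empty = col-empty λ (x , xC , _) → empty (x , xC)

  TriFree : (V → Set) → Set
  TriFree P = ∀ {x y z} → P x → P y → P z → x ~ y → y ~ z → x ~ z → ⊥

  MaxStable : Sub → Sub → Set
  MaxStable S U = S ⊆ U × (∀ {x y} → x ∈ S → y ∈ S → x ≁ y) ×
                  (∀ {x} → x ∈ U → x ∉ S → ∃[ s ] s ∈ S × s ~ x)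

  maximal-stable : ∀ U → Σ Sub λ S → MaxStable S U
  maximal-stable = sub-induction (λ U → Σ Sub λ S → MaxStable S U) step
    where
    step : ∀ U → (∀ U′ → U′ ⊆ U → (∃[ z ] z ∈ U × z ∉ U′) → Σ Sub λ S → MaxStable S U′) →
           Σ Sub λ S → MaxStable S U
    step U ih with inhab? U
    ... | no empty = U , id , (λ xU _ → ⊥-elim (empty (_ , xU))) , λ xU _ → ⊥-elim (empty (_ , xU))
    ... | yes (v , vU) with ih (U ∖ ｛ v ｝ ∖ N v) (proj₁ ∘ proj₁) (v , vU , λ ((_ , v≢v) , _) → v≢v refl)
    ...   | S , S⊆ , stable , cover = ｛ v ｝ ∪ S , sub , st , cov
      where
      far : ∀ {x} → x ∈ S → v ≁ x
      far xS = not~ (proj₂ (S⊆ xS))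
      sub : ｛ v ｝ ∪ S ⊆ U
      sub (inj₁ refl) = vU
      sub (inj₂ xS)   = proj₁ (proj₁ (S⊆ xS))
      st : ∀ {x y} → x ∈ ｛ v ｝ ∪ S → y ∈ ｛ v ｝ ∪ S → x ≁ y
      st (inj₁ refl) (inj₁ refl) = irrefl G v
      st (inj₁ refl) (inj₂ yS)   = far yS
      st (inj₂ xS)   (inj₁ refl) = A-sym (far xS)
      st (inj₂ xS)   (inj₂ yS)   = stable xS yS
      cov : ∀ {x} → x ∈ U → x ∉ ｛ v ｝ ∪ S → ∃[ s ] s ∈ ｛ v ｝ ∪ S × s ~ x
      cov {x} xU x∉ with ~? v x
      ... | inj₁ vx = v , inj₁ refl , vx
      ... | inj₂ vx with cover ((xU , λ e → x∉ (inj₁ e)) , λ q → clash q vx) (x∉ ∘ inj₂)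
      ...   | s , sS , sx = s , inj₂ sS , sx

-- Bull-free graphs: from neighbourhoods to the whole set

NoBull : Graph → Set
NoBull G = ∀ {x y z p q} → x ~ y → y ~ z → x ~ z → p ~ x → q ~ y →
             p ≁ y → p ≁ z → q ≁ x → q ≁ z → p ≁ q → ⊥
  where open VertexSets G

module StableTraces (G : Graph) (noBull : NoBull G) where
  open Colourings G

  module _ (U S : Sub) (S-max : MaxStable S U) where
    private
      S⊆U = proj₁ S-max
      stable = proj₁ (proj₂ S-max)
      dominates = proj₂ (proj₂ S-max)

    H : Sub
    H = U ∖ S

    -- compares the traces N x ∩ S and N y ∩ S
    _⊈_ : V → V → Set
    x ⊈ y = ∃[ s ] s ∈ S × s ~ x × s ≁ y

    ⊈? : ∀ x y → Dec (x ⊈ y)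
    ⊈? x y = Finₚ.any? λ s → mem S s ×-dec (A s x Bₚ.≟ true) ×-dec (A s y Bₚ.≟ false)

    ⊑-use : ∀ {x y s} → ¬ x ⊈ y → s ∈ S → s ~ x → s ~ y
    ⊑-use {x} {y} {s} h sS sx with ~? s y
    ... | inj₁ sy = sy
    ... | inj₂ sy = ⊥-elim (h (s , sS , sx , sy))

    _≺_ : V → V → Set
    x ≺ y = x ~ y × ¬ x ⊈ y × y ⊈ x

    ≺? : ∀ x y → Dec (x ≺ y)
    ≺? x y = (A x y Bₚ.≟ true) ×-dec ¬? (⊈? x y) ×-dec ⊈? y x

    -- The middle vertex and its two witnesses span a bull unless x ~ z; so ≺-chains are cliques.
    ≺-trans : ∀ {x y z} → x ≺ y → y ≺ z → x ≺ z
    ≺-trans {x} {y} {z} (xy , x⊑y , t , tS , ty , tx) (yz , y⊑z , r , rS , rz , ry) =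
      xz , x⊑z , r , rS , rz , rx
      where
      x⊑z : ¬ x ⊈ z
      x⊑z (s , sS , sx , sz) = clash (⊑-use y⊑z sS (⊑-use x⊑y sS sx)) sz
      rx : r ≁ x
      rx = not~ λ q → clash (⊑-use x⊑y rS q) ry
      xz : x ~ z
      xz with ~? x z
      ... | inj₁ e = e
      ... | inj₂ e = ⊥-elim (noBull (A-sym yz) (A-sym ty) (A-sym (⊑-use y⊑z tS ty)) rz xy ry
                       (stable rS tS) e (A-sym tx) rx)

    -- There are k vertices above x; by transitivity they form a clique together with x, which keeps
    -- heights below `ω U`.
    Chain : ℕ → V → Set
    Chain zero    x = ⊤
    Chain (suc k) x = ∃[ y ] y ∈ H × x ≺ y × Chain k y

    Chain? : ∀ k x → Dec (Chain k x)
    Chain? zero    x = yes tt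
    Chain? (suc k) x = Finₚ.any? λ y → mem H y ×-dec ≺? x y ×-dec Chain? k y

    Chain⇒HasCl : ∀ k {x} → Chain k x → HasCl k (λ y → y ∈ H × x ≺ y)
    Chain⇒HasCl zero    _ = tt
    Chain⇒HasCl (suc k) (y , yH , x≺y , c) =
      y , (yH , x≺y) , HasCl-⊆ k (λ (zH , y≺z) → (zH , ≺-trans x≺y y≺z) , proj₁ y≺z) (Chain⇒HasCl k c)

    Chain-< : ∀ k {x} → x ∈ H → Chain k x → suc k ≤ ω U
    Chain-< k {x} xH c = ω-max U (x , proj₁ xH ,
      HasCl-⊆ k (λ (yH , x≺y) → proj₁ yH , proj₁ x≺y) (Chain⇒HasCl k c))

    height-data : ∀ x → ∃[ k ] Chain k x × (∀ j → Chain j x → j ≤ k)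
    height-data x = greatest (λ k → Chain k x) (λ k → Chain? k x) tt (n G) λ k c →
      ℕₚ.≮⇒≥ λ n<k → full-bound full
        (Many-⊆ (suc (n G)) (λ _ → tt) (HasCl⇒Many (suc (n G)) (HasCl-≤ n<k (Chain⇒HasCl k c))))

    height : V → ℕ
    height x = proj₁ (height-data x)

    height-≺ : ∀ {x y} → y ∈ H → x ≺ y → height y < height x
    height-≺ {x} {y} yH x≺y =
      proj₂ (proj₂ (height-data x)) _ (y , yH , x≺y , proj₁ (proj₂ (height-data y)))

    -- Two separate witnesses, one at x and one at y, would be the pendants of a bull on the
    -- triangle x y z.
    shared : ∀ {x y z} → x ~ y → y ~ z → x ~ z → x ⊈ z → y ⊈ z → ∃[ s ] s ∈ S × s ~ x × s ~ y × s ≁ z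
    shared {x} {y} {z} xy yz xz (s , sS , sx , sz) (t , tS , ty , tz) with ~? s y | ~? t x
    ... | inj₁ sy | _       = s , sS , sx , sy , sz
    ... | inj₂ _  | inj₁ tx = t , tS , tx , ty , tz
    ... | inj₂ sy | inj₂ tx = ⊥-elim (noBull xy yz xz sx ty sy sz tx tz (stable sS tS))

    -- Each pair of the triangle has a shared witness missing the third vertex. The witness r of y
    -- and z forms a triangle with them, and the other two witnesses are its pendants at y and z.
    no-incomparable-triangle : ∀ {x y z} → x ~ y → y ~ z → x ~ z →
      x ⊈ y → y ⊈ x → x ⊈ z → z ⊈ x → y ⊈ z → z ⊈ y → ⊥
    no-incomparable-triangle xy yz xz x⊈y y⊈x x⊈z z⊈x y⊈z z⊈y
      with shared xy yz xz x⊈z y⊈z | shared xz (A-sym yz) xy x⊈y z⊈y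
         | shared yz (A-sym xz) (A-sym xy) y⊈x z⊈x
    ... | s , sS , _ , sy , sz | t , tS , _ , tz , ty | r , rS , ry , rz , _ =
      noBull yz (A-sym rz) (A-sym ry) sy tz sz (stable sS rS) ty (stable tS rS) (stable sS tS)

    module _ {b} (local : ∀ s → s ∈ U → Col ⟦ U ∩ N s ⟧ b) where

      -- The default value makes the colouring depend on s alone and not on a proof of membership,
      -- so that equal owners give equal colour functions.
      colours : V → V → ℕ
      colours s with mem U s
      ... | yes sU = colour (local s sU)
      ... | no _   = λ _ → 0

      colours-spec : ∀ {s} → s ∈ U → (∀ {x} → x ∈ U ∩ N s → colours s x < b) × Proper ⟦ U ∩ N s ⟧ (colours s)
      colours-spec {s} sU with mem U s
      ... | yes sU′ = within (local s sU′) , is-proper (local s sU′)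
      ... | no s∉U  = ⊥-elim (s∉U sU)

      -- The least neighbour in S is a function of the trace: adjacent vertices with equal traces
      -- lie in the neighbourhood of one owner, whose local colouring separates them.
      owner : V → V
      owner x with Finₚ.any? (λ s → mem S s ×-dec (A s x Bₚ.≟ true))
      ... | yes e = proj₁ (least (λ s → s ∈ S × s ~ x) (λ s → mem S s ×-dec (A s x Bₚ.≟ true)) e)
      ... | no _  = x

      owner-spec : ∀ {x} → x ∈ H → (owner x ∈ S × owner x ~ x) × (∀ s → s ∈ S × s ~ x → owner x Fin.≤ s)
      owner-spec {x} (xU , x∉S) with Finₚ.any? (λ s → mem S s ×-dec (A s x Bₚ.≟ true))
      ... | yes e = proj₂ (least (λ s → s ∈ S × s ~ x) (λ s → mem S s ×-dec (A s x Bₚ.≟ true)) e)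
      ... | no h  = ⊥-elim (h (dominates xU x∉S))

      β : V → ℕ
      β x = colours (owner x) x

      β< : ∀ {x} → x ∈ H → β x < b
      β< xH with owner-spec xH
      ... | (oS , ox) , _ = proj₁ (colours-spec (S⊆U oS)) (proj₁ xH , ox)

      β-equal-traces : ∀ {x y} → x ∈ H → y ∈ H → x ~ y → ¬ x ⊈ y → ¬ y ⊈ x → β x ≢ β y
      β-equal-traces {x} {y} xH yH xy x⊑y y⊑x e with owner-spec xH | owner-spec yH
      ... | (oS , ox) , minx | (pS , py) , miny =
        proj₂ (colours-spec (S⊆U oS)) (proj₁ xH , ox) (proj₁ yH , ⊑-use x⊑y oS ox) xy
          (trans e (cong (λ s → colours s y) (≡sym same)))
        where
        same : owner x ≡ owner y
        same = Finₚ.≤-antisym (minx _ (pS , ⊑-use y⊑x pS py)) (miny _ (oS , ⊑-use x⊑y oS ox))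

      -- Along an edge, equal heights exclude strict inclusion of the traces and equal values of `β`
      -- exclude equality, so the traces are incomparable.
      class-triangle-free : ∀ i j → TriFree (λ x → (x ∈ H × height x ≡ i) × β x ≡ j)
      class-triangle-free i j {x} {y} {z} px py pz xy yz xz = no-incomparable-triangle xy yz xz
        (inc px py xy) (inc py px (A-sym xy)) (inc px pz xz) (inc pz px (A-sym xz))
        (inc py pz yz) (inc pz py (A-sym yz))
        where
        inc : ∀ {x y} → (x ∈ H × height x ≡ i) × β x ≡ j → (y ∈ H × height y ≡ i) × β y ≡ j →
              x ~ y → x ⊈ y
        inc {x} {y} ((xH , hx) , bx) ((yH , hy) , by) xy with ⊈? x y | ⊈? y x
        ... | yes h | _     = h
        ... | no x⊑y | yes y⊈x = ⊥-elim (ℕₚ.<⇒≢ (height-≺ yH (xy , x⊑y , y⊈x)) (trans hy (≡sym hx)))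
        ... | no x⊑y | no y⊑x  = ⊥-elim (β-equal-traces xH yH xy x⊑y y⊑x (trans bx (≡sym by)))

      col-H : ∀ {k} → (∀ T → T ⊆ U → TriFree ⟦ T ⟧ → Col ⟦ T ⟧ k) → Col ⟦ H ⟧ (ω U * (b * k))
      col-H base = col-classes height
        (λ {x} xH → Chain-< (height x) xH (proj₁ (proj₂ (height-data x))))
        λ i → col-classes β (β< ∘ proj₁) λ j →
          base ((λ x → (x ∈ H × height x ≡ i) × β x ≡ j) ∣
                  λ x → (mem H x ×-dec (height x ℕₚ.≟ i)) ×-dec (β x ℕₚ.≟ j))
               (proj₁ ∘ proj₁ ∘ proj₁) (class-triangle-free i j)

  local-to-global : ∀ U {b k} → (∀ T → T ⊆ U → TriFree ⟦ T ⟧ → Col ⟦ T ⟧ k) →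
                    (∀ s → s ∈ U → Col ⟦ U ∩ N s ⟧ b) → Col ⟦ U ⟧ (1 + ω U * (b * k))
  local-to-global U base local with maximal-stable U
  ... | S , S-max = col-∪ S (col-const 0 (λ _ → s≤s z≤n) λ (_ , xS) (_ , yS) → proj₁ (proj₂ S-max) xS yS)
                            (col-H U S S-max local base)

-- Palettes, modules and nice sets

Uniq : List ℕ → Set
Uniq []      = ⊤
Uniq (x ∷ l) = x ∉ₗ l × Uniq l

cut : ∀ k (l : List ℕ) → Uniq l → k ≤ length l →
      ∃[ l₁ ] ∃[ l₂ ] (length l₁ ≡ k × length l₂ ≡ length l ∸ k) × (Uniq l₁ × Uniq l₂) ×
      (∀ {i} → i ∈ₗ l₁ → i ∈ₗ l) × (∀ {i} → i ∈ₗ l₂ → i ∈ₗ l) × (∀ {i} → i ∈ₗ l₁ → i ∉ₗ l₂)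
cut zero    l u _ = [] , l , (refl , refl) , (tt , u) , (λ ()) , id , λ ()
cut (suc k) (x ∷ l) (x∉ , u) (s≤s k≤) with cut k l u k≤
... | l₁ , l₂ , (len₁ , len₂) , (u₁ , u₂) , in₁ , in₂ , dis =
  x ∷ l₁ , l₂ , (cong suc len₁ , len₂) , ((x∉ ∘ in₁ , u₁) , u₂) ,
  (λ { (here e) → here e ; (there p) → there (in₁ p) }) , there ∘ in₂ ,
  λ { (here refl) q → x∉ (in₂ q) ; (there p) q → dis p q }

Uniq-++ : ∀ l {m} → Uniq l → Uniq m → (∀ {i} → i ∈ₗ l → i ∉ₗ m) → Uniq (l ++ m)
Uniq-++ []      _ um _ = um
Uniq-++ (x ∷ l) (x∉ , ul) um dis =
  (λ p → [ x∉ , dis (here refl) ]′ (∈-++⁻ l p)) , Uniq-++ l ul um (dis ∘ there)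

module Modules (G : Graph) where
  open Colourings G public

  IsModule : Sub → Sub → Set
  IsModule D W = D ⊆ W × (∀ {y x x′} → y ∈ W → y ∉ D → x ∈ D → x′ ∈ D → A y x ≡ A y x′)

  unmixed : ∀ {b} D → Conn b D → ∀ y →
            (∀ {e f} → e ∈ D → f ∈ D → y ~ e → y ≁ f → A e f ≡ b → ⊥) →
            ∀ {x x′} → x ∈ D → x′ ∈ D → A y x ≡ A y x′
  unmixed D conn y h {x} {x′} xD x′D with ~? y x | ~? y x′
  ... | inj₁ p | inj₁ q = trans p (≡sym q)
  ... | inj₂ p | inj₂ q = trans p (≡sym q)
  ... | inj₁ p | inj₂ q with mixed-pair {D = D} conn y xD x′D p q
  ...   | e , f , eD , fD , ye , yf , ef = ⊥-elim (h eD fD ye yf ef)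
  unmixed D conn y h {x} {x′} xD x′D | inj₂ p | inj₁ q with mixed-pair {D = D} conn y x′D xD q p
  ...   | e , f , eD , fD , ye , yf , ef = ⊥-elim (h eD fD ye yf ef)

  -- A supply of distinct colours that properness keeps away from everything joined to the clique;
  -- `split-colouring` reuses them.
  clique-colours : ∀ k {P Q} (c : ColP P Q) → HasCl k P →
                   ∃[ l ] length l ≡ k × Uniq l × (∀ {i} → i ∈ₗ l → ∃[ x ] P x × colour c x ≡ i)
  clique-colours zero    c _ = [] , refl , tt , λ ()
  clique-colours (suc k) c (x , px , cl) with clique-colours k (col-⊆ proj₁ c) cl
  ... | l , len , u , back = colour c x ∷ l , cong suc len , (new , u) , back′
    where
    new : colour c x ∉ₗ l
    new p with back p
    ... | y , (py , xy) , e = is-proper c px py xy (≡sym e)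
    back′ : ∀ {i} → i ∈ₗ colour c x ∷ l → _
    back′ (here refl) = x , px , refl
    back′ (there p) with back p
    ... | y , (py , _) , e = y , py , e

  -- In a bull-free graph, a and c make D ∩ N q and D ∖ N q the stable and the complete side of a
  -- split graph of modules.
  Distinguished : Sub → Set
  Distinguished D = ∃[ q ] ∃[ a ] ∃[ c ] (∃[ e ] e ∈ D × q ~ e) × (∃[ f ] f ∈ D × q ≁ f) ×
    (a ~ q × (∀ {x} → x ∈ D → a ≁ x)) × (c ≁ q × (∀ {x} → x ∈ D → c ~ x))

  -- Only modules connected in the graph and in the complement need a distinguisher; the others
  -- decompose into a disjoint union or a join.
  Nice : Sub → Set₁
  Nice D = ∀ D′ → IsModule D′ D → Conn true D′ → Conn false D′ →
           (∃[ x ] ∃[ y ] x ∈ D′ × y ∈ D′ × x ≢ y) → Distinguished D′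

  -- The intersection with U is built in since niceness speaks of modules of D and does not pass to
  -- arbitrary subsets. The palette is prescribed since the induction recolours parts with leftover
  -- colours.
  Perfect : Sub → Set₁
  Perfect D = ∀ U l → Uniq l → ω (D ∩ U) ≤ length l → ColP ⟦ D ∩ U ⟧ λ _ k → k ∈ₗ l

  Nice-⊆ : ∀ C D → (∀ D′ → IsModule D′ C → Conn true D′ → Conn false D′ → IsModule D′ D) → Nice D → Nice C
  Nice-⊆ C D lift nice D′ m ct cf two = nice D′ (lift D′ m ct cf) ct cf two

  Nice-closed : ∀ C D → C ⊆ D → Closed C D → Nice D → Nice C
  Nice-closed C D C⊆D closed = Nice-⊆ C D λ D′ (D′⊆ , m) _ _ →
    (C⊆D ∘ D′⊆) , λ {y} yD y∉ x x′ → case mem C y of λ where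
      (yes yC) → m yC y∉ x x′
      (no y∉C) → trans (A-sym (closed (D′⊆ x) yD y∉C)) (≡sym (A-sym (closed (D′⊆ x′) yD y∉C)))

  Nice-joined : ∀ C D → C ⊆ D → (∀ {x y} → x ∈ C → y ∈ D → y ∉ C → x ~ y) → Nice D → Nice C
  Nice-joined C D C⊆D joined = Nice-⊆ C D λ D′ (D′⊆ , m) _ _ →
    (C⊆D ∘ D′⊆) , λ {y} yD y∉ x x′ → case mem C y of λ where
      (yes yC) → m yC y∉ x x′
      (no y∉C) → trans (A-sym (joined (D′⊆ x) yD y∉C)) (≡sym (A-sym (joined (D′⊆ x′) yD y∉C)))

-- Nice sets are perfect

private
  palette-bound : ∀ {c b w r L} → w ≤ b + r → w ≤ L → c + b ≤ L → c ≤ r + (L ∸ w)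
  palette-bound {c} {b} {w} {r} {L} w≤ w≤L cb = ℕₚ.≤-trans
    (ℕₚ.≤-trans (ℕₚ.≤-reflexive (≡sym (ℕₚ.m+n∸n≡m c w))) (ℕₚ.∸-monoˡ-≤ w c+w≤r+L))
    (ℕₚ.≤-reflexive (ℕₚ.+-∸-assoc r w≤L))
    where
    open ℕₚ.≤-Reasoning
    c+w≤r+L : c + w ≤ r + L
    c+w≤r+L = begin
      c + w       ≤⟨ ℕₚ.+-monoʳ-≤ c w≤ ⟩
      c + (b + r) ≡⟨ ≡sym (ℕₚ.+-assoc c b r) ⟩
      c + b + r   ≤⟨ ℕₚ.+-monoˡ-≤ r cb ⟩
      L + r       ≡⟨ ℕₚ.+-comm L r ⟩
      r + L       ∎

module NiceSets (G : Graph) (noBull : NoBull G) where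
  open Modules G public

  module SplitStep (D : Sub) {q a c : V} (aq : a ~ q) (a-anti : ∀ {x} → x ∈ D → a ≁ x)
                   (c≁q : c ≁ q) (c-full : ∀ {x} → x ∈ D → c ~ x) (nice : Nice D) where
    E W : Sub
    E = D ∩ N q
    W = D ∖ N q

    -- A bull on the triangle q e f with pendants a and y. Hence a vertex of W sees all or nothing
    -- of each component of E.
    E-edges : ∀ {y e f} → y ∈ W → e ∈ E → f ∈ E → e ~ f → y ~ e → y ≁ f → ⊥
    E-edges (yD , y≁) (eD , qe) (fD , qf) ef ye yf =
      noBull qe ef qf aq ye (a-anti eD) (a-anti fD) (A-sym (not~ y≁)) yf (a-anti yD)

    -- Otherwise the triangle x c p with pendants q at x and r at c is a bull. Hence the neighbours
    -- of x in W are joined to its non-neighbours in W.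
    W-joined : ∀ {x p r} → x ∈ E → p ∈ W → r ∈ W → x ~ p → x ≁ r → p ~ r
    W-joined {x} {p} {r} (xD , qx) (pD , p≁) (rD , r≁) xp xr with ~? p r
    ... | inj₁ pr = pr
    ... | inj₂ pr = ⊥-elim (noBull (A-sym (c-full xD)) (c-full pD) xp qx (A-sym (c-full rD))
                      (A-sym c≁q) (not~ p≁) (A-sym xr) (A-sym pr) (not~ r≁))

    -- By `E-edges` a connected module of E is uniform from W as well, hence a module of D. In
    -- `Nice-W` co-connectedness does the same through `W-joined`.
    Nice-E : Nice E
    Nice-E = Nice-⊆ E D (λ D′ (D′⊆ , m) ct _ → (proj₁ ∘ D′⊆) , λ {y} yD y∉ → case mem (N q) y of λ where
      (yes qy) → m (yD , qy) y∉
      (no qy)  → unmixed D′ ct y λ e f ye yf ef → E-edges (yD , qy) (D′⊆ e) (D′⊆ f) ef ye yf) nice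

    Nice-W : Nice W
    Nice-W = Nice-⊆ W D (λ D′ (D′⊆ , m) _ cf → (proj₁ ∘ D′⊆) , λ {y} yD y∉ → case mem (N q) y of λ where
      (no qy)  → m (yD , qy) y∉
      (yes qy) → unmixed D′ cf y λ e f ye yf ef →
        clash (W-joined (yD , qy) (D′⊆ e) (D′⊆ f) ye yf) ef) nice

    module _ (U : Sub) (l : List ℕ) (ul : Uniq l) (bound : ω (D ∩ U) ≤ length l)
             (perf-W : Perfect W) (perf-C : ∀ C → C ⊆ E → Nice C → Perfect C) where

      WU≤ : ω (W ∩ U) ≤ length l
      WU≤ = ℕₚ.≤-trans (ω-mono (W ∩ U) (D ∩ U) λ ((x , _) , u) → x , u) bound

      -- W takes as few colours as possible. All vertices of a component C of E have the same
      -- neighbourhood B in W, which is joined to the rest of W; so C may use the colours left over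
      -- by W and also those of a largest clique of W outside B.
      split-colouring : ColP ⟦ D ∩ U ⟧ λ _ k → k ∈ₗ l
      split-colouring with cut (ω (W ∩ U)) l ul WU≤
      ... | l₁ , l₂ , (len₁ , len₂) , (u₁ , u₂) , in₁ , in₂ , dis = col-glue (N q)
          (col-⊆ (λ ((d , u) , n) → (d , n) , u) (colouring (colour E-col) (proj₁ ∘ within E-col) (is-proper E-col)))
          (col-⊆ (λ ((d , u) , n) → (d , n) , u) (colouring (colour W-col) (in₁ ∘ within W-col) (is-proper W-col)))
          λ (xD , xU) qx (yD , yU) qy xy e →
            proj₂ (within E-col ((xD , qx) , xU)) ((yD , qy) , yU) xy (≡sym e)
        where
        W-col : ColP ⟦ W ∩ U ⟧ λ _ k → k ∈ₗ l₁
        W-col = perf-W U l₁ u₁ (ℕₚ.≤-reflexive (≡sym len₁))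
        -- Conflicts with W are excluded inside the bound, so that they survive the gluing of
        -- components.
        Q : V → ℕ → Set
        Q x k = k ∈ₗ l × (∀ {y} → y ∈ W ∩ U → x ~ y → colour W-col y ≢ k)
        E-col : ColP ⟦ E ∩ U ⟧ Q
        E-col = col-components U E λ C C⊆E conn closed (x₀ , x₀C) →
          let B = N x₀
              same : ∀ {x y} → x ∈ C → y ∈ W → A y x ≡ A y x₀
              same xC yW = unmixed C conn _ (λ e f ye yf ef → E-edges yW (C⊆E e) (C⊆E f) ef ye yf) xC x₀C
              (k , len , uk , back) = clique-colours _ (col-⊆ proj₁ W-col) (ω-has (W ∩ U ∖ B))
              back₁ : ∀ {i} → i ∈ₗ k → i ∈ₗ l₁
              back₁ p = let (z , (zW , _) , e) = back p in subst (_∈ₗ l₁) e (within W-col zW)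
              -- C and B are joined, so their clique numbers add up to at most the length of the
              -- palette, while the clique number of W is at most that of B plus the number of
              -- reused colours.
              fits : ω (C ∩ U) ≤ length (k ++ l₂)
              fits = ℕₚ.≤-trans
                (palette-bound {b = ω (W ∩ U ∩ B)}
                  (ω-split-∖ (W ∩ U) B) WU≤
                  (ℕₚ.≤-trans (ω-join (C ∩ U) (W ∩ U ∩ B) (D ∩ U)
                    (λ (xC , _) ((yW , _) , x₀y) → A-sym (trans (same xC yW) (A-sym x₀y)))
                    (λ (xC , xU) → proj₁ (C⊆E xC) , xU) (λ (((y , _) , yU) , _) → y , yU)) bound))
                (ℕₚ.≤-reflexive (≡sym (trans (length-++ k) (cong₂ _+_ len len₂))))
              col = perf-C C C⊆E (Nice-closed C E C⊆E closed Nice-E) U (k ++ l₂)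
                      (Uniq-++ k uk u₂ (dis ∘ back₁)) fits
          in colouring (colour col)
               (λ {x} xCU → let i∈ = within col xCU in
                 [ in₁ ∘ back₁ , in₂ ]′ (∈-++⁻ k i∈) ,
                 λ {y} yWU xy e → [ (λ p → let (z , (zWU , z≁) , ez) = back p in
                     is-proper W-col yWU zWU
                       (W-joined (C⊆E x₀C) (proj₁ yWU) (proj₁ zWU)
                         (A-sym (trans (≡sym (same (proj₁ xCU) (proj₁ yWU))) (A-sym xy))) (not~ z≁))
                       (trans e (≡sym ez)))
                   , (λ p → dis (within W-col yWU) (subst (_∈ₗ l₂) (≡sym e) p)) ]′ (∈-++⁻ k i∈))
               (is-proper col)
          where
          ω-split-∖ : ∀ X B → ω X ≤ ω (X ∩ B) + ω (X ∖ B)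
          ω-split-∖ X B = ℕₚ.≤-trans (ω-split X B (full ∖ B) λ {x} _ → case mem B x of λ where
              (yes p) → inj₁ p
              (no p)  → inj₂ (tt , p))
            (ℕₚ.+-monoʳ-≤ (ω (X ∩ B)) (ω-mono (X ∩ (full ∖ B)) (X ∖ B) λ (x , _ , b) → x , b))

  -- Components share the palette and joined parts divide it. Otherwise D, if not a single vertex,
  -- is a nontrivial module of itself, and niceness supplies the vertices for `SplitStep`.
  nice⇒perfect : ∀ D → Nice D → Perfect D
  nice⇒perfect = sub-induction (λ D → Nice D → Perfect D) step
    where
    step : ∀ D → (∀ D′ → D′ ⊆ D → (∃[ z ] z ∈ D × z ∉ D′) → Nice D′ → Perfect D′) → Nice D → Perfect D
    step D ih nice U l ul bound with split-or-conn true D | split-or-conn false D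
    ... | inj₁ (S , (x , xD , xS) , (y , yD , y∉S) , apart) | _ =
      col-apart S (λ (xD , _) xS (yD , _) y∉S → apart xD xS yD y∉S)
        (col-⊆ (λ ((d , u) , s) → (d , s) , u)
          (ih (D ∩ S) proj₁ (y , yD , y∉S ∘ proj₂)
            (Nice-closed (D ∩ S) D proj₁ (λ (xD , xS) yD y∉ → apart xD xS yD λ yS → y∉ (yD , yS)) nice)
            U l ul (ℕₚ.≤-trans (ω-mono (D ∩ S ∩ U) (D ∩ U) λ ((d , _) , u) → d , u) bound)))
        (col-⊆ (λ ((d , u) , s) → (d , s) , u)
          (ih (D ∖ S) proj₁ (x , xD , λ (_ , x∉S) → x∉S xS)
            (Nice-closed (D ∖ S) D proj₁ (λ {_} {y} (xD , x∉S) yD y∉ → A-sym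
              (apart yD (decidable-stable (mem S y) λ y∉S → y∉ (yD , y∉S)) xD x∉S)) nice)
            U l ul (ℕₚ.≤-trans (ω-mono (D ∖ S ∩ U) (D ∩ U) λ ((d , _) , u) → d , u) bound)))
    ... | inj₂ _ | inj₁ (S , (x , xD , xS) , (y , yD , y∉S) , joined)
      with cut (ω (D ∩ S ∩ U)) l ul (ℕₚ.≤-trans (ω-mono (D ∩ S ∩ U) (D ∩ U) λ ((d , _) , u) → d , u) bound)
    ...   | l₁ , l₂ , (len₁ , len₂) , (u₁ , u₂) , in₁ , in₂ , dis =
      col-glue S (colouring (colour c₁) (in₁ ∘ within c₁ ∘ swap) λ p r → is-proper c₁ (swap p) (swap r))
                 (colouring (colour c₂) (in₂ ∘ within c₂ ∘ swap) λ p r → is-proper c₂ (swap p) (swap r))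
        λ (xD , xU) xS (yD , yU) y∉S xy e →
          dis (within c₁ ((xD , xS) , xU)) (subst (_∈ₗ l₂) (≡sym e) (within c₂ ((yD , y∉S) , yU)))
      where
      swap : ∀ {P Q R : Set} → (P × Q) × R → (P × R) × Q
      swap ((p , q) , r) = (p , r) , q
      c₁ : ColP ⟦ D ∩ S ∩ U ⟧ λ _ k → k ∈ₗ l₁
      c₁ = ih (D ∩ S) proj₁ (y , yD , y∉S ∘ proj₂)
        (Nice-joined (D ∩ S) D proj₁ (λ (xD , xS) yD y∉ → joined xD xS yD λ yS → y∉ (yD , yS)) nice)
        U l₁ u₁ (ℕₚ.≤-reflexive (≡sym len₁))
      c₂ : ColP ⟦ D ∖ S ∩ U ⟧ λ _ k → k ∈ₗ l₂
      c₂ = ih (D ∖ S) proj₁ (x , xD , λ (_ , x∉S) → x∉S xS)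
        (Nice-joined (D ∖ S) D proj₁ (λ {_} {y} (xD , x∉S) yD y∉ → A-sym
              (joined yD (decidable-stable (mem S y) λ y∉S → y∉ (yD , y∉S)) xD x∉S)) nice)
        U l₂ u₂ (ℕₚ.≤-trans (ℕₚ.≤-trans (ℕₚ.m+n≤o⇒m≤o∸n (ω (D ∖ S ∩ U)) (ℕₚ.≤-trans
            (ℕₚ.≤-reflexive (ℕₚ.+-comm (ω (D ∖ S ∩ U)) (ω (D ∩ S ∩ U))))
            (ω-join (D ∩ S ∩ U) (D ∖ S ∩ U) (D ∩ U)
              (λ ((xD , xS) , _) ((yD , y∉S) , _) → joined xD xS yD y∉S)
              (λ ((d , _) , u) → d , u) λ ((d , _) , u) → d , u)))
          (ℕₚ.∸-monoˡ-≤ (ω (D ∩ S ∩ U)) bound)) (ℕₚ.≤-reflexive (≡sym len₂)))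
    step D ih nice U l ul bound | inj₂ ct | inj₂ cf with two? D
    ...   | yes two with nice D (id , λ yD y∉D → ⊥-elim (y∉D yD)) ct cf two
    ...     | q , a , c , (e , eD , qe) , (f , fD , qf) , (aq , a-anti) , (c≁q , c-full) =
      split-colouring U l ul bound (ih W proj₁ (e , eD , λ (_ , h) → h qe) Nice-W)
        λ C C⊆E → ih C (proj₁ ∘ C⊆E) (f , fD , λ fC → clash (proj₂ (C⊆E fC)) qf)
      where open SplitStep D aq a-anti c≁q c-full nice
    step D ih nice U l ul bound | inj₂ ct | inj₂ cf | no ¬two with inhab? (D ∩ U) | l
    ...     | no empty | _ = col-empty empty
    ...     | yes (x , xDU) | [] = ⊥-elim (ℕₚ.<⇒≱ (ω-pos (D ∩ U) xDU) bound)
    ...     | yes (x , xDU) | k ∷ _ = col-const k (λ _ → here refl) λ {y} (yD , _) (zD , _) →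
      subst (y ≁_) (one {D} ¬two yD zD) (irrefl G y)

-- Induced copies of bulls and sunspots

module Patterns (G : Graph) where
  open VertexSets G

  Row : ∀ k → (Fin k → Bool) → V → (Fin k → V) → Set
  Row zero    r v g = ⊤
  Row (suc k) r v g = A v (g Fin.zero) ≡ r Fin.zero × Row k (r ∘ Fin.suc) v (g ∘ Fin.suc)

  -- Only the entries above the diagonal are demanded; symmetry and irreflexivity supply the others.
  Matches : ∀ k → (Fin k → Fin k → Bool) → (Fin k → V) → Set
  Matches zero    h f = ⊤
  Matches (suc k) h f = Row k (h Fin.zero ∘ Fin.suc) (f Fin.zero) (f ∘ Fin.suc) ×
                        Matches k (λ i j → h (Fin.suc i) (Fin.suc j)) (f ∘ Fin.suc)

  row-at : ∀ k {r v g} → Row k r v g → ∀ i → A v (g i) ≡ r i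
  row-at (suc k) (e , _) Fin.zero    = e
  row-at (suc k) (_ , m) (Fin.suc i) = row-at k m i

  matches-at : ∀ k {h f} → Matches k h f → (∀ i j → h i j ≡ h j i) → (∀ i → h i i ≡ false) →
               ∀ i j → h i j ≡ A (f i) (f j)
  matches-at (suc k) m       h-sym h-irr Fin.zero    Fin.zero    = trans (h-irr _) (≡sym (irrefl G _))
  matches-at (suc k) (r , _) h-sym h-irr Fin.zero    (Fin.suc j) = ≡sym (row-at k r j)
  matches-at (suc k) (r , _) h-sym h-irr (Fin.suc i) Fin.zero    =
    trans (h-sym _ _) (≡sym (A-sym (row-at k r i)))
  matches-at (suc k) (_ , m) h-sym h-irr (Fin.suc i) (Fin.suc j) =
    matches-at k m (λ i j → h-sym _ _) (λ i → h-irr _) i j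

  -- Injectivity is automatic when no two vertices of the pattern are twins.
  copy : ∀ k {h f} → Matches k h f → (∀ i j → h i j ≡ h j i) → (∀ i → h i i ≡ false) →
         (∀ i j → (∀ l → h i l ≡ h j l) → i ≡ j) → InducedCopy k h G
  copy k {h} {f} m h-sym h-irr twinless = f , inj , eq
    where
    eq = matches-at k m h-sym h-irr
    inj : ∀ {i j} → f i ≡ f j → i ≡ j
    inj {i} {j} e = twinless i j λ l → trans (eq i l) (trans (cong (λ x → A x (f l)) e) (≡sym (eq j l)))

  symmetric? : ∀ {k} (h : Fin k → Fin k → Bool) → Dec (∀ i j → h i j ≡ h j i)
  symmetric? h = Finₚ.all? λ i → Finₚ.all? λ j → h i j Bₚ.≟ h j i

  irreflexive? : ∀ {k} (h : Fin k → Fin k → Bool) → Dec (∀ i → h i i ≡ false)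
  irreflexive? h = Finₚ.all? λ i → h i i Bₚ.≟ false

  twinless? : ∀ {k} (h : Fin k → Fin k → Bool) → Dec (∀ i j → (∀ l → h i l ≡ h j l) → i ≡ j)
  twinless? h = Finₚ.all? λ i → Finₚ.all? λ j →
    Finₚ.all? (λ l → h i l Bₚ.≟ h j l) →-dec (i Finₚ.≟ j)

  noBull : Free 5 bull G → NoBull G
  noBull free {x} {y} {z} {p} {q} xy yz xz px qy py pz qx qz pq = free
    (copy 5 {f = lookup (x ∷ᵥ y ∷ᵥ z ∷ᵥ p ∷ᵥ q ∷ᵥ []ᵥ)}
      ((xy , xz , A-sym px , A-sym qx , tt) , (yz , A-sym py , A-sym qy , tt) , (A-sym pz , A-sym qz , tt) ,
       (pq , tt) , tt , tt)
      (from-yes (symmetric? bull)) (from-yes (irreflexive? bull)) (from-yes (twinless? bull)))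

-- a b c d is an induced four-cycle; x, y, z are attached to the consecutive vertices a, b, c.
NoSunspot : Graph → Set
NoSunspot G = ∀ {a b c d x y z} → a ~ b → b ~ c → c ~ d → d ~ a → a ≁ c → b ≁ d →
  x ~ a → y ~ b → z ~ c → x ≁ b → x ≁ c → x ≁ d → y ≁ a → y ≁ c → y ≁ d → z ≁ a → z ≁ b → z ≁ d →
  x ≁ y → y ≁ z → x ≁ z → ⊥
  where open VertexSets G

noSunspot : ∀ G → Free (4 + 4 ∸ 1) (sunspot 4) G → NoSunspot G
noSunspot G free {a} {b} {c} {d} {x} {y} {z} ab bc cd da ac bd xa yb zc xb xc xd ya yc yd za zb zd xy yz xz =
  free (copy 7 {f = lookup (a ∷ᵥ b ∷ᵥ c ∷ᵥ d ∷ᵥ x ∷ᵥ y ∷ᵥ z ∷ᵥ []ᵥ)}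
    ((ab , ac , A-sym da , A-sym xa , A-sym ya , A-sym za , tt) ,
     (bc , bd , A-sym xb , A-sym yb , A-sym zb , tt) ,
     (cd , A-sym xc , A-sym yc , A-sym zc , tt) ,
     (A-sym xd , A-sym yd , A-sym zd , tt) , (xy , xz , tt) , (yz , tt) , tt , tt)
    (from-yes (symmetric? (sunspot 4))) (from-yes (irreflexive? (sunspot 4)))
    (from-yes (twinless? (sunspot 4))))
  where
  open VertexSets G
  open Patterns G

-- Breadth-first levels

module Layerings (G : Graph) where
  open VertexSets G

  -- Distances from v inside the connected set Y.
  record Layering (Y : Sub) (v : V) : Set where
    field
      d      : V → ℕ
      root   : ∀ {x} → x ∈ Y → d x ≡ 0 → x ≡ v
      parent : ∀ {x k} → x ∈ Y → d x ≡ suc k → ∃[ p ] p ∈ Y × p ~ x × d p ≡ k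
      step   : ∀ {x y} → x ∈ Y → y ∈ Y → x ~ y → d y ≤ suc (d x)

    far : ∀ {x y} → x ∈ Y → y ∈ Y → 2 + d x ≤ d y → x ≁ y
    far xY yY gap = not~ λ xy → ℕₚ.<⇒≱ gap (step xY yY xy)

    ancestor : ∀ k {x} → x ∈ Y → d x ≡ k → ∃[ y ] y ∈ Y × d y ≡ 0
    ancestor zero    xY dx = _ , xY , dx
    ancestor (suc k) xY dx with parent xY dx
    ... | p , pY , _ , dp = ancestor k pY dp

    d-root : ∀ {x} → x ∈ Y → d v ≡ 0
    d-root {x} xY with ancestor (d x) xY refl
    ... | y , yY , dy = trans (cong d (≡sym (root yY dy))) dy

    level : ℕ → Sub
    level m = (λ x → x ∈ Y × d x ≡ m) ∣ λ x → mem Y x ×-dec (d x ℕₚ.≟ m)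

  module _ (Y : Sub) (conn : Conn true Y) (v : V) (vY : v ∈ Y) where

    private
      -- The invariant of breadth-first search: P is the ball of radius k, and `settled` says that
      -- only its outermost level can have neighbours in Y outside P.
      record Partial (k : ℕ) (P : Sub) : Set where
        field
          d       : V → ℕ
          vP      : v ∈ P
          P⊆Y     : P ⊆ Y
          d≤k     : ∀ {x} → x ∈ P → d x ≤ k
          root    : ∀ {x} → x ∈ P → d x ≡ 0 → x ≡ v
          parent  : ∀ {x k} → x ∈ P → d x ≡ suc k → ∃[ p ] p ∈ P × p ~ x × d p ≡ k
          step    : ∀ {x y} → x ∈ P → y ∈ P → x ~ y → d y ≤ suc (d x)
          settled : ∀ {x y} → x ∈ P → d x < k → y ∈ Y → x ~ y → y ∈ P

      front : Sub → Sub
      front P = (λ y → (y ∈ Y × y ∉ P) × ∃[ x ] x ∈ P × x ~ y) ∣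
                λ y → mem (Y ∖ P) y ×-dec Finₚ.any? λ x → mem P x ×-dec (A x y Bₚ.≟ true)

      extend : ∀ {k P} → Partial k P → Partial (suc k) (P ∪ front P)
      extend {k} {P} L = record
        { d = d′ ; vP = inj₁ vP ; P⊆Y = [ P⊆Y , proj₁ ∘ proj₁ ]′ ; d≤k = d′≤ ; root = root′
        ; parent = parent′ ; step = step′ ; settled = settled′ }
        where
        open Partial L
        d′ : V → ℕ
        d′ x with mem P x
        ... | yes _ = d x
        ... | no _  = suc k
        d′-old : ∀ {x} → x ∈ P → d′ x ≡ d x
        d′-old {x} xP with mem P x
        ... | yes _ = refl
        ... | no x∉ = ⊥-elim (x∉ xP)
        d′-new : ∀ {x} → x ∈ front P → d′ x ≡ suc k
        d′-new {x} ((_ , x∉) , _) with mem P x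
        ... | yes xP = ⊥-elim (x∉ xP)
        ... | no _   = refl
        last : ∀ {x y} → x ∈ P → y ∈ front P → x ~ y → d x ≡ k
        last xP ((yY , y∉) , _) xy = ℕₚ.≤-antisym (d≤k xP) (ℕₚ.≮⇒≥ λ lt → y∉ (settled xP lt yY xy))
        d′≤ : ∀ {x} → x ∈ P ∪ front P → d′ x ≤ suc k
        d′≤ (inj₁ xP) = subst (_≤ suc k) (≡sym (d′-old xP)) (ℕₚ.m≤n⇒m≤1+n (d≤k xP))
        d′≤ (inj₂ xF) = ℕₚ.≤-reflexive (d′-new xF)
        root′ : ∀ {x} → x ∈ P ∪ front P → d′ x ≡ 0 → x ≡ v
        root′ (inj₁ xP) e = root xP (trans (≡sym (d′-old xP)) e)
        root′ (inj₂ xF) e = case trans (≡sym (d′-new xF)) e of λ ()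
        parent′ : ∀ {x j} → x ∈ P ∪ front P → d′ x ≡ suc j → ∃[ p ] p ∈ P ∪ front P × p ~ x × d′ p ≡ j
        parent′ (inj₁ xP) e with parent xP (trans (≡sym (d′-old xP)) e)
        ... | p , pP , px , dp = p , inj₁ pP , px , trans (d′-old pP) dp
        parent′ (inj₂ xF@(_ , p , pP , px)) e =
          p , inj₁ pP , px , trans (d′-old pP) (trans (last pP xF px)
            (ℕₚ.suc-injective (trans (≡sym (d′-new xF)) e)))
        step′ : ∀ {x y} → x ∈ P ∪ front P → y ∈ P ∪ front P → x ~ y → d′ y ≤ suc (d′ x)
        step′ (inj₁ xP) (inj₁ yP) xy rewrite d′-old xP | d′-old yP = step xP yP xy
        step′ (inj₁ xP) (inj₂ yF) xy rewrite d′-old xP | d′-new yF | last xP yF xy = ℕₚ.≤-refl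
        step′ (inj₂ xF) (inj₁ yP) xy rewrite d′-new xF | d′-old yP =
          ℕₚ.m≤n⇒m≤1+n (ℕₚ.m≤n⇒m≤1+n (d≤k yP))
        step′ (inj₂ xF) (inj₂ yF) xy rewrite d′-new xF | d′-new yF = ℕₚ.n≤1+n (suc k)
        settled′ : ∀ {x y} → x ∈ P ∪ front P → d′ x < suc k → y ∈ Y → x ~ y → y ∈ P ∪ front P
        settled′ {x} {y} (inj₁ xP) lt yY xy with mem P y
        ... | yes yP = inj₁ yP
        ... | no y∉  = inj₂ ((yY , y∉) , x , xP , xy)
        settled′ (inj₂ xF) lt yY xy = ⊥-elim (ℕₚ.<⇒≢ lt (d′-new xF))

      grow : ∀ m {k P} → Y ∖ P ≲ m → Partial k P → Layering Y v
      grow m {k} {P} left L with inhab? (front P)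
      ... | no none = record
        { d = d ; root = root ∘ Y⊆P
        ; parent = λ xY e → let (p , pP , px , dp) = parent (Y⊆P xY) e in p , P⊆Y pP , px , dp
        ; step = λ xY yY → step (Y⊆P xY) (Y⊆P yY) }
        where
        open Partial L
        -- With an empty front no edge of the connected set Y leaves P.
        Y⊆P : Y ⊆ P
        Y⊆P yY = decidable-stable (mem P _) λ y∉ → let (e , f , (_ , eP) , fY , ef) = conn P vY vP yY y∉ in
          none (f , fY , e , eP , ef)
      grow zero    left L | yes (z , zF) = ⊥-elim (left (z , proj₁ zF , tt))
      grow (suc m) {P = P} left L | yes (z , zF) =
        grow m (shrink (Y ∖ (P ∪ front P)) (Y ∖ P) z (proj₁ zF) (λ (_ , h) → h (inj₂ zF))
                 (λ (yY , h) → yY , h ∘ inj₁) left) (extend L)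

    layering : Layering Y v
    layering = grow (n G) {0} {｛ v ｝} (full-bound (Y ∖ ｛ v ｝)) record
      { d = λ _ → 0 ; vP = refl ; P⊆Y = λ { refl → vY } ; d≤k = λ _ → z≤n ; root = λ e _ → e
      ; parent = λ _ () ; step = λ _ _ _ → z≤n ; settled = λ _ () }

-- Ladders of four-cycles in sunspot-free graphs

module Ladders (G : Graph) (noSunspot : NoSunspot G) where
  open VertexSets G
  open Layerings G

  module _ {Y : Sub} {v : V} (L : Layering Y v) where
    open Layering L

    -- The one fact about common parents that the climb uses. It is immediate in triangle-free sets
    -- and follows from bull-freeness in the layering of a prime graph, so the ladder serves both.
    PrivateParents : Set
    PrivateParents = ∀ {p r p′ n} → p ∈ Y → r ∈ Y → p′ ∈ Y → n ∈ Y → d p ≡ d r → p ~ r →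
      p′ ~ p → suc (d p′) ≡ d p → n ~ p → n ≁ r → n ≁ p′ → d p ≤ d n → p′ ≁ r

    RungsEnd : ℕ → Set
    RungsEnd k = ∀ {p r p′ r′ n} → p ∈ Y → r ∈ Y → p′ ∈ Y → r′ ∈ Y → n ∈ Y →
      d p ≡ k → d r ≡ k → p ~ r → n ~ p → n ≁ r → k ≤ d n →
      p′ ~ p → suc (d p′) ≡ k → r′ ~ r → suc (d r′) ≡ k → n ≁ p′ → n ≁ r′ → p′ ≁ r′
    -- If p′ ~ r′, then p p′ r′ r is an induced four-cycle with n, p″ and r″ attached to p, p′ and
    -- r′. The absence of a sunspot makes p″ and r″ adjacent, but the induction hypothesis forbids
    -- this, with p in the role of n one level higher up.
    climb : PrivateParents → ∀ i → RungsEnd (suc i) → RungsEnd (suc (suc i))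
    climb priv i ih {p} {r} {p′} {r′} {n} pY rY p′Y r′Y nY dp dr pr np nr k≤n p′p dp′ r′r dr′ np′ nr′
      with ~? p′ r′
    ... | inj₂ e = e
    ... | inj₁ e with parent p′Y (ℕₚ.suc-injective dp′) | parent r′Y (ℕₚ.suc-injective dr′)
    ...     | p″ , p″Y , p″p′ , dp″ | r″ , r″Y , r″r′ , dr″ = ⊥-elim (noSunspot
        (A-sym p′p) e r′r (A-sym pr) (A-sym r′≁p) p′≁r np p″p′ r″r′ np′ nr′ nr
        (up p″Y pY dp″ (ℕₚ.≤-reflexive (≡sym dp))) p″≁r′ (up p″Y rY dp″ (ℕₚ.≤-reflexive (≡sym dr)))
        (up r″Y pY dr″ (ℕₚ.≤-reflexive (≡sym dp))) r″≁p′ (up r″Y rY dr″ (ℕₚ.≤-reflexive (≡sym dr)))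
        (A-sym (up p″Y nY dp″ k≤n)) p″≁r″ (A-sym (up r″Y nY dr″ k≤n)))
      where
      up : ∀ {x y} → x ∈ Y → y ∈ Y → d x ≡ i → suc (suc i) ≤ d y → x ≁ y
      up xY yY dx le = far xY yY (subst (λ t → 2 + t ≤ _) (≡sym dx) le)
      p′≁r = priv pY rY p′Y nY (trans dp (≡sym dr)) pr p′p (trans dp′ (≡sym dp)) np nr np′
               (subst (_≤ d n) (≡sym dp) k≤n)
      r′≁p : r′ ≁ p
      r′≁p = not~ λ r′p → clash r′r (priv pY rY r′Y nY (trans dp (≡sym dr)) pr r′p (trans dr′ (≡sym dp)) np nr nr′
               (subst (_≤ d n) (≡sym dp) k≤n))
      d′ = trans (ℕₚ.suc-injective dp′) (≡sym (ℕₚ.suc-injective dr′))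
      p′≤p : d p′ ≤ d p
      p′≤p = ℕₚ.≤-trans (ℕₚ.n≤1+n _) (ℕₚ.≤-reflexive (trans dp′ (≡sym dp)))
      r′≤r : d r′ ≤ d r
      r′≤r = ℕₚ.≤-trans (ℕₚ.n≤1+n _) (ℕₚ.≤-reflexive (trans dr′ (≡sym dr)))
      p≁p″ = A-sym (up p″Y pY dp″ (ℕₚ.≤-reflexive (≡sym dp)))
      r≁r″ = A-sym (up r″Y rY dr″ (ℕₚ.≤-reflexive (≡sym dr)))
      p≁r″ = A-sym (up r″Y pY dr″ (ℕₚ.≤-reflexive (≡sym dp)))
      p″≁r′ = priv p′Y r′Y p″Y pY d′ e p″p′ (trans (cong suc dp″) (≡sym (ℕₚ.suc-injective dp′)))
                (A-sym p′p) (A-sym r′≁p) p≁p″ p′≤p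
      r″≁p′ = priv r′Y p′Y r″Y rY (≡sym d′) (A-sym e) r″r′ (trans (cong suc dr″) (≡sym (ℕₚ.suc-injective dr′)))
                (A-sym r′r) (A-sym p′≁r) r≁r″ r′≤r
      p″≁r″ = ih p′Y r′Y p″Y r″Y pY (ℕₚ.suc-injective dp′) (ℕₚ.suc-injective dr′) e
                (A-sym p′p) (A-sym r′≁p) (ℕₚ.≤-trans (ℕₚ.n≤1+n _) (ℕₚ.≤-reflexive (≡sym dp)))
                p″p′ (cong suc dp″) r″r′ (cong suc dr″) p≁p″ p≁r″

    -- Otherwise a ladder of four-cycles climbs up to the root, where its last rung collapses.
    ladder : PrivateParents → ∀ k → RungsEnd k
    ladder priv zero pY rY p′Y r′Y nY dp dr pr np nr k≤n p′p ()
    ladder priv 1 pY rY p′Y r′Y nY dp dr pr np nr k≤n p′p dp′ r′r dr′ np′ nr′ =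
      not~ (irr (trans (root p′Y (ℕₚ.suc-injective dp′)) (≡sym (root r′Y (ℕₚ.suc-injective dr′)))))
    ladder priv (suc (suc i)) = climb priv i (ladder priv (suc i))

-- Four-cycles inside a level of a triangle-free set

module LevelSets (G : Graph) (noSunspot : NoSunspot G) where
  open Colourings G
  open Layerings G
  open Ladders G noSunspot

  Nbrs : Sub → V → V → Set
  Nbrs W x y = y ∈ W × x ~ y

  module _ {Y : Sub} {v : V} (L : Layering Y v) (tri-free : TriFree ⟦ Y ⟧) (j : ℕ) (W : Sub)
           (W⊆ : W ⊆ Layering.level L (2 + j))
           (undominated : ∀ {x z} → x ∈ W → z ∈ W → x ≢ z → ∃[ b ] b ∈ W × b ~ x × b ≁ z)
           (degree : ∀ {x} → x ∈ W → Many 8 (Nbrs W x)) where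
    open Layering L

    private
      inY : ∀ {x} → x ∈ W → x ∈ Y
      inY = proj₁ ∘ W⊆
      dW : ∀ {x} → x ∈ W → d x ≡ 2 + j
      dW = proj₂ ∘ W⊆

      Up : V → Set
      Up p = p ∈ Y × d p ≡ suc j

      no3 : ∀ {x y z} → x ∈ Y → y ∈ Y → z ∈ Y → x ~ y → y ~ z → x ≁ z
      no3 xY yY zY xy yz = not~ (tri-free xY yY zY xy yz)

      up : ∀ {x} → x ∈ W → ∃[ p ] Up p × p ~ x
      up xW with parent (inY xW) (dW xW)
      ... | p , pY , px , dp = p , (pY , dp) , px

      far-up : ∀ {p x} → p ∈ Y → d p ≡ j → x ∈ W → p ≁ x
      far-up pY dp xW = far pY (inY xW) (ℕₚ.≤-reflexive (trans (cong (2 +_) dp) (≡sym (dW xW))))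

      -- Sunspots force this relation on opposite vertices of four-cycles, whereas
      -- `no-matched-triple` lets no three distinct vertices be pairwise matched.
      Matched : V → V → Set
      Matched x z = ∀ {b c} → b ∈ W → c ∈ W → b ~ x → b ≁ z → c ~ z → c ≁ x → b ~ c

      -- The four-cycle x p z y with b, a parent p′ of p, and c attached to x, p, z. Being on level
      -- 2 or deeper guarantees p′.
      matched : ∀ {p x y z} → Up p → x ∈ W → z ∈ W → p ~ x → p ~ z → y ∈ W → y ~ x → y ~ z → Matched x z
      matched {p} {x} {y} {z} (pY , dp) xW zW px pz yW yx yz {b} {c} bW cW bx bz cz cx
        with parent pY dp | ~? b c
      ... | _ | inj₁ bc = bc
      ... | p′ , p′Y , p′p , dp′ | inj₂ bc = ⊥-elim (noSunspot (A-sym px) pz (A-sym yz) yx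
        (no3 (inY xW) pY (inY zW) (A-sym px) pz) (no3 pY (inY xW) (inY yW) px (A-sym yx))
        bx p′p cz
        (no3 (inY bW) (inY xW) pY bx (A-sym px)) bz (no3 (inY bW) (inY xW) (inY yW) bx (A-sym yx))
        (far-up p′Y dp′ xW) (far-up p′Y dp′ zW) (far-up p′Y dp′ yW)
        cx (no3 (inY cW) (inY zW) pY cz (A-sym pz)) (no3 (inY cW) (inY zW) (inY yW) cz (A-sym yz))
        (A-sym (far-up p′Y dp′ bW)) (far-up p′Y dp′ cW) bc)

      -- The same four-cycle, now with p′, b and w attached to p, x and y.
      meets : ∀ {p x y z b w} → Up p → x ∈ W → z ∈ W → p ~ x → p ~ z → y ∈ W → y ~ x → y ~ z →
              b ∈ W → b ~ x → b ≁ z → w ∈ W → w ~ y → p ≁ w → b ~ w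
      meets {p} {x} {y} {z} {b} {w} (pY , dp) xW zW px pz yW yx yz bW bx bz wW wy pw
        with parent pY dp | ~? b w
      ... | _ | inj₁ bw = bw
      ... | p′ , p′Y , p′p , dp′ | inj₂ bw = ⊥-elim (noSunspot px (A-sym yx) yz (A-sym pz)
        (no3 pY (inY xW) (inY yW) px (A-sym yx)) (no3 (inY xW) pY (inY zW) (A-sym px) pz)
        p′p bx wy
        (far-up p′Y dp′ xW) (far-up p′Y dp′ yW) (far-up p′Y dp′ zW)
        (no3 (inY bW) (inY xW) pY bx (A-sym px)) (no3 (inY bW) (inY xW) (inY yW) bx (A-sym yx)) bz
        (A-sym pw) (no3 (inY wW) (inY yW) (inY xW) wy yx) (no3 (inY wW) (inY yW) (inY zW) wy yz)
        (far-up p′Y dp′ bW) bw (far-up p′Y dp′ wW))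

      -- Otherwise w forms a triangle with a neighbour of x missing z and a neighbour of z missing
      -- x.
      absorbed : ∀ {p x y z w} → Up p → x ∈ W → z ∈ W → p ~ x → p ~ z → x ≢ z → y ∈ W → y ~ x → y ~ z →
                 w ∈ W → y ~ w → p ~ w
      absorbed {p} {x} {y} {z} {w} pU xW zW px pz x≢z yW yx yz wW yw with ~? p w
      ... | inj₁ pw = pw
      ... | inj₂ pw with undominated xW zW x≢z | undominated zW xW (≢-sym x≢z)
      ...   | b , bW , bx , bz | c , cW , cz , cx = ⊥-elim (tri-free (inY bW) (inY cW) (inY wW)
        (matched pU xW zW px pz yW yx yz bW cW bx bz cz cx)
        (meets pU zW xW pz px yW yz yx cW cz cx wW (A-sym yw) pw)
        (meets pU xW zW px pz yW yx yz bW bx bz wW (A-sym yw) pw))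

      -- If the witness against y sees z and the witness against z sees y, matching makes them
      -- adjacent, and x completes a triangle.
      private-neighbour : ∀ {x y z} → x ∈ W → y ∈ W → z ∈ W → x ≢ y → x ≢ z → Matched y z →
                          ∃[ b ] b ∈ W × b ~ x × b ≁ y × b ≁ z
      private-neighbour {x} {y} {z} xW yW zW x≢y x≢z yz
        with undominated xW yW x≢y | undominated xW zW x≢z
      ... | b , bW , bx , by | c , cW , cx , cz with ~? b z | ~? c y
      ...   | inj₂ bz | _       = b , bW , bx , by , bz
      ...   | inj₁ _  | inj₂ cy = c , cW , cx , cy , cz
      ...   | inj₁ bz | inj₁ cy = ⊥-elim (tri-free (inY cW) (inY bW) (inY xW) (yz cW bW cy cz bz by) bx cx)

      -- Neighbours private to each of the three vertices would form a triangle.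
      no-matched-triple : ∀ {x y z} → x ∈ W → y ∈ W → z ∈ W → x ≢ y → x ≢ z → y ≢ z →
                          Matched x y → Matched x z → Matched y z → ⊥
      no-matched-triple xW yW zW x≢y x≢z y≢z xy xz yz
        with private-neighbour xW yW zW x≢y x≢z yz
           | private-neighbour yW xW zW (≢-sym x≢y) y≢z xz
           | private-neighbour zW xW yW (≢-sym x≢z) (≢-sym y≢z) xy
      ... | a , aW , ax , ay , az | b , bW , by , bx , bz | c , cW , cz , cx , cy =
        tri-free (inY aW) (inY bW) (inY cW) (xy aW bW ax ay by bx) (yz bW cW by bz cz cy) (xz aW cW ax az cz cx)

      -- A third neighbour w of y is also a child of p by `absorbed`, so x, z and w are pairwise
      -- matched.
      no-common-parent : ∀ {p x y z} → Up p → x ∈ W → z ∈ W → p ~ x → p ~ z → x ≢ z →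
                         y ∈ W → y ~ x → y ~ z → ⊥
      no-common-parent {p} {x} {y} {z} pU xW zW px pz x≢z yW yx yz
        with avoid 8 (x ∷ z ∷ []) (s≤s (s≤s (s≤s z≤n))) (degree yW)
      ... | w , (wW , yw) , w∉ = no-matched-triple xW zW wW x≢z (λ e → w∉ (here (≡sym e)))
        (λ e → w∉ (there (here (≡sym e))))
        (matched pU xW zW px pz yW yx yz) (matched pU xW wW px pw yW yx yw) (matched pU zW wW pz pw yW yz yw)
        where pw = absorbed pU xW zW px pz x≢z yW yx yz wW yw

      -- The ladder applies with a second neighbour c of a as its pendant; c misses r since b and c,
      -- having the common neighbour a, share no parent.
      parents-apart : ∀ {a b p r} → a ∈ W → b ∈ W → a ~ b → Up p → Up r → p ~ a → r ~ b → p ≁ r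
      parents-apart {a} {b} aW bW ab (pY , dp) (rY , dr) pa rb
        with avoid 8 (b ∷ []) (s≤s (s≤s z≤n)) (degree aW)
      ... | c , (cW , ac) , c∉ = ladder L
        (λ pY rY p′Y _ _ pr p′p _ _ _ _ _ → no3 p′Y pY rY p′p pr) (2 + j)
        (inY aW) (inY bW) pY rY (inY cW) (dW aW) (dW bW) ab (A-sym ac)
        (no3 (inY cW) (inY aW) (inY bW) (A-sym ac) ab) (ℕₚ.≤-reflexive (≡sym (dW cW)))
        pa (cong suc dp) rb (cong suc dr) (no3 (inY cW) (inY aW) pY (A-sym ac) (A-sym pa))
        (not~ λ cr → no-common-parent (rY , dr) cW bW (A-sym cr) rb (λ e → c∉ (here e)) aW ac ab)

      module _ {a b c e} (aW : a ∈ W) (bW : b ∈ W) (cW : c ∈ W) (eW : e ∈ W)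
               (ab : a ~ b) (bc : b ~ c) (ce : c ~ e) (ea : e ~ a) (b≢e : b ≢ e) (a≢c : a ≢ c) where

        private
          ac = no3 (inY aW) (inY bW) (inY cW) ab bc
          be = no3 (inY bW) (inY cW) (inY eW) bc ce

        cycle-matched : Matched a c
        cycle-matched {x} {z} xW zW xa xc zc za with up bW | ~? x z
        ... | _ | inj₁ xz = xz
        ... | p , (pY , dp) , pb | inj₂ xz = ⊥-elim (noSunspot ab bc ce ea ac be xa pb zc
          (no3 (inY xW) (inY aW) (inY bW) xa ab) xc (no3 (inY xW) (inY aW) (inY eW) xa (A-sym ea))
          (no3 pY (inY bW) (inY aW) pb (A-sym ab)) (no3 pY (inY bW) (inY cW) pb bc)
          (not~ λ pe → no-common-parent (pY , dp) bW eW pb pe b≢e aW ab (A-sym ea))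
          za (no3 (inY zW) (inY cW) (inY bW) zc (A-sym bc)) (no3 (inY zW) (inY cW) (inY eW) zc ce)
          (not~ λ xp → no-common-parent (pY , dp) xW bW (A-sym xp) pb (≢-sym (sep (A-sym bc) (A-sym xc))) aW (A-sym xa) ab)
          (not~ λ pz → no-common-parent (pY , dp) zW bW pz pb (≢-sym (sep ab (A-sym za))) cW (A-sym zc) (A-sym bc))
          xz)

        -- Every neighbour of a that misses c is a child of one fixed parent r of c: else it, a
        -- parent of b, and r attach to a, b, c and give a sunspot. Two such children would share
        -- both r and a.
        at-most-one : ∀ {x y} → x ∈ W → y ∈ W → a ~ x → a ~ y → x ≁ c → y ≁ c → x ≡ y
        at-most-one {x} {y} xW yW ax ay xc yc with up bW | up cW
        ... | p , (pY , dp) , pb | r , (rY , dr) , rc = decidable-stable (x Finₚ.≟ y) λ x≢y →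
          no-common-parent (rY , dr) xW yW (A-sym (reach xW ax xc)) (A-sym (reach yW ay yc)) x≢y aW ax ay
          where
          reach : ∀ {x} → x ∈ W → a ~ x → x ≁ c → x ~ r
          reach {x} xW ax xc with ~? x r
          ... | inj₁ xr = xr
          ... | inj₂ xr = ⊥-elim (noSunspot ab bc ce ea ac be (A-sym ax) pb rc
            (no3 (inY xW) (inY aW) (inY bW) (A-sym ax) ab) xc (no3 (inY xW) (inY aW) (inY eW) (A-sym ax) (A-sym ea))
            (no3 pY (inY bW) (inY aW) pb (A-sym ab)) (no3 pY (inY bW) (inY cW) pb bc)
            (not~ λ pe → no-common-parent (pY , dp) bW eW pb pe b≢e aW ab (A-sym ea))
            (not~ λ ra → no-common-parent (rY , dr) cW aW rc ra (≢-sym a≢c) bW bc (A-sym ab))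
            (no3 rY (inY cW) (inY bW) rc (A-sym bc)) (no3 rY (inY cW) (inY eW) rc ce)
            (not~ λ xp → no-common-parent (pY , dp) xW bW (A-sym xp) pb (≢-sym (sep (A-sym bc) (A-sym xc))) aW ax ab)
            (parents-apart bW cW bc (pY , dp) (rY , dr) pb rc) xr)

    -- All but one of the neighbours of a see c. Any two of these form a four-cycle with a and c,
    -- hence are matched, and three of them are too many.
    C4-free : ∀ {a b c e} → a ∈ W → b ∈ W → c ∈ W → e ∈ W →
              a ~ b → b ~ c → c ~ e → e ~ a → b ≢ e → a ≢ c → ⊥
    C4-free {a} {b} {c} {e} aW bW cW eW ab bc ce ea b≢e a≢c
      with undominated aW cW a≢c
    ... | x , xW , xa , xc
      with avoid 8 (x ∷ []) (s≤s (s≤s z≤n)) (degree aW)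
    ... | y₁ , (y₁W , ay₁) , y₁∉ with avoid 8 (x ∷ y₁ ∷ []) (s≤s (s≤s (s≤s z≤n))) (degree aW)
    ... | y₂ , (y₂W , ay₂) , y₂∉ with avoid 8 (x ∷ y₁ ∷ y₂ ∷ []) (s≤s (s≤s (s≤s (s≤s z≤n)))) (degree aW)
    ... | y₃ , (y₃W , ay₃) , y₃∉ = no-matched-triple y₁W y₂W y₃W 1≢2 1≢3 2≢3
      (pair y₁W y₂W ay₁ ay₂ c₁ c₂ 1≢2) (pair y₁W y₃W ay₁ ay₃ c₁ c₃ 1≢3) (pair y₂W y₃W ay₂ ay₃ c₂ c₃ 2≢3)
      where
      common : ∀ {y} → y ∈ W → a ~ y → y ≢ x → y ~ c
      common {y} yW ay y≢x with ~? y c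
      ... | inj₁ yc = yc
      ... | inj₂ yc = ⊥-elim (y≢x (at-most-one aW bW cW eW ab bc ce ea b≢e a≢c yW xW ay (A-sym xa) yc xc))
      c₁ = common y₁W ay₁ (y₁∉ ∘ here)
      c₂ = common y₂W ay₂ (y₂∉ ∘ here)
      c₃ = common y₃W ay₃ (y₃∉ ∘ here)
      1≢2 : y₁ ≢ y₂
      1≢2 e = y₂∉ (there (here (≡sym e)))
      1≢3 : y₁ ≢ y₃
      1≢3 e = y₃∉ (there (here (≡sym e)))
      2≢3 : y₂ ≢ y₃
      2≢3 e = y₃∉ (there (there (here (≡sym e))))
      pair : ∀ {y z} → y ∈ W → z ∈ W → a ~ y → a ~ z → y ~ c → z ~ c → y ≢ z → Matched y z
      pair yW zW ay az yc zc y≢z = cycle-matched yW aW zW cW (A-sym ay) az zc (A-sym yc) a≢c y≢z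

-- Shortest cycles and suns

NoLongSun : Graph → Set
NoLongSun G = ∀ t → 5 ≤ t → Free (t + t) (sun t) G

-- The adjacency of sun t as a proposition; its decision procedure computes to sunAdjℕ.
SunAdj : ℕ → ℕ → ℕ → Set
SunAdj t a b = ((suc a ≡ b ⊎ suc b ≡ a ⊎ (suc a ≡ t × b ≡ 0) ⊎ (suc b ≡ t × a ≡ 0)) × (a < t × b < t))
  ⊎ a ≡ b + t ⊎ b ≡ a + t

SunAdj? : ∀ t a b → Dec (SunAdj t a b)
SunAdj? t a b = (((suc a ℕₚ.≟ b) ⊎-dec (suc b ℕₚ.≟ a) ⊎-dec ((suc a ℕₚ.≟ t) ×-dec (b ℕₚ.≟ 0)) ⊎-dec
    ((suc b ℕₚ.≟ t) ×-dec (a ℕₚ.≟ 0))) ×-dec ((a ℕₚ.<? t) ×-dec (b ℕₚ.<? t)))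
  ⊎-dec (a ℕₚ.≟ b + t) ⊎-dec (b ℕₚ.≟ a + t)

sunAdjℕ-does : ∀ t a b → sunAdjℕ t a b ≡ does (SunAdj? t a b)
sunAdjℕ-does t a b = refl

module Cycles (G : Graph) (W : VertexSets.Sub G) where
  open VertexSets G

  -- A periodic function on all of ℕ: moving the starting point to f i is just adding i, and an arc
  -- never has to wrap around.
  record Cycle (t : ℕ) (f : ℕ → V) : Set where
    field
      inW      : ∀ k → f k ∈ W
      edge     : ∀ k → f k ~ f (suc k)
      period   : ∀ k → f (k + t) ≡ f k
      distinct : ∀ i j → i < j → j < i + t → f i ≢ f j

  -- residues modulo suc r
  residue : ℕ → ℕ → ℕ
  residue r zero = 0
  residue r (suc k) with residue r k ℕₚ.≟ r
  ... | yes _ = 0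
  ... | no _  = suc (residue r k)

  residue-≤ : ∀ r k → residue r k ≤ r
  residue-≤ r zero = z≤n
  residue-≤ r (suc k) with residue r k ℕₚ.≟ r
  ... | yes _ = z≤n
  ... | no ne = ℕₚ.≤∧≢⇒< (residue-≤ r k) ne

  residue-wrap : ∀ r k → residue r k ≡ r → residue r (suc k) ≡ 0
  residue-wrap r k e with residue r k ℕₚ.≟ r
  ... | yes _ = refl
  ... | no ne = ⊥-elim (ne e)

  residue-climb : ∀ r i δ → δ + residue r i ≤ r → residue r (δ + i) ≡ δ + residue r i
  residue-climb r i zero    _ = refl
  residue-climb r i (suc δ) le with residue r (δ + i) ℕₚ.≟ r | residue-climb r i δ (ℕₚ.<⇒≤ le)
  ... | no _  | e = cong suc e
  ... | yes w | e = ⊥-elim (ℕₚ.<⇒≢ le (trans (≡sym e) w))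

  residue-small : ∀ r k → k ≤ r → residue r k ≡ k
  residue-small r k le = trans (cong (residue r) (≡sym (ℕₚ.+-identityʳ k)))
    (trans (residue-climb r 0 k (subst (_≤ r) (≡sym (ℕₚ.+-identityʳ k)) le)) (ℕₚ.+-identityʳ k))

  residue-period : ∀ r k → residue r (k + suc r) ≡ residue r k
  residue-period r zero = residue-wrap r r (residue-small r r ℕₚ.≤-refl)
  residue-period r (suc k) with residue r (k + suc r) ℕₚ.≟ r | residue r k ℕₚ.≟ r | residue-period r k
  ... | yes _ | yes _ | _ = refl
  ... | no _  | no _  | e = cong suc e
  ... | yes p | no q  | e = ⊥-elim (q (trans (≡sym e) p))
  ... | no p  | yes q | e = ⊥-elim (p (trans e q))

  -- If the sum passes r, it wraps exactly once and ends at ρ, strictly below the residue it started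
  -- from.
  residue-distinct : ∀ r i δ → 0 < δ → δ < suc r → residue r (δ + i) ≢ residue r i
  residue-distinct r i δ 0<δ δ≤r with δ + residue r i ℕₚ.≤? r
  ... | yes le = λ e → ℕₚ.<⇒≢ (ℕₚ.+-monoˡ-< (residue r i) 0<δ) (≡sym (trans (≡sym (residue-climb r i δ le)) e))
  ... | no nle = λ e → ℕₚ.<⇒≢ small (trans (≡sym at-ρ) e)
    where
    a = residue r i
    τ = r ∸ a
    r<δ+a : r < δ + a
    r<δ+a = ℕₚ.≰⇒> nle
    τ+a : τ + a ≡ r
    τ+a = ℕₚ.m∸n+n≡m (residue-≤ r i)
    τ<δ : τ < δ
    τ<δ = ℕₚ.+-cancelʳ-< a τ δ (subst (_< δ + a) (≡sym τ+a) r<δ+a)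
    ρ = δ ∸ suc τ
    ρ+ : ρ + suc τ ≡ δ
    ρ+ = ℕₚ.m∸n+n≡m τ<δ
    small : ρ < a
    small = ℕₚ.+-cancelʳ-< (suc τ) ρ a (subst₂ _<_ (≡sym ρ+)
      (trans (cong suc (≡sym τ+a)) (ℕₚ.+-comm (suc τ) a)) δ≤r)
    at-wrap : residue r (suc τ + i) ≡ 0
    at-wrap = residue-wrap r (τ + i) (trans (residue-climb r i τ (ℕₚ.≤-reflexive τ+a)) τ+a)
    at-ρ : residue r (δ + i) ≡ ρ
    at-ρ = trans (cong (residue r) (trans (cong (_+ i) (≡sym ρ+)) (ℕₚ.+-assoc ρ (suc τ) i)))
      (trans (residue-climb r (suc τ + i) ρ (subst (λ z → ρ + z ≤ r) (≡sym at-wrap)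
                (ℕₚ.≤-trans (ℕₚ.≤-reflexive (ℕₚ.+-identityʳ ρ)) (ℕₚ.≤-trans (ℕₚ.<⇒≤ small) (residue-≤ r i)))))
             (trans (cong (ρ +_) at-wrap) (ℕₚ.+-identityʳ ρ)))

  close : ∀ r (g : ℕ → V) → (∀ i → i ≤ r → g i ∈ W) → (∀ i → i < r → g i ~ g (suc i)) → g r ~ g 0 →
          (∀ i j → i < j → j ≤ r → g i ≢ g j) → Cycle (suc r) (g ∘ residue r)
  close r g gW ge gc gd = record
    { inW = λ k → gW _ (residue-≤ r k) ; edge = edge ; period = λ k → cong g (residue-period r k)
    ; distinct = distinct }
    where
    edge : ∀ k → g (residue r k) ~ g (residue r (suc k))
    edge k with residue r k ℕₚ.≟ r
    ... | yes e = subst (λ a → g a ~ g 0) (≡sym e) gc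
    ... | no ne = ge _ (ℕₚ.≤∧≢⇒< (residue-≤ r k) ne)
    g-inj : ∀ {a b} → a ≤ r → b ≤ r → a ≢ b → g a ≢ g b
    g-inj {a} {b} a≤ b≤ a≢b with ℕₚ.<-cmp a b
    ... | tri< lt _ _ = gd a b lt b≤
    ... | tri≈ _ e _  = ⊥-elim (a≢b e)
    ... | tri> _ _ gt = ≢-sym (gd b a gt a≤)
    distinct : ∀ i j → i < j → j < i + suc r → g (residue r i) ≢ g (residue r j)
    distinct i j i<j j< = g-inj (residue-≤ r i) (residue-≤ r j) λ e →
      residue-distinct r i (j ∸ i) (ℕₚ.m<n⇒0<n∸m i<j)
        (ℕₚ.+-cancelʳ-< i (j ∸ i) (suc r) (subst₂ _<_ (≡sym j≡) (ℕₚ.+-comm i (suc r)) j<))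
        (trans (cong (residue r) j≡) (≡sym e))
      where
      j≡ : j ∸ i + i ≡ j
      j≡ = ℕₚ.m∸n+n≡m (ℕₚ.<⇒≤ i<j)

  -- A longest path would have all neighbours of its first vertex on it.
  module _ {w} (wW : w ∈ W) (degree : ∀ {x} → x ∈ W → Many 2 (λ y → y ∈ W × x ~ y)) where

    private
      record Path (k : ℕ) : Set where
        field
          at       : ℕ → V
          atW      : ∀ i → i ≤ k → at i ∈ W
          edge     : ∀ i → i < k → at i ~ at (suc i)
          distinct : ∀ i j → i < j → j ≤ k → at i ≢ at j

      many : ∀ s {P : V → Set} (g : ℕ → V) → (∀ i → i < s → P (g i)) → (∀ i j → i < j → j < s → g i ≢ g j) → Many s P
      many zero    g gP gd = tt
      many (suc s) g gP gd = g 0 , gP 0 (s≤s z≤n) , many s (g ∘ suc)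
        (λ i i<s → gP (suc i) (s≤s i<s) , ≢-sym (gd 0 (suc i) (s≤s z≤n) (s≤s i<s)))
        λ i j i<j j<s → gd (suc i) (suc j) (s≤s i<j) (s≤s j<s)

      search-upto : ∀ (P : ℕ → Set) → (∀ i → Dec (P i)) → ∀ k → (∃[ i ] i ≤ k × P i) ⊎ (∀ i → i ≤ k → ¬ P i)
      search-upto P P? zero with P? 0
      ... | yes p = inj₁ (0 , z≤n , p)
      ... | no ¬p = inj₂ λ { zero z≤n → ¬p }
      search-upto P P? (suc k) with P? (suc k) | search-upto P P? k
      ... | yes p | _ = inj₁ (suc k , ℕₚ.≤-refl , p)
      ... | no _  | inj₁ (i , le , p) = inj₁ (i , ℕₚ.m≤n⇒m≤1+n le , p)
      ... | no ¬p | inj₂ h = inj₂ λ i le p → case ℕₚ.m≤n⇒m<n∨m≡n le of λ where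
              (inj₁ lt)   → h i (ℕₚ.≤-pred lt) p
              (inj₂ refl) → ¬p p

      grow : ∀ fuel k → Path k → n G ≤ k + fuel → ∃[ t ] ∃[ f ] 3 ≤ t × Cycle t f
      grow zero k path le = ⊥-elim (full-bound full (Many-⊆ (suc (n G)) (λ _ → tt)
        (many (suc (n G)) {λ _ → ⊤} at (λ _ _ → tt) λ i j i<j j<s → distinct i j i<j
          (ℕₚ.≤-trans (ℕₚ.≤-pred j<s) (ℕₚ.≤-trans le (ℕₚ.≤-reflexive (ℕₚ.+-identityʳ k)))))))
        where open Path path
      grow (suc fuel) k path le with avoid 2 (Path.at path 1 ∷ []) (s≤s (s≤s z≤n)) (degree (Path.atW path 0 z≤n))
      ... | y , (yW , 0y) , y∉ with search-upto (λ i → y ≡ Path.at path i) (λ i → y Finₚ.≟ Path.at path i) k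
      ...   | inj₁ (zero , _ , e) = ⊥-elim (irr (≡sym e) 0y)
      ...   | inj₁ (suc zero , _ , e) = ⊥-elim (y∉ (here e))
      ...   | inj₁ (suc (suc j) , le′ , e) = suc (suc (suc j)) , _ , s≤s (s≤s (s≤s z≤n)) ,
          close (2 + j) at (λ i i≤ → atW i (ℕₚ.≤-trans i≤ le′)) (λ i i< → edge i (ℕₚ.<-≤-trans i< le′))
            (A-sym (subst (at 0 ~_) e 0y)) (λ a b a<b b≤ → distinct a b a<b (ℕₚ.≤-trans b≤ le′))
        where open Path path
      ...   | inj₂ new = grow fuel (suc k) record
          { at = at′ ; atW = λ { zero _ → yW ; (suc i) (s≤s le) → atW i le }
          ; edge = λ { zero _ → A-sym 0y ; (suc i) (s≤s lt) → edge i lt }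
          ; distinct = λ { zero (suc b) _ (s≤s le) → new b le
                         ; (suc a) (suc b) (s≤s lt) (s≤s le) → distinct a b lt le } }
          (ℕₚ.≤-trans le (ℕₚ.≤-reflexive (ℕₚ.+-suc k fuel)))
        where
        open Path path
        at′ : ℕ → V
        at′ zero    = y
        at′ (suc i) = at i

    exists-cycle : ∃[ t ] ∃[ f ] 3 ≤ t × Cycle t f
    exists-cycle = grow (n G) 0 record
      { at = λ _ → w ; atW = λ _ _ → wW ; edge = λ _ () ; distinct = λ { _ (suc _) _ () } } ℕₚ.≤-refl

module Suns (G : Graph) (W : VertexSets.Sub G) where
  open VertexSets G
  open Cycles G W

  module _ (tri-free : ∀ {x y z} → x ∈ W → y ∈ W → z ∈ W → x ~ y → y ~ z → x ~ z → ⊥)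
           (C4-free : ∀ {a b c e} → a ∈ W → b ∈ W → c ∈ W → e ∈ W →
                      a ~ b → b ~ c → c ~ e → e ~ a → b ≢ e → a ≢ c → ⊥)
           (degree : ∀ {x} → x ∈ W → Many 8 (λ y → y ∈ W × x ~ y)) where

    module Shortest (r : ℕ) (f : ℕ → V) (3≤t : 3 ≤ suc r) (cycle : Cycle (suc r) f)
             (minimal : ∀ s f′ → 3 ≤ s → s < suc r → Cycle s f′ → ⊥) where
      open Cycle cycle

      t : ℕ
      t = suc r

      arc-distinct : ∀ i {a b} → a < b → b < t → f (a + i) ≢ f (b + i)
      arc-distinct i {a} {b} a<b b<t = distinct (a + i) (b + i) (ℕₚ.+-monoˡ-< i a<b)
        (ℕₚ.<-≤-trans (ℕₚ.+-monoˡ-< i b<t) (ℕₚ.≤-trans (ℕₚ.≤-reflexive (ℕₚ.+-comm t i)) (ℕₚ.+-monoˡ-≤ t (ℕₚ.m≤n+m i a))))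

      Off : V → Set
      Off x = x ∈ W × (∀ k → x ≢ f k)

      -- The arc of δ edges closed by the chord is a cycle of length δ + 1. The two detours close
      -- the same arc through one or two vertices off the cycle.
      chord : ∀ i δ → 2 ≤ δ → δ < t → f i ~ f (δ + i) → t ≤ suc δ
      chord i δ 2≤δ δ<t e = ℕₚ.≮⇒≥ λ lt → minimal (suc δ) _ (s≤s 2≤δ) lt
        (close δ (λ k → f (k + i)) (λ k _ → inW _) (λ k _ → edge _) (A-sym e)
          λ a b a<b b≤δ → arc-distinct i a<b (ℕₚ.≤-<-trans b≤δ δ<t))

      detour₁ : ∀ i δ {x} → 1 ≤ δ → δ < t → Off x → x ~ f i → x ~ f (δ + i) → t ≤ 2 + δ
      detour₁ i δ {x} 1≤δ δ<t (xW , x-off) xi xj = ℕₚ.≮⇒≥ λ lt → minimal (2 + δ) _ (s≤s (s≤s 1≤δ)) lt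
        (close (suc δ) g (λ { zero _ → xW ; (suc k) _ → inW _ }) (λ { zero _ → xi ; (suc k) _ → edge _ })
          (A-sym xj) λ { zero (suc b) _ _ → x-off _
                       ; (suc a) (suc b) (s≤s lt) (s≤s le) → arc-distinct i lt (ℕₚ.≤-<-trans le δ<t) })
        where
        g : ℕ → V
        g zero    = x
        g (suc k) = f (k + i)

      detour₂ : ∀ i δ {x y} → 1 ≤ δ → δ < t → Off x → Off y → x ~ y → x ~ f i → y ~ f (δ + i) → t ≤ 3 + δ
      detour₂ i δ {x} {y} 1≤δ δ<t (xW , x-off) (yW , y-off) xy xi yj = ℕₚ.≮⇒≥ λ lt →
        minimal (3 + δ) _ (s≤s (s≤s (s≤s z≤n))) lt
        (close (2 + δ) g (λ { zero _ → yW ; 1 _ → xW ; (suc (suc k)) _ → inW _ })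
          (λ { zero _ → A-sym xy ; 1 _ → xi ; (suc (suc k)) _ → edge _ }) (A-sym yj)
          λ { zero 1 _ _ → ≢-sym (~⇒≢ xy) ; zero (suc (suc b)) _ _ → y-off _
            ; 1 1 (s≤s ()) _ ; 1 (suc (suc b)) _ _ → x-off _
            ; (suc (suc a)) 1 (s≤s ()) _
            ; (suc (suc a)) (suc (suc b)) (s≤s (s≤s lt)) (s≤s (s≤s le)) → arc-distinct i lt (ℕₚ.≤-<-trans le δ<t) })
        where
        g : ℕ → V
        g zero          = y
        g 1             = x
        g (suc (suc k)) = f (k + i)

      periods : ∀ k q → f (k + q * t) ≡ f k
      periods k zero    = cong f (ℕₚ.+-identityʳ k)
      periods k (suc q) = trans (cong f (trans (≡sym (ℕₚ.+-assoc k t (q * t)))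
        (trans (cong (_+ q * t) (ℕₚ.+-comm k t)) (trans (ℕₚ.+-assoc t k (q * t)) (ℕₚ.+-comm t (k + q * t))))))
        (trans (period _) (periods k q))

      window : ∀ i k → ∃[ δ ] δ < t × f k ≡ f (δ + i)
      window i k = e % t , m%n<n e t , trans (≡sym (periods k i)) (trans (cong f (≡sym e+i))
        (trans (cong f (trans (cong (_+ i) (m≡m%n+[m/n]*n e t)) swap)) (periods (e % t + i) (e / t))))
        where
        -- Adding i full turns first keeps the subtraction from truncating.
        e = k + i * t ∸ i
        e+i : e + i ≡ k + i * t
        e+i = ℕₚ.m∸n+n≡m (ℕₚ.≤-trans (ℕₚ.m≤m*n i t) (ℕₚ.m≤n+m (i * t) k))
        swap : e % t + e / t * t + i ≡ e % t + i + e / t * t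
        swap = trans (ℕₚ.+-assoc (e % t) (e / t * t) i) (trans (cong (e % t +_) (ℕₚ.+-comm (e / t * t) i))
          (≡sym (ℕₚ.+-assoc (e % t) i (e / t * t))))

      5≤t : 5 ≤ t
      5≤t = ℕₚ.≮⇒≥ (short r f 3≤t cycle)
        where
        short : ∀ r f → 3 ≤ suc r → Cycle (suc r) f → suc r < 5 → ⊥
        short 2 f _ c _ = tri-free (C.inW 0) (C.inW 1) (C.inW 2) (C.edge 0) (C.edge 1)
          (A-sym (subst (f 2 ~_) (C.period 0) (C.edge 2)))
          where module C = Cycle c
        short 3 f _ c _ = C4-free (C.inW 0) (C.inW 1) (C.inW 2) (C.inW 3) (C.edge 0) (C.edge 1) (C.edge 2)
          (subst (f 3 ~_) (C.period 0) (C.edge 3)) (C.distinct 1 3 (s≤s (s≤s z≤n)) (s≤s (s≤s (s≤s (s≤s z≤n)))))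
          (C.distinct 0 2 (s≤s z≤n) (s≤s (s≤s (s≤s z≤n))))
          where module C = Cycle c
        short 0 f (s≤s ()) _ _
        short 1 f (s≤s (s≤s ())) _ _
        short (suc (suc (suc (suc _)))) f _ _ (s≤s (s≤s (s≤s (s≤s (s≤s ())))))

      off-cycle : ∀ i {y} → y ∈ W → f i ~ y → y ≢ f (suc i) → y ≢ f (r + i) → Off y
      off-cycle i {y} yW iy y≢next y≢prev = yW , λ k e → excluded (window i k) e
        where
        excluded : ∀ {k} → ∃[ δ ] δ < t × f k ≡ f (δ + i) → y ≡ f k → ⊥
        excluded (0 , _ , e′) e = irr (≡sym (trans e e′)) iy
        excluded (1 , _ , e′) e = y≢next (trans e e′)
        excluded (suc (suc δ) , lt , e′) e = y≢prev (trans (trans e e′) (cong (λ z → f (z + i)) (ℕₚ.≤-antisym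
          (ℕₚ.≤-pred lt) (ℕₚ.≤-pred (chord i (2 + δ) (s≤s (s≤s z≤n)) lt (subst (f i ~_) (trans e e′) iy))))))

      arcs : ∀ {i j} → i < j → j < t → ∃[ δ ] ∃[ ε ] δ + i ≡ j × ε + δ ≡ t × 1 ≤ δ × 1 ≤ ε
      arcs {i} {j} i<j j<t = j ∸ i , t ∸ (j ∸ i) , ℕₚ.m∸n+n≡m (ℕₚ.<⇒≤ i<j) , ℕₚ.m∸n+n≡m (ℕₚ.<⇒≤ δ<t) ,
        ℕₚ.m<n⇒0<n∸m i<j , ℕₚ.m<n⇒0<n∸m δ<t
        where
        δ<t : j ∸ i < t
        δ<t = ℕₚ.≤-<-trans (ℕₚ.m∸n≤m j i) j<t

      around : ∀ i δ ε → ε + δ ≡ t → f (ε + (δ + i)) ≡ f i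
      around i δ ε e = trans (cong f (trans (≡sym (ℕₚ.+-assoc ε δ i)) (trans (cong (_+ i) e) (ℕₚ.+-comm t i)))) (period i)

      double-bound : ∀ {k δ ε} → ε + δ ≡ t → t ≤ k + δ → t ≤ k + ε → t ≤ k + k
      double-bound {k} {δ} {ε} e p q = ℕₚ.+-cancelʳ-≤ t t (k + k) (ℕₚ.≤-trans (ℕₚ.+-mono-≤ p q) (ℕₚ.≤-reflexive
        (trans (ℕₚ.+-assoc k δ (k + ε)) (trans (cong (k +_) (trans (≡sym (ℕₚ.+-assoc δ k ε)) (trans (cong (_+ ε) (ℕₚ.+-comm δ k))
          (trans (ℕₚ.+-assoc k δ ε) (cong (k +_) (trans (ℕₚ.+-comm δ ε) e)))))) (≡sym (ℕₚ.+-assoc k k t))))))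

      -- Both arcs between the feet close up through x, so t is at most 2 plus either length; adding
      -- the two bounds gives t ≤ 4. Two linked vertices replace 2 by 3, whence t ≤ 6 below.
      one-foot : ∀ {i j x} → i < j → j < t → Off x → x ~ f i → x ~ f j → ⊥
      one-foot {i} i<j j<t off xi xj with arcs i<j j<t
      ... | δ , ε , refl , e , 1≤δ , 1≤ε = ℕₚ.<⇒≱ 5≤t (double-bound {2} {δ} {ε} e
        (detour₁ i δ 1≤δ (ℕₚ.≤-trans (ℕₚ.+-monoˡ-≤ δ 1≤ε) (ℕₚ.≤-reflexive e)) off xi xj)
        (detour₁ (δ + i) ε 1≤ε (ℕₚ.≤-trans (ℕₚ.≤-trans (ℕₚ.≤-reflexive (ℕₚ.+-comm 1 ε)) (ℕₚ.+-monoʳ-≤ ε 1≤δ)) (ℕₚ.≤-reflexive e))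
          off xj (subst (_ ~_) (≡sym (around i δ ε e)) xi)))

      linked-feet : ∀ {i j x y} → i < j → j < t → Off x → Off y → x ~ f i → y ~ f j → x ~ y → t ≤ 6
      linked-feet {i} i<j j<t offx offy xi yj xy with arcs i<j j<t
      ... | δ , ε , refl , e , 1≤δ , 1≤ε = double-bound {3} {δ} {ε} e
        (detour₂ i δ 1≤δ (ℕₚ.≤-trans (ℕₚ.+-monoˡ-≤ δ 1≤ε) (ℕₚ.≤-reflexive e)) offx offy xy xi yj)
        (detour₂ (δ + i) ε 1≤ε (ℕₚ.≤-trans (ℕₚ.≤-trans (ℕₚ.≤-reflexive (ℕₚ.+-comm 1 ε)) (ℕₚ.+-monoʳ-≤ ε 1≤δ)) (ℕₚ.≤-reflexive e))
          offy offx (A-sym xy) yj (subst (_ ~_) (≡sym (around i δ ε e)) xi))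

      Pendants : ℕ → Set
      Pendants s = Σ (ℕ → V) λ x → (∀ i → i < s → Off (x i) × x i ~ f i) × (∀ i j → i < j → j < s → x i ≁ x j)

      private
        -- The only common neighbour of f s and x i in W, if there is one: two would close a
        -- four-cycle.
        blocker : (ℕ → V) → ℕ → ℕ → V
        blocker x s i with Finₚ.any? (λ y → (mem W y ×-dec (A (f s) y Bₚ.≟ true)) ×-dec (A (x i) y Bₚ.≟ true))
        ... | yes (y , _) = y
        ... | no _ = f s

        blocked : ∀ x s i {y} → Off (x i) → y ∈ W → f s ~ y → x i ~ y → y ≡ blocker x s i
        blocked x s i {y} (xW , x-off) yW sy xy
          with Finₚ.any? (λ y → (mem W y ×-dec (A (f s) y Bₚ.≟ true)) ×-dec (A (x i) y Bₚ.≟ true))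
        ... | no none = ⊥-elim (none (y , (yW , sy) , xy))
        ... | yes (z , (zW , sz) , xz) = decidable-stable (y Finₚ.≟ z) λ y≢z →
          C4-free yW (inW s) zW xW (A-sym sy) sz (A-sym xz) xy (≢-sym (x-off s)) y≢z

      -- Adjacent pendants exist only for t ≤ 6, and then each pendant chosen so far
      -- rules out at most one neighbour of f s.
      next-pendant : ∀ s (P : Pendants s) → s < t →
                     ∃[ y ] (Off y × y ~ f s) × (∀ i → i < s → proj₁ P i ≁ y)
      next-pendant s (x , ok , _) s<t with t ℕₚ.≤? 6
      ... | no t>6 with avoid 8 (f (suc s) ∷ f (r + s) ∷ []) (s≤s (s≤s (s≤s z≤n))) (degree (inW s))
      ...   | y , (yW , sy) , y∉ = y , (off , A-sym sy) , λ i i<s → not~ λ xy →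
                t>6 (linked-feet i<s s<t (proj₁ (ok i i<s)) off (proj₂ (ok i i<s)) (A-sym sy) xy)
        where off = off-cycle s yW sy (y∉ ∘ here) (y∉ ∘ there ∘ here)
      next-pendant s (x , ok , _) s<t | yes t≤6
        -- Two neighbours on the cycle and at most s ≤ 5 blockers are to be avoided: this is the
        -- origin of the degree 8.
        with avoid 8 (f (suc s) ∷ f (r + s) ∷ applyUpTo (blocker x s) s)
               (s≤s (s≤s (s≤s (subst (_≤ 5) (≡sym (length-applyUpTo (blocker x s) s))
                 (ℕₚ.≤-pred (ℕₚ.≤-trans s<t t≤6)))))) (degree (inW s))
      ... | y , (yW , sy) , y∉ = y , (off-cycle s yW sy (y∉ ∘ here) (y∉ ∘ there ∘ here) , A-sym sy) ,
        λ i i<s → not~ λ xy → y∉ (there (there (subst (_∈ₗ applyUpTo (blocker x s) s)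
          (≡sym (blocked x s i (proj₁ (ok i i<s)) yW sy xy)) (∈-applyUpTo⁺ (blocker x s) i<s))))

      pendants : ∀ s → s ≤ t → Pendants s
      pendants zero    _   = (λ _ → f 0) , (λ _ ()) , λ _ _ _ ()
      pendants (suc s) s<t with pendants s (ℕₚ.<⇒≤ s<t)
      ... | P@(x , ok , apart) with next-pendant s P s<t
      ...   | y , new , y-apart = x′ , ok′ , apart′
        where
        x′ : ℕ → V
        x′ i with i ℕₚ.<? s
        ... | yes _ = x i
        ... | no _  = y
        ok′ : ∀ i → i < suc s → Off (x′ i) × x′ i ~ f i
        ok′ i i< with i ℕₚ.<? s
        ... | yes i<s = ok i i<s
        ... | no i≮s  = subst (λ k → Off y × y ~ f k) (ℕₚ.≤-antisym (ℕₚ.≮⇒≥ i≮s) (ℕₚ.≤-pred i<)) new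
        apart′ : ∀ i j → i < j → j < suc s → x′ i ≁ x′ j
        apart′ i j i<j j< with i ℕₚ.<? s | j ℕₚ.<? s
        ... | yes _   | yes j<s = apart i j i<j j<s
        ... | yes i<s | no _    = y-apart i i<s
        ... | no i≮s  | _       = ⊥-elim (i≮s (ℕₚ.<-≤-trans i<j (ℕₚ.≤-pred j<)))

      module _ (x : ℕ → V) (ok : ∀ i → i < t → Off (x i) × x i ~ f i)
               (apart : ∀ i j → i < j → j < t → x i ≁ x j) where

        corner : ℕ → V
        corner a with a ℕₚ.<? t
        ... | yes _ = f a
        ... | no _  = x (a ∸ t)

        -- Matching on the two kinds of sun vertices exposes every index at or above t as a sum a +
        -- t, so no subtraction enters the adjacency cases.
        data Label : ℕ → V → Set where
          rim : ∀ {a} → a < t → Label a (f a)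
          ray : ∀ {a} → a < t → Label (a + t) (x a)

        label : ∀ a → a < t + t → Label a (corner a)
        label a a< with a ℕₚ.<? t
        ... | yes a<t = rim a<t
        ... | no a≮t  = subst (λ b → Label b (x (a ∸ t))) a∸t+t
          (ray (ℕₚ.+-cancelʳ-< t (a ∸ t) t (subst (_< t + t) (≡sym a∸t+t) a<)))
          where
          a∸t+t : a ∸ t + t ≡ a
          a∸t+t = ℕₚ.m∸n+n≡m (ℕₚ.≮⇒≥ a≮t)

        foot : ∀ {i j} → i < t → j < t → x i ~ f j → i ≡ j
        foot {i} {j} i<t j<t e with ℕₚ.<-cmp i j | ok i i<t
        ... | tri< i<j _ _ | off , xi = ⊥-elim (one-foot i<j j<t off xi e)
        ... | tri≈ _ i≡j _ | _ = i≡j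
        ... | tri> _ _ j<i | off , xi = ⊥-elim (one-foot j<i i<t off e xi)

        rim-inj : ∀ {i j} → i < t → j < t → f i ≡ f j → i ≡ j
        rim-inj {i} {j} i<t j<t e with ℕₚ.<-cmp i j
        ... | tri< i<j _ _ = ⊥-elim (distinct i j i<j (ℕₚ.<-≤-trans j<t (ℕₚ.m≤n+m t i)) e)
        ... | tri≈ _ i≡j _ = i≡j
        ... | tri> _ _ j<i = ⊥-elim (distinct j i j<i (ℕₚ.<-≤-trans i<t (ℕₚ.m≤n+m t j)) (≡sym e))

        labels-inj : ∀ {a b u v} → Label a u → Label b v → u ≡ v → a ≡ b
        labels-inj (rim p) (rim q) e = rim-inj p q e
        labels-inj (rim p) (ray {b} q) e = ⊥-elim (proj₂ (proj₁ (ok b q)) _ (≡sym e))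
        labels-inj (ray {a} p) (rim q) e = ⊥-elim (proj₂ (proj₁ (ok a p)) _ e)
        labels-inj (ray {a} p) (ray {b} q) e = cong (_+ t) (foot p q (subst (_~ f b) (≡sym e) (proj₂ (ok b q))))

        rim-adj : ∀ {i j} → i < j → j < t → f i ~ f j → suc i ≡ j ⊎ (i ≡ 0 × suc j ≡ t)
        rim-adj {i} {j} i<j j<t e with arcs i<j j<t
        ... | 1 , _ , refl , _ = inj₁ refl
        ... | suc (suc δ) , suc ε , refl , e′ , _ = inj₂ (ℕₚ.n≤0⇒n≡0 (ℕₚ.+-cancelˡ-≤ (suc (2 + δ)) i 0
            (ℕₚ.≤-trans j<t (ℕₚ.≤-trans long (ℕₚ.≤-reflexive (≡sym (ℕₚ.+-identityʳ _)))))) ,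
            ℕₚ.≤-antisym j<t (ℕₚ.≤-trans long (s≤s (ℕₚ.m≤m+n (2 + δ) i))))
          where
          long : t ≤ suc (2 + δ)
          long = chord i (2 + δ) (s≤s (s≤s z≤n)) (ℕₚ.≤-trans (s≤s (ℕₚ.m≤n+m (2 + δ) ε)) (ℕₚ.≤-reflexive e′)) e

        sun-edge : ∀ {a b u v} → Label a u → Label b v → SunAdj t a b → u ~ v
        sun-edge (rim p) (rim q) (inj₁ (inj₁ refl , _)) = edge _
        sun-edge (rim p) (rim q) (inj₁ (inj₂ (inj₁ refl) , _)) = A-sym (edge _)
        sun-edge (rim p) (rim q) (inj₁ (inj₂ (inj₂ (inj₁ (refl , refl))) , _)) = subst (f _ ~_) (period 0) (edge _)
        sun-edge (rim p) (rim q) (inj₁ (inj₂ (inj₂ (inj₂ (refl , refl))) , _)) = A-sym (subst (f _ ~_) (period 0) (edge _))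
        sun-edge (rim p) (rim {b} q) (inj₂ (inj₁ e)) = ⊥-elim (ℕₚ.<⇒≱ p (subst (t ≤_) (≡sym e) (ℕₚ.m≤n+m t b)))
        sun-edge (rim {a} p) (rim q) (inj₂ (inj₂ e)) = ⊥-elim (ℕₚ.<⇒≱ q (subst (t ≤_) (≡sym e) (ℕₚ.m≤n+m t a)))
        sun-edge _ (ray {b} q) (inj₁ (_ , _ , lt)) = ⊥-elim (ℕₚ.<⇒≱ lt (ℕₚ.m≤n+m t b))
        sun-edge (ray {a} p) _ (inj₁ (_ , lt , _)) = ⊥-elim (ℕₚ.<⇒≱ lt (ℕₚ.m≤n+m t a))
        sun-edge (rim p) (ray {b} q) (inj₂ (inj₁ e)) = ⊥-elim (ℕₚ.<⇒≱ p (subst (t ≤_) (≡sym e) (ℕₚ.m≤n+m t (b + t))))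
        sun-edge (rim {a} p) (ray {b} q) (inj₂ (inj₂ e)) with ℕₚ.+-cancelʳ-≡ t b a e
        ... | refl = A-sym (proj₂ (ok b q))
        sun-edge (ray {a} p) (rim {b} q) (inj₂ (inj₁ e)) with ℕₚ.+-cancelʳ-≡ t a b e
        ... | refl = proj₂ (ok a p)
        sun-edge (ray {a} p) (rim q) (inj₂ (inj₂ e)) = ⊥-elim (ℕₚ.<⇒≱ q (subst (t ≤_) (≡sym e) (ℕₚ.m≤n+m t (a + t))))
        sun-edge (ray {a} p) (ray {b} q) (inj₂ (inj₁ e)) =
          ⊥-elim (ℕₚ.<⇒≱ p (subst (t ≤_) (≡sym (ℕₚ.+-cancelʳ-≡ t a (b + t) e)) (ℕₚ.m≤n+m t b)))
        sun-edge (ray {a} p) (ray {b} q) (inj₂ (inj₂ e)) =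
          ⊥-elim (ℕₚ.<⇒≱ q (subst (t ≤_) (≡sym (ℕₚ.+-cancelʳ-≡ t b (a + t) e)) (ℕₚ.m≤n+m t a)))

        edge-sun : ∀ {a b u v} → Label a u → Label b v → u ~ v → SunAdj t a b
        edge-sun (rim {a} p) (rim {b} q) e with ℕₚ.<-cmp a b
        ... | tri≈ _ refl _ = ⊥-elim (irr refl e)
        ... | tri< a<b _ _ = inj₁ ([ inj₁ , (λ (z , w) → inj₂ (inj₂ (inj₂ (w , z)))) ]′ (rim-adj a<b q e) , p , q)
        ... | tri> _ _ b<a = inj₁ ([ inj₂ ∘ inj₁ , (λ (z , w) → inj₂ (inj₂ (inj₁ (w , z)))) ]′ (rim-adj b<a p (A-sym e)) , p , q)
        edge-sun (rim p) (ray q) e = inj₂ (inj₂ (cong (_+ t) (foot q p (A-sym e))))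
        edge-sun (ray p) (rim q) e = inj₂ (inj₁ (cong (_+ t) (foot p q e)))
        edge-sun (ray {a} p) (ray {b} q) e with ℕₚ.<-cmp a b
        ... | tri≈ _ refl _ = ⊥-elim (irr refl e)
        ... | tri< a<b _ _ = ⊥-elim (clash e (apart a b a<b q))
        ... | tri> _ _ b<a = ⊥-elim (clash (A-sym e) (apart b a b<a p))

        sun-copy : InducedCopy (t + t) (sun t) G
        sun-copy = corner ∘ toℕ ,
          (λ {i} {j} e → Finₚ.toℕ-injective (labels-inj (label _ (Finₚ.toℕ<n i)) (label _ (Finₚ.toℕ<n j)) e)) ,
          λ i j → adjacency (label _ (Finₚ.toℕ<n i)) (label _ (Finₚ.toℕ<n j))
          where
          adjacency : ∀ {a b u v} → Label a u → Label b v → sunAdjℕ t a b ≡ A u v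
          adjacency {a} {b} la lb with SunAdj? t a b in eq
          ... | yes s = trans (sunAdjℕ-does t a b) (trans (cong does eq) (≡sym (sun-edge la lb s)))
          ... | no ¬s = trans (sunAdjℕ-does t a b) (trans (cong does eq) (≡sym (not~ (¬s ∘ edge-sun la lb))))

      contains-sun : InducedCopy (t + t) (sun t) G
      contains-sun with pendants t ℕₚ.≤-refl
      ... | x , ok , apart = sun-copy x ok apart

    no-cycle : NoLongSun G → ∀ t f → 3 ≤ t → Cycle t f → ⊥
    no-cycle noSun = <-rec (λ t → ∀ f → 3 ≤ t → Cycle t f → ⊥) λ where
        zero ih f () c
        (suc r) ih f 3≤t c → let open Shortest r f 3≤t c (λ s f′ 3≤s s<t → ih s<t f′ 3≤s) in
          noSun (suc r) 5≤t contains-sun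

    empty : NoLongSun G → ∀ {w} → w ∈ W → ⊥
    empty noSun wW with exists-cycle wW (λ xW → shorten (degree xW))
      where
      shorten : ∀ {P} → Many 8 P → Many 2 P
      shorten (x , p , y , (q , ne) , _) = x , p , y , (q , ne) , tt
    ... | t , f , 3≤t , c = no-cycle noSun t f 3≤t c

-- Triangle-free graphs

free-colour : ∀ m (l : List ℕ) → length l < m → ∃[ k ] k < m × k ∉ₗ l
free-colour (suc m) l lt with any?ₗ (m ℕₚ.≟_) l
... | no m∉  = m , ℕₚ.≤-refl , m∉
... | yes m∈ with free-colour m (filter (λ k → ¬? (m ℕₚ.≟ k)) l)
                 (ℕₚ.<-≤-trans (filter-notAll (λ k → ¬? (m ℕₚ.≟ k)) l (Any.map (λ e h → h e) m∈)) (ℕₚ.≤-pred lt))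
...   | k , k<m , k∉ = k , ℕₚ.m≤n⇒m≤1+n k<m , λ p →
        k∉ (∈-filter⁺ (λ k → ¬? (m ℕₚ.≟ k)) p (≢-sym (ℕₚ.<⇒≢ k<m)))

parity : ℕ → ℕ
parity 0 = 0
parity 1 = 1
parity (suc (suc k)) = parity k

parity-< : ∀ k → parity k < 2
parity-< 0 = s≤s z≤n
parity-< 1 = s≤s (s≤s z≤n)
parity-< (suc (suc k)) = parity-< k

parity-step : ∀ k → parity (suc k) ≢ parity k
parity-step 0 ()
parity-step (suc k) e = parity-step k (≡sym e)

parity-close : ∀ {a b} → a ≤ suc b → b ≤ suc a → parity a ≡ parity b → a ≡ b
parity-close {a} {b} p q e with ℕₚ.<-cmp a b
... | tri≈ _ a≡b _ = a≡b
... | tri< a<b _ _ = ⊥-elim (parity-step a (trans (cong parity (ℕₚ.≤-antisym a<b q)) (≡sym e)))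
... | tri> _ _ b<a = ⊥-elim (parity-step b (trans (cong parity (ℕₚ.≤-antisym b<a p)) e))

module Recolouring (G : Graph) where
  open Colourings G
  open Layerings G

  col-add : ∀ {m} W x k → k < m → (c : Col ⟦ W ∖ ｛ x ｝ ⟧ m) →
            (∀ {y} → y ∈ W → y ~ x → colour c y ≢ k) → Col ⟦ W ⟧ m
  col-add W x k k<m c ok = col-glue ｛ x ｝
    (col-const k (λ _ → k<m) λ { (_ , refl) (_ , refl) → irrefl G x }) c
    λ { _ refl yW _ xy e → ok yW (A-sym xy) (≡sym e) }

  col-fibres : ∀ {P b} (α : V → ℕ) → (∀ i → Col (λ x → P x × α x ≡ i) b) →
               (∀ {x y} → P x → P y → x ~ y → α x ≡ α y) → Col P b
  col-fibres {P} α fibre α-const = colouring (λ x → colour (fibre (α x)) x)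
    (λ {x} px → within (fibre (α x)) (px , refl))
    λ {x} {y} px py xy e → is-proper (fibre (α x)) (px , refl) (py , ≡sym (α-const px py xy)) xy
      (trans e (cong (λ i → colour (fibre i) y) (≡sym (α-const px py xy))))

  -- Even levels can share one palette, and odd levels another.
  col-levels : ∀ {Y v b} (L : Layering Y v) (U : Sub) → U ⊆ Y →
               (∀ m → Col (λ x → x ∈ U × Layering.d L x ≡ m) b) → Col ⟦ U ⟧ (2 * b)
  col-levels L U U⊆Y level-col = col-classes (parity ∘ d) (λ {x} _ → parity-< (d x)) λ i →
    col-fibres d (λ m → col-⊆ (λ ((xU , _) , e) → xU , e) (level-col m))
      λ (xU , px) (yU , py) xy → parity-close (step (U⊆Y yU) (U⊆Y xU) (A-sym xy)) (step (U⊆Y xU) (U⊆Y yU) xy)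
        (trans px (≡sym py))
    where open Layering L

module TriangleFree (G : Graph) (noSunspot : NoSunspot G) (noSun : NoLongSun G) where
  open Colourings G
  open Layerings G
  open Recolouring G

  module _ {Y : Sub} {v : V} (L : Layering Y v) (tri-free : TriFree ⟦ Y ⟧) (j : ℕ) where
    open Layering L

    -- The deletions of a vertex of degree at most 7 or of a dominated vertex stop only when every
    -- degree is at least 8 and nothing is dominated; `Suns.empty` leaves no vertex in such a set.
    level-colouring : ∀ W → W ⊆ level (2 + j) → Col ⟦ W ⟧ 8
    level-colouring = sub-induction (λ W → W ⊆ level (2 + j) → Col ⟦ W ⟧ 8) step′
      where
      step′ : ∀ W → (∀ W′ → W′ ⊆ W → (∃[ z ] z ∈ W × z ∉ W′) → W′ ⊆ level (2 + j) → Col ⟦ W′ ⟧ 8) →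
             W ⊆ level (2 + j) → Col ⟦ W ⟧ 8
      step′ W ih W⊆ with Finₚ.any? (λ x → mem W x ×-dec ¬? (Many? 8 (λ y → mem W y ×-dec (A x y Bₚ.≟ true))))
      ... | yes (x , xW , low) with few 7 (W ∩ N x) low | ih (W ∖ ｛ x ｝) proj₁ (x , xW , λ (_ , ne) → ne refl) (W⊆ ∘ proj₁)
      ...   | l , len , cover | c with free-colour 8 (map (colour c) l) (s≤s (subst (_≤ 7) (≡sym (length-map (colour c) l)) len))
      ...     | k , k<8 , k∉ = col-add W x k k<8 c λ yW yx e →
                k∉ (subst (_∈ₗ map (colour c) l) e (∈-map⁺ (colour c) (cover _ (yW , A-sym yx))))
      step′ W ih W⊆ | no high
        with Finₚ.any? (λ x → Finₚ.any? (λ z → mem W x ×-dec mem W z ×-dec ¬? (x Finₚ.≟ z) ×-dec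
               ¬? (Finₚ.any? (λ b → mem W b ×-dec (A b x Bₚ.≟ true) ×-dec (A b z Bₚ.≟ false)))))
      ... | yes (x , z , xW , zW , x≢z , dominated)
        with ih (W ∖ ｛ x ｝) proj₁ (x , xW , λ (_ , ne) → ne refl) (W⊆ ∘ proj₁)
      -- Every neighbour of x is a neighbour of z, so x can copy the colour of z; in particular x
      -- and z are not adjacent.
      ...   | c = col-add W x (colour c z) (within c (zW , ≢-sym x≢z)) c λ {y} yW yx e →
                case ~? y z of λ where
                  (inj₁ yz) → is-proper c (yW , ~⇒≢ yx) (zW , ≢-sym x≢z) yz e
                  (inj₂ yz) → dominated (y , yW , yx , yz)
      step′ W ih W⊆ | no high | no undom = col-empty λ (w , wW) → Suns.empty G W
          (λ x y z → tri-free (proj₁ (W⊆ x)) (proj₁ (W⊆ y)) (proj₁ (W⊆ z)))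
          (LevelSets.C4-free G noSunspot L tri-free j W W⊆ undominated degree) degree noSun wW
        where
        undominated : ∀ {x z} → x ∈ W → z ∈ W → x ≢ z → ∃[ b ] b ∈ W × b ~ x × b ≁ z
        undominated {x} {z} xW zW x≢z = decidable-stable
          (Finₚ.any? λ b → mem W b ×-dec (A b x Bₚ.≟ true) ×-dec (A b z Bₚ.≟ false))
          λ h → undom (x , z , xW , zW , x≢z , h)
        degree : ∀ {x} → x ∈ W → Many 8 (λ y → y ∈ W × x ~ y)
        degree {x} xW = decidable-stable (Many? 8 (λ y → mem W y ×-dec (A x y Bₚ.≟ true))) λ h → high (x , xW , h)

  triangle-free-colouring : ∀ U → TriFree ⟦ U ⟧ → Col ⟦ U ⟧ 16
  triangle-free-colouring U tri-free = col-⊆ (λ x → x , tt) (col-components full U component)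
    where
    component : ∀ C → C ⊆ U → Conn true C → Closed C U → ∃ ⟦ C ⟧ → Col ⟦ C ∩ full ⟧ 16
    component C C⊆U conn _ (v , vC) = col-⊆ proj₁ (col-levels L C id by-level)
      where
      L = layering C conn v vC
      open Layering L
      tri-C : TriFree ⟦ C ⟧
      tri-C x y z = tri-free (C⊆U x) (C⊆U y) (C⊆U z)
      by-level : ∀ m → Col (λ x → x ∈ C × d x ≡ m) 8
      by-level 0 = col-const 0 (λ _ → s≤s z≤n) λ (x , dx) (y , dy) → not~ (irr (trans (root x dx) (≡sym (root y dy))))
      by-level 1 = col-const 0 (λ _ → s≤s z≤n) stable
        where
        stable : ∀ {x y} → x ∈ C × d x ≡ 1 → y ∈ C × d y ≡ 1 → x ≁ y
        stable (xC , dx) (yC , dy) with parent xC dx | parent yC dy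
        ... | p , pC , px , dp | q , qC , qy , dq with root pC dp | root qC dq
        ...   | refl | refl = not~ λ xy → tri-C pC xC yC px xy qy
      by-level (suc (suc j)) = level-colouring L tri-C j (level (2 + j)) id

-- Prime graphs

down : ℕ → List ℕ
down zero    = []
down (suc k) = k ∷ down k

down-< : ∀ k {i} → i ∈ₗ down k → i < k
down-< (suc k) (here refl) = ℕₚ.≤-refl
down-< (suc k) (there p)   = ℕₚ.m≤n⇒m≤1+n (down-< k p)

down-uniq : ∀ k → Uniq (down k)
down-uniq zero    = tt
down-uniq (suc k) = (λ p → ℕₚ.<-irrefl refl (down-< k p)) , down-uniq k

length-down : ∀ k → length (down k) ≡ k
length-down zero    = refl
length-down (suc k) = cong suc (length-down k)

-- The factors: 2 for the parity of levels, 1 for a maximal stable set, w for the heights, w + w for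
-- two perfect sets covering a neighbourhood within a level, and 16 for triangle-free classes.
β : ℕ → ℕ
β w = 2 * (1 + w * ((w + w) * 16))

module PrimeSets (G : Graph) (noBull : NoBull G) (noSunspot : NoSunspot G) (noSun : NoLongSun G) where
  open NiceSets G noBull
  open Layerings G
  open Ladders G noSunspot
  open Recolouring G
  open StableTraces G noBull using (local-to-global)
  open TriangleFree G noSunspot noSun using (triangle-free-colouring)

  Prime : Sub → Set₁
  Prime R = ∀ D {x y r} → D ⊆ R → x ∈ D → y ∈ D → x ≢ y → r ∈ R → r ∉ D →
            ∃[ q ] q ∈ R × q ∉ D × (∃[ e ] e ∈ D × q ~ e) × (∃[ f ] f ∈ D × q ≁ f)

  conn-add : ∀ X → Conn true X → ∀ {u x₀} → x₀ ∈ X → u ~ x₀ → Conn true (X ∪ ｛ u ｝)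
  conn-add X conn x₀X ux₀ S (inj₁ xX) xS (inj₁ yX) yS with conn S xX xS yX yS
  ... | e , f , (eX , eS) , (fX , fS) , ef = e , f , (inj₁ eX , eS) , (inj₁ fX , fS) , ef
  conn-add X conn {u} {x₀} x₀X ux₀ S (inj₁ xX) xS (inj₂ refl) uS with mem S x₀
  ... | yes x₀S = x₀ , u , (inj₁ x₀X , x₀S) , (inj₂ refl , uS) , A-sym ux₀
  ... | no x₀S with conn S xX xS x₀X x₀S
  ...   | e , f , (eX , eS) , (fX , fS) , ef = e , f , (inj₁ eX , eS) , (inj₁ fX , fS) , ef
  conn-add X conn {u} {x₀} x₀X ux₀ S (inj₂ refl) uS (inj₁ yX) yS with mem S x₀
  ... | no x₀S = u , x₀ , (inj₂ refl , uS) , (inj₁ x₀X , x₀S) , ux₀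
  ... | yes x₀S with conn S x₀X x₀S yX yS
  ...   | e , f , (eX , eS) , (fX , fS) , ef = e , f , (inj₁ eX , eS) , (inj₁ fX , fS) , ef
  conn-add X conn x₀X ux₀ S (inj₂ refl) uS (inj₂ refl) uS′ = ⊥-elim (uS′ uS)

  perfect-col : ∀ {D} → Perfect D → ∀ U → Col ⟦ D ∩ U ⟧ (ω (D ∩ U))
  perfect-col {D} perfect U = colouring (colour c) (λ p → down-< k (within c p)) (is-proper c)
    where
    k = ω (D ∩ U)
    c = perfect U (down k) (down-uniq k) (ℕₚ.≤-reflexive (≡sym (length-down k)))

  module _ (R : Sub) (prime : Prime R) {v : V} (vR : v ∈ R) where

    M : Sub
    M = R ∖ N v ∖ ｛ v ｝

    private
      v≁ : ∀ {x} → x ∈ M → v ≁ x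
      v≁ ((_ , h) , _) = not~ h

      -- A bull on w e f with pendants v and y. So a vertex of M missed by w is uniform on connected
      -- sets of neighbours of w in M.
      through-v : ∀ {w e f y} → v ~ w → e ∈ M → f ∈ M → w ~ e → w ~ f → e ~ f →
                  y ∈ M → w ≁ y → y ~ e → y ≁ f → ⊥
      through-v vw eM fM we wf ef yM wy ye yf =
        noBull we ef wf vw ye (v≁ eM) (v≁ fM) (A-sym wy) yf (v≁ yM)

      -- If q saw c, then c and the end e′ of a split nonadjacent pair would form a triangle with q,
      -- with v at q and f′ at c as pendants.
      centre-avoids : ∀ {c q e f} D → D ⊆ M → Conn false D → c ∈ M → (∀ {x} → x ∈ D → c ~ x) → v ~ q →
                      e ∈ D → f ∈ D → q ~ e → q ≁ f → c ≁ q
      centre-avoids {q = q} D D⊆M conn cM full vq eD fD qe qf with mixed-pair {D = D} conn q eD fD qe qf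
      ... | e′ , f′ , e′D , f′D , qe′ , qf′ , ef′ = not~ λ cq →
        through-v vq cM (D⊆M e′D) (A-sym cq) qe′ (full e′D) (D⊆M f′D) qf′ (A-sym (full f′D)) (A-sym ef′)

    module Component (X : Sub) (X⊆M : X ⊆ M) (conn : Conn true X) (closed : Closed X M)
                     {u x₀ y₀ : V} (uR : u ∈ R) (x₀X : x₀ ∈ X) (y₀X : y₀ ∈ X) (ux₀ : u ~ x₀) (uy₀ : u ≁ y₀)
                     (vu : v ~ u) where

      -- Of all neighbours of v only u is kept, so level 1 is u alone and level 2 consists of the
      -- neighbours of u in X.
      Y : Sub
      Y = X ∪ ｛ u ｝ ∪ ｛ v ｝

      L : Layering Y v
      L = layering Y (conn-add (X ∪ ｛ u ｝) (conn-add X conn x₀X ux₀) (inj₂ refl) vu) v (inj₂ refl)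
      open Layering L

      private
        X⊆Y : X ⊆ Y
        X⊆Y = inj₁ ∘ inj₁
        uY : u ∈ Y
        uY = inj₁ (inj₂ refl)
        vY : v ∈ Y
        vY = inj₂ refl
        dv : d v ≡ 0
        dv = d-root vY
        du : d u ≤ 1
        du = ℕₚ.≤-trans (step vY uY vu) (ℕₚ.≤-reflexive (cong suc dv))

        first : ∀ {x} → x ∈ Y → d x ≡ 1 → x ≡ u
        first {x} xY dx with parent xY dx
        ... | p , pY , px , dp with root pY dp | xY
        ...   | refl | inj₁ (inj₁ xX)   = ⊥-elim (clash px (v≁ (X⊆M xX)))
        ...   | refl | inj₁ (inj₂ refl) = refl
        ...   | refl | inj₂ refl        = ⊥-elim (irr refl px)

        u∉X : u ∉ X
        u∉X uX = clash vu (v≁ (X⊆M uX))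

        deep : ∀ {x} → x ∈ X → 2 ≤ d x
        deep {x} xX with d x in dx
        ... | 0 = ⊥-elim (proj₂ (X⊆M xX) (root (X⊆Y xX) dx))
        ... | 1 = ⊥-elim (u∉X (subst (_∈ X) (first (X⊆Y xX) dx) xX))
        ... | suc (suc _) = s≤s (s≤s z≤n)

        inX : ∀ {x} → x ∈ Y → 2 ≤ d x → x ∈ X
        inX (inj₁ (inj₁ xX))   _  = xX
        inX (inj₁ (inj₂ refl)) le = ⊥-elim (ℕₚ.<⇒≱ le du)
        inX (inj₂ refl)        le = ⊥-elim (ℕₚ.<⇒≱ le (ℕₚ.≤-trans (ℕₚ.≤-reflexive dv) z≤n))

        below : ∀ {p x k} → p ∈ Y → x ∈ Y → d p ≡ k → 2 + k ≤ d x → p ≁ x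
        below pY xY dp le = far pY xY (subst (λ j → 2 + j ≤ _) (≡sym dp) le)

        -- A common parent p′ would form a bull with p, r, its own parent p″ and n. If p′ is the
        -- root, both p and r equal u.
        priv : PrivateParents L
        priv {p} {r} {p′} {n} pY rY p′Y nY dpr pr p′p dp′ np nr np′ le with d p′ in dp′≡
        ... | zero = ⊥-elim (irr (trans (first pY (≡sym dp′)) (≡sym (first rY (trans (≡sym dpr) (≡sym dp′))))) pr)
        ... | suc i with parent p′Y dp′≡
        ...   | p″ , p″Y , p″p′ , dp″ = not~ λ p′r → noBull p′p pr p′r p″p′ np
                (below p″Y pY dp″ (ℕₚ.≤-reflexive dp′)) (below p″Y rY dp″ (ℕₚ.≤-reflexive (trans dp′ dpr)))
                np′ nr (below p″Y nY dp″ (ℕₚ.≤-trans (ℕₚ.≤-reflexive dp′) le))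

        -- The edge and the common child n′ form a triangle whose pendants are parents of p and of
        -- r: `priv` makes these parents private, and the ladder with n makes them nonadjacent.
        same-children : ∀ {k p r n n′} → p ∈ Y → r ∈ Y → n ∈ Y → n′ ∈ Y → d p ≡ suc k → d r ≡ suc k →
                        2 + k ≤ d n → 2 + k ≤ d n′ → p ~ r → n ~ p → n ≁ r → n′ ~ p → n′ ~ r → ⊥
        same-children {k} pY rY nY n′Y dp dr dn dn′ pr np nr n′p n′r with parent pY dp | parent rY dr
        ... | p′ , p′Y , p′p , dp′ | r′ , r′Y , r′r , dr′ = noBull pr (A-sym n′r) (A-sym n′p) p′p r′r
            p′≁r (below p′Y n′Y dp′ dn′) r′≁p (below r′Y n′Y dr′ dn′)
            (ladder L priv (suc k) pY rY p′Y r′Y nY dp dr pr np nr (ℕₚ.<⇒≤ dn) p′p (cong suc dp′) r′r (cong suc dr′)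
              n≁p′ n≁r′)
          where
          n≁p′ = A-sym (below p′Y nY dp′ dn)
          n≁r′ = A-sym (below r′Y nY dr′ dn)
          le : d _ ≤ d _
          le = ℕₚ.≤-trans (ℕₚ.≤-reflexive dp) (ℕₚ.<⇒≤ dn)
          p′≁r = priv pY rY p′Y nY (trans dp (≡sym dr)) pr p′p (trans (cong suc dp′) (≡sym dp)) np nr n≁p′ le
          r′≁p = not~ λ r′p → clash r′r
            (priv pY rY r′Y nY (trans dp (≡sym dr)) pr r′p (trans (cong suc dr′) (≡sym dp)) np nr n≁r′ le)

        locate : ∀ {q e} → q ∈ R → e ∈ X → q ~ e → v ~ q ⊎ q ∈ X
        locate {q} qR eX qe with ~? v q | q Finₚ.≟ v | mem X q
        ... | inj₁ vq | _ | _ = inj₁ vq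
        ... | inj₂ _ | _ | yes qX = inj₂ qX
        ... | inj₂ _ | yes refl | no _ = ⊥-elim (clash qe (v≁ (X⊆M eX)))
        ... | inj₂ vq | no q≢v | no q∉X =
          ⊥-elim (clash (A-sym qe) (closed eX ((qR , λ h → clash h vq) , q≢v) q∉X))

        Distinguisher : Sub → V → Set
        Distinguisher D q = (∃[ a ] a ~ q × (∀ {x} → x ∈ D → a ≁ x)) × (∃[ c ] c ≁ q × (∀ {x} → x ∈ D → c ~ x))

        -- Primeness yields a vertex q that splits the module. If q is a neighbour of v, then v is
        -- its anticomplete neighbour and `centre-avoids` handles the centre c; only a q in X needs
        -- an argument specific to the set.
        nice-by : ∀ D → D ⊆ X →
          (∀ D′ → IsModule D′ D → Conn true D′ → Conn false D′ →
            ∃[ c ] c ∈ X × (∀ {x} → x ∈ D′ → c ~ x) ×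
              (∀ {q e f} → q ∈ X → q ∉ D′ → e ∈ D′ → f ∈ D′ → q ~ e → q ≁ f → Distinguisher D′ q)) → Nice D
        nice-by D D⊆X h D′ m@(D′⊆ , _) ct cf (x , y , xD , yD , x≢y)
          with h D′ m ct cf | prime D′ (proj₁ ∘ proj₁ ∘ X⊆M ∘ D⊆X ∘ D′⊆) xD yD x≢y vR
                                (λ vD → proj₂ (X⊆M (D⊆X (D′⊆ vD))) refl)
        ... | c , cX , c-full , inner | q , qR , q∉ , (e , eD , qe) , (f , fD , qf)
          with locate qR (D⊆X (D′⊆ eD)) qe
        ...   | inj₁ vq = q , v , c , (e , eD , qe) , (f , fD , qf) , (vq , v≁ ∘ X⊆M ∘ D⊆X ∘ D′⊆) ,
                  (centre-avoids D′ (X⊆M ∘ D⊆X ∘ D′⊆) cf (X⊆M cX) c-full vq eD fD qe qf , c-full)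
        ...   | inj₂ qX with inner qX q∉ eD fD qe qf
        ...     | (a , a-spec) , (c′ , c′-spec) = q , a , c′ , (e , eD , qe) , (f , fD , qf) , a-spec , c′-spec

      nice-level₂ : Nice (level 2)
      nice-level₂ D′ m@(D′⊆ , module-eq) ct cf two@(x , _ , xD , _) =
        nice-by (level 2) ⊆X (λ D′ m ct cf → centre D′ m ct cf) D′ m ct cf two
        where
        ⊆X : level 2 ⊆ X
        ⊆X (xY , dx) = inX xY (ℕₚ.≤-reflexive (≡sym dx))
        u-full : ∀ {x} → x ∈ level 2 → u ~ x
        u-full (xY , dx) with parent xY dx
        ... | p , pY , px , dp = subst (_~ _) (first pY dp) px
        centre : ∀ D′ → IsModule D′ (level 2) → Conn true D′ → Conn false D′ →
            ∃[ c ] c ∈ X × (∀ {x} → x ∈ D′ → c ~ x) ×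
              (∀ {q e f} → q ∈ X → q ∉ D′ → e ∈ D′ → f ∈ D′ → q ~ e → q ≁ f → Distinguisher D′ q)
        centre D′ (D′⊆ , module-eq) ct cf with inhab? D′
        ... | no empty = y₀ , y₀X , (λ xD → ⊥-elim (empty (_ , xD))) , λ _ _ eD _ _ _ → ⊥-elim (empty (_ , eD))
        -- Here u ≁ y₀ is used: y₀ lies outside level 2, so an edge of X leaves D′, and its outer
        -- end z is the centre.
        ... | yes (x , xD) with conn D′ (⊆X (D′⊆ xD)) xD y₀X (λ yD → clash (u-full (D′⊆ yD)) uy₀)
        ...   | e , z , (_ , eD) , (zX , z∉) , ez = z , zX ,
                (λ yD → trans (unmixing zX z∉ yD eD) (A-sym ez)) ,
                λ qX q∉ eD fD qe qf → ⊥-elim (clash (trans (≡sym (unmixing qX q∉ eD fD)) qe) qf)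
          where
          unmixing : ∀ {q} → q ∈ X → q ∉ D′ → ∀ {x y} → x ∈ D′ → y ∈ D′ → A q x ≡ A q y
          unmixing {q} qX q∉ with ~? u q
          ... | inj₁ uq = module-eq (X⊆Y qX , ℕₚ.≤-antisym (ℕₚ.≤-trans (step uY (X⊆Y qX) uq) (s≤s du)) (deep qX)) q∉
          ... | inj₂ uq = unmixed D′ ct q λ eD fD qe qf ef → through-v vu (X⊆M (⊆X (D′⊆ eD))) (X⊆M (⊆X (D′⊆ fD)))
                  (u-full (D′⊆ eD)) (u-full (D′⊆ fD)) ef (X⊆M qX) uq qe qf

      module Deep (k : ℕ) {p : V} (pY : p ∈ Y) (dp : d p ≡ 2 + k) where
        private
          pX : p ∈ X
          pX = inX pY (subst (2 ≤_) (≡sym dp) (s≤s (s≤s z≤n)))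
          p′ = proj₁ (parent pY dp)
          p′Y = proj₁ (proj₂ (parent pY dp))
          p′p = proj₁ (proj₂ (proj₂ (parent pY dp)))
          dp′ = proj₂ (proj₂ (proj₂ (parent pY dp)))

        Children : Sub
        Children = level (3 + k) ∩ N p

        -- The centre is p. A splitting q on the level of p has its own parent as anticomplete
        -- neighbour if it misses p, and contradicts `same-children` if it sees p. A deeper q that
        -- sees p lies in `Children`; one that misses p gives a bull on p and a split edge, with
        -- pendants p′ and q.
        nice-children : Nice Children
        nice-children = nice-by Children ⊆X λ D′ (D′⊆ , module-eq) ct cf → p , pX , proj₂ ∘ D′⊆ ,
          λ {q} {e} {f} qX q∉ eD fD qe qf → inner D′ D′⊆ module-eq ct qX q∉ eD fD qe qf
          where
          ⊆X : Children ⊆ X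
          ⊆X ((xY , dx) , _) = inX xY (subst (2 ≤_) (≡sym dx) (s≤s (s≤s z≤n)))
          inner : ∀ D′ → D′ ⊆ Children →
            (∀ {y x x′} → y ∈ Children → y ∉ D′ → x ∈ D′ → x′ ∈ D′ → A y x ≡ A y x′) → Conn true D′ →
            ∀ {q e f} → q ∈ X → q ∉ D′ → e ∈ D′ → f ∈ D′ → q ~ e → q ≁ f → Distinguisher D′ q
          inner D′ D′⊆ module-eq ct {q} {e} {f} qX q∉ eD fD qe qf with D′⊆ eD | D′⊆ fD | d q ℕₚ.≟ 2 + k | ~? p q
          ... | (eY , de) , pe | (fY , df) , pf | yes dq | inj₁ pq =
            ⊥-elim (same-children pY (X⊆Y qX) fY eY dp dq (ℕₚ.≤-reflexive (≡sym df)) (ℕₚ.≤-reflexive (≡sym de)) pq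
              (A-sym pf) (A-sym qf) (A-sym pe) (A-sym qe))
          ... | _ | _ | yes dq | inj₂ pq with parent (X⊆Y qX) dq
          ...   | q′ , q′Y , q′q , dq′ = (q′ , q′q , λ xD → let ((xY , dx) , _) = D′⊆ xD in
                    below q′Y xY dq′ (ℕₚ.≤-reflexive (≡sym dx))) , (p , pq , proj₂ ∘ D′⊆)
          inner D′ D′⊆ module-eq ct {q} {e} {f} qX q∉ eD fD qe qf
              | (eY , de) , pe | _ | no dq≢ | inj₁ pq = ⊥-elim (clash (trans (≡sym (module-eq
                ((X⊆Y qX , ℕₚ.≤-antisym (ℕₚ.≤-trans (step pY (X⊆Y qX) pq) (ℕₚ.≤-reflexive (cong suc dp)))
                  (ℕₚ.≤∧≢⇒< (ℕₚ.≤-pred (subst (_≤ suc (d q)) de (step (X⊆Y qX) eY qe))) (≢-sym dq≢))) , pq)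
                q∉ eD fD)) qe) qf)
          inner D′ D′⊆ module-eq ct {q} {e} {f} qX q∉ eD fD qe qf
              | (eY , de) , pe | _ | no dq≢ | inj₂ pq with mixed-pair {D = D′} ct q eD fD qe qf
          ...   | e′ , f′ , e′D , f′D , qe′ , qf′ , ef′ with D′⊆ e′D | D′⊆ f′D
          ...     | (e′Y , de′) , pe′ | (f′Y , df′) , pf′ = ⊥-elim (noBull pe′ ef′ pf′ p′p qe′
                      (below p′Y e′Y dp′ (ℕₚ.≤-reflexive (≡sym de′))) (below p′Y f′Y dp′ (ℕₚ.≤-reflexive (≡sym df′)))
                      (A-sym pq) qf′ (below p′Y (X⊆Y qX) dp′
                        (ℕₚ.≤∧≢⇒< (ℕₚ.≤-pred (subst (_≤ suc (d q)) de (step (X⊆Y qX) eY qe))) (≢-sym dq≢))))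

        module _ {z} (zY : z ∈ Y) (dz : d z ≡ 3 + k) (pz : p ~ z) where
          private
            zX : z ∈ X
            zX = inX zY (subst (2 ≤_) (≡sym dz) (s≤s (s≤s z≤n)))

          Remote : Sub
          Remote = ((λ x → x ∈ Y × 3 + k ≤ d x) ∣ λ x → mem Y x ×-dec (3 + k ℕₚ.≤? d x)) ∩ N z ∖ N p

          -- The centre is z. On the level of p, a splitting q that misses z is distinguished by its
          -- parent, and one that sees z gives a bull on q, z, e′. A deeper q that sees both p and z
          -- gives a bull on p, z, q; one that sees only z is in the set; one that sees only p has p
          -- as anticomplete neighbour; one that sees neither gives a bull on z and a split edge.
          nice-remote : Nice Remote
          nice-remote = nice-by Remote ⊆X λ D′ (D′⊆ , module-eq) ct cf → z , zX , proj₂ ∘ proj₁ ∘ D′⊆ ,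
            λ {q} {e} {f} qX q∉ eD fD qe qf → inner D′ D′⊆ module-eq ct cf qX q∉ eD fD qe qf
            where
            ⊆X : Remote ⊆ X
            ⊆X (((xY , dx) , _) , _) = inX xY (ℕₚ.≤-trans (s≤s (s≤s z≤n)) dx)
            inner : ∀ D′ → D′ ⊆ Remote →
              (∀ {y x x′} → y ∈ Remote → y ∉ D′ → x ∈ D′ → x′ ∈ D′ → A y x ≡ A y x′) → Conn true D′ → Conn false D′ →
              ∀ {q e f} → q ∈ X → q ∉ D′ → e ∈ D′ → f ∈ D′ → q ~ e → q ≁ f → Distinguisher D′ q
            inner D′ D′⊆ module-eq ct cf {q} {e} {f} qX q∉ eD fD qe qf with d q ℕₚ.≟ 2 + k | ~? z q
            ... | yes dq | inj₂ zq with parent (X⊆Y qX) dq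
            ...   | q′ , q′Y , q′q , dq′ = (q′ , q′q , λ xD → let (((xY , dx) , _) , _) = D′⊆ xD in
                      below q′Y xY dq′ dx) , (z , zq , proj₂ ∘ proj₁ ∘ D′⊆)
            inner D′ D′⊆ module-eq ct cf {q} {e} {f} qX q∉ eD fD qe qf | yes dq | inj₁ zq
              with parent (X⊆Y qX) dq | mixed-pair {D = D′} cf q eD fD qe qf
            ... | q′ , q′Y , q′q , dq′ | e′ , f′ , e′D , f′D , qe′ , qf′ , ef′ with D′⊆ e′D | D′⊆ f′D
            ...   | (((e′Y , de′) , ze′) , _) | (((f′Y , df′) , zf′) , _) = ⊥-elim (noBull (A-sym zq) ze′ qe′ q′q (A-sym zf′)
                      (below q′Y zY dq′ (ℕₚ.≤-reflexive (≡sym dz))) (below q′Y e′Y dq′ de′)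
                      (A-sym qf′) (A-sym ef′) (below q′Y f′Y dq′ df′))
            inner D′ D′⊆ module-eq ct cf {q} {e} {f} qX q∉ eD fD qe qf | no dq≢ | zq?
              with D′⊆ eD | D′⊆ fD | ~? p q | zq?
            ... | (((eY , de) , ze) , pe) | (((fY , df) , zf) , pf) | inj₁ pq | inj₁ zq =
              ⊥-elim (noBull pz zq pq p′p (A-sym zf) (below p′Y zY dp′ (ℕₚ.≤-reflexive (≡sym dz)))
                (below p′Y (X⊆Y qX) dp′ q-deep) (A-sym (not~ pf)) (A-sym qf) (below p′Y fY dp′ df))
              where
              q-deep = ℕₚ.≤∧≢⇒< (ℕₚ.≤-pred (ℕₚ.≤-trans de (step (X⊆Y qX) eY qe))) (≢-sym dq≢)
            ... | (((eY , de) , ze) , pe) | _ | inj₂ pq | inj₁ zq =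
              ⊥-elim (clash (trans (≡sym (module-eq (((X⊆Y qX , q-deep) , zq) , λ h → clash h pq) q∉ eD fD)) qe) qf)
              where
              q-deep = ℕₚ.≤∧≢⇒< (ℕₚ.≤-pred (ℕₚ.≤-trans de (step (X⊆Y qX) eY qe))) (≢-sym dq≢)
            ... | _ | _ | inj₁ pq | inj₂ zq = (p , pq , λ xD → not~ (proj₂ (D′⊆ xD))) , (z , zq , proj₂ ∘ proj₁ ∘ D′⊆)
            ... | _ | _ | inj₂ pq | inj₂ zq with mixed-pair {D = D′} ct q eD fD qe qf
            ...   | e′ , f′ , e′D , f′D , qe′ , qf′ , ef′ with D′⊆ e′D | D′⊆ f′D
            ...     | ((_ , ze′) , pe′) | ((_ , zf′) , pf′) =
              ⊥-elim (noBull ze′ ef′ zf′ pz qe′ (not~ pe′) (not~ pf′) (A-sym zq) qf′ pq)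

      level-bound : ∀ U m → Col (λ x → x ∈ X ∩ U × d x ≡ m) (1 + ω U * ((ω U + ω U) * 16))
      level-bound U 0 = col-empty λ (x , (xX , _) , dx) → ℕₚ.<⇒≱ (deep xX) (subst (_≤ 1) (≡sym dx) z≤n)
      level-bound U 1 = col-empty λ (x , (xX , _) , dx) → ℕₚ.<⇒≱ (deep xX) (ℕₚ.≤-reflexive dx)
      level-bound U 2 = col-≤ small (col-⊆ (λ ((xX , xU) , dx) → (X⊆Y xX , dx) , xU)
          (perfect-col {level 2} (nice⇒perfect (level 2) nice-level₂) U))
        where
        linear : ∀ w → w ≤ 1 + w * ((w + w) * 16)
        linear zero    = z≤n
        linear (suc w) = ℕₚ.m≤n⇒m≤1+n (ℕₚ.m≤m*n (suc w) ((suc w + suc w) * 16))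
        small : ω (level 2 ∩ U) ≤ 1 + ω U * ((ω U + ω U) * 16)
        small = ℕₚ.≤-trans (ω-mono (level 2 ∩ U) U proj₂) (linear (ω U))
      level-bound U (suc (suc (suc k))) = col-⊆ (λ ((xX , xU) , dx) → (X⊆Y xX , dx) , xU)
          (col-≤ (s≤s (ℕₚ.*-monoˡ-≤ ((ω U + ω U) * 16) (ω-mono U′ U proj₂)))
            (local-to-global U′ (λ T _ → triangle-free-colouring T) local))
        where
        U′ : Sub
        U′ = level (3 + k) ∩ U
        local : ∀ s → s ∈ U′ → Col ⟦ U′ ∩ N s ⟧ (ω U + ω U)
        local s ((sY , ds) , _) with parent sY ds
        ... | p , pY , ps , dp = col-∪ (N p)
          (col-⊆ (λ (((lx , xU) , _) , px) → (lx , px) , xU) (col-≤ (ω-mono (Children ∩ U) U proj₂)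
            (perfect-col {Children} (nice⇒perfect Children nice-children) U)))
          (col-⊆ (λ ((((xY , dx) , xU) , sx) , px) → (((xY , ℕₚ.≤-reflexive (≡sym dx)) , sx) , px) , xU)
            (col-≤ (ω-mono (Remote sY ds ps ∩ U) U proj₂)
              (perfect-col {Remote sY ds ps} (nice⇒perfect (Remote sY ds ps) (nice-remote sY ds ps)) U)))
          where open Deep k pY dp

      component-colouring : ∀ U → Col ⟦ X ∩ U ⟧ (β (ω U))
      component-colouring U = col-levels L (X ∩ U) (X⊆Y ∘ proj₁) (level-bound U)

    antineighbours : ∀ U → Col ⟦ M ∩ U ⟧ (β (ω U))
    antineighbours U = col-components U M component
      where
      component : ∀ X → X ⊆ M → Conn true X → Closed X M → ∃ ⟦ X ⟧ → Col ⟦ X ∩ U ⟧ (β (ω U))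
      component X X⊆M conn closed _ with two? X
      ... | no ¬two = col-const 0 (λ _ → s≤s z≤n) λ {x} (xX , _) (yX , _) → subst (x ≁_) (one {X} ¬two xX yX) (irrefl G x)
      ... | yes (x , y , xX , yX , x≢y)
        -- X is closed in M, so the vertex that splits it cannot lie in M and must be a neighbour of
        -- v.
        with prime X (proj₁ ∘ proj₁ ∘ X⊆M) xX yX x≢y vR (λ vX → proj₂ (X⊆M vX) refl)
      ...   | u , uR , u∉X , (x₀ , x₀X , ux₀) , (y₀ , y₀X , uy₀) =
        Component.component-colouring X X⊆M conn closed uR x₀X y₀X ux₀ uy₀ vu U
        where
        vu : v ~ u
        vu with ~? v u | u Finₚ.≟ v
        ... | inj₁ e | _        = e
        ... | inj₂ _ | yes refl = ⊥-elim (clash ux₀ (v≁ (X⊆M x₀X)))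
        ... | inj₂ e | no u≢v   = ⊥-elim (clash (A-sym ux₀) (closed x₀X ((uR , λ h → clash h e) , u≢v) u∉X))

  module _ (R : Sub) (prime : Prime R) where

    β-mono : ∀ {a b} → a ≤ b → β a ≤ β b
    β-mono a≤b = ℕₚ.*-monoʳ-≤ 2 (s≤s (ℕₚ.*-mono-≤ a≤b (ℕₚ.*-monoˡ-≤ 16 (ℕₚ.+-mono-≤ a≤b a≤b))))

    -- Removing a vertex together with its non-neighbours lowers the clique number.
    peel : ∀ K k U → U ⊆ R → ω U ≤ k → k ≤ K → Col ⟦ U ⟧ (k * (1 + β K))
    peel K k U U⊆R ω≤ k≤K with inhab? U
    ... | no empty = col-empty empty
    peel K zero U U⊆R ω≤ k≤K | yes (v , vU) = ⊥-elim (ℕₚ.<⇒≱ (ω-pos U vU) ω≤)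
    peel K (suc k) U U⊆R ω≤ k≤K | yes (v , vU) = col-≤ (ℕₚ.≤-reflexive (ℕₚ.+-comm (k * (1 + β K)) (1 + β K)))
      (col-∪ (N v)
        (peel K k (U ∩ N v) (U⊆R ∘ proj₁)
          (ℕₚ.≤-pred (ℕₚ.≤-trans (ω-max U (v , vU , ω-has (U ∩ N v))) ω≤)) (ℕₚ.<⇒≤ k≤K))
        (col-∪ {a = 1} {b = β K} ｛ v ｝
          (col-const 0 (λ _ → s≤s z≤n) λ { (_ , refl) (_ , refl) → irrefl G v })
          (col-⊆ (λ ((xU , x≁) , x≢) → ((U⊆R xU , x≁) , x≢) , xU)
            (col-≤ (β-mono (ℕₚ.≤-trans ω≤ k≤K)) (antineighbours R prime (U⊆R vU) U)))))

-- Arithmetic of the exponents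

private
  ^-distribʳ-* : ∀ o m n → (m * n) ^ o ≡ m ^ o * n ^ o
  ^-distribʳ-* zero    m n = refl
  ^-distribʳ-* (suc o) m n = trans (cong (m * n *_) (^-distribʳ-* o m n))
    (solve 4 (λ a b c d → a :* b :* (c :* d) := a :* c :* (b :* d)) refl m n (m ^ o) (n ^ o))

  4*2^10≤2^26 : 4 * 2 ^ 10 ≤ 2 ^ 26
  4*2^10≤2^26 = ℕₚ.^-monoʳ-≤ 2 {12} {26} (ℕₚ.m≤m+n 12 14)

-- The light modules of weight between x and m, coloured with g ^ 10 · m ^ 37 colours, fit into their slot.
slot-fits : ∀ g x Ω m → g * x ≤ Ω → m ≤ 2 * x → 2 * m ≤ Ω → 2 * (g ^ 10 * m ^ 37) ≤ x * Ω ^ 36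
slot-fits g x Ω m gx mx mΩ = begin
  2 * (g ^ 10 * m ^ 37)
    -- 37 = 1 + 10 + 26: one factor m turns into 2x, ten more pair up with g ^ 10 to give Ω ^ 10,
    -- and since 2m ≤ Ω the last 26 absorb the twelve factors 2 collected by then.
    ≡⟨ cong (λ z → 2 * (g ^ 10 * z)) (trans (ℕₚ.^-distribˡ-+-* m 11 26) (cong (_* m ^ 26) (ℕₚ.^-distribˡ-+-* m 1 10))) ⟩
  2 * (g ^ 10 * (m ^ 1 * m ^ 10 * m ^ 26))
    ≤⟨ ℕₚ.*-monoʳ-≤ 2 (ℕₚ.*-monoʳ-≤ (g ^ 10) (ℕₚ.*-monoˡ-≤ (m ^ 26)
         (ℕₚ.*-mono-≤ (ℕₚ.≤-trans (ℕₚ.≤-reflexive (ℕₚ.^-identityʳ m)) mx) (ℕₚ.^-monoˡ-≤ 10 mx)))) ⟩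
  2 * (g ^ 10 * (2 * x * (2 * x) ^ 10 * m ^ 26))
    ≡⟨ cong (λ z → 2 * (g ^ 10 * (2 * x * z * m ^ 26))) (^-distribʳ-* 10 2 x) ⟩
  2 * (g ^ 10 * (2 * x * (2 ^ 10 * x ^ 10) * m ^ 26))
    ≡⟨ regroup (g ^ 10) x (2 ^ 10) (x ^ 10) (m ^ 26) ⟩
  x * (g ^ 10 * x ^ 10 * (4 * 2 ^ 10 * m ^ 26))
    ≤⟨ ℕₚ.*-monoʳ-≤ x (ℕₚ.*-mono-≤
         (ℕₚ.≤-trans (ℕₚ.≤-reflexive (≡sym (^-distribʳ-* 10 g x))) (ℕₚ.^-monoˡ-≤ 10 gx))
         (ℕₚ.≤-trans (ℕₚ.*-monoˡ-≤ (m ^ 26) 4*2^10≤2^26)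
           (ℕₚ.≤-trans (ℕₚ.≤-reflexive (≡sym (^-distribʳ-* 26 2 m))) (ℕₚ.^-monoˡ-≤ 26 mΩ)))) ⟩
  x * (Ω ^ 10 * Ω ^ 26)
    ≡⟨ cong (x *_) (≡sym (ℕₚ.^-distribˡ-+-* Ω 10 26)) ⟩
  x * Ω ^ 36 ∎
  where
  open ℕₚ.≤-Reasoning
  regroup : ∀ G x T X M → 2 * (G * (2 * x * (T * X) * M)) ≡ x * (G * X * (4 * T * M))
  regroup = solve 5 (λ G x T X M → con 2 :* (G :* (con 2 :* x :* (T :* X) :* M)) :=
                                   x :* (G :* X :* (con 4 :* T :* M))) refl

-- Since β w = 2 + 64 w ^ 2, the left side is 3w + 64 w ^ 3 ≤ 128 w ^ 3, and 128 = 2 ^ 7 ≤ w ^ 7.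
prime-bound : ∀ w → 2 ≤ w → w * (1 + β w) ≤ w ^ 10
prime-bound w 2≤w = begin
  w * (1 + β w)
    ≡⟨ solve 1 (λ w → w :* (con 1 :+ con 2 :* (con 1 :+ w :* ((w :+ w) :* con 16))) :=
                       con 3 :* w :+ con 64 :* (w :* (w :* w))) refl w ⟩
  3 * w + 64 * (w * (w * w))
    ≤⟨ ℕₚ.+-monoˡ-≤ (64 * (w * (w * w))) (ℕₚ.*-mono-≤ (ℕₚ.m≤m+n 3 61)
         (ℕₚ.≤-trans (ℕₚ.≤-reflexive (≡sym (ℕₚ.*-identityʳ w))) (ℕₚ.*-monoʳ-≤ w (ℕₚ.*-mono-≤ 1≤w 1≤w)))) ⟩
  64 * (w * (w * w)) + 64 * (w * (w * w))
    ≡⟨ solve 1 (λ w → con 64 :* (w :* (w :* w)) :+ con 64 :* (w :* (w :* w)) :=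
                       con 128 :* (w :* (w :* (w :* con 1)))) refl w ⟩
  2 ^ 7 * w ^ 3
    ≤⟨ ℕₚ.*-monoˡ-≤ (w ^ 3) (ℕₚ.^-monoˡ-≤ 7 2≤w) ⟩
  w ^ 7 * w ^ 3
    ≡⟨ ≡sym (ℕₚ.^-distribˡ-+-* w 7 3) ⟩
  w ^ 10 ∎
  where
  open ℕₚ.≤-Reasoning
  1≤w : 1 ≤ w
  1≤w = ℕₚ.≤-trans (ℕₚ.n≤1+n 1) 2≤w

^37-superadditive : ∀ a b → a ^ 37 + b ^ 37 ≤ (a + b) ^ 37
^37-superadditive a b = ℕₚ.≤-trans
  (ℕₚ.+-mono-≤ (ℕₚ.*-monoʳ-≤ a (ℕₚ.^-monoˡ-≤ 36 (ℕₚ.m≤m+n a b))) (ℕₚ.*-monoʳ-≤ b (ℕₚ.^-monoˡ-≤ 36 (ℕₚ.m≤n+m b a))))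
  (ℕₚ.≤-reflexive (≡sym (ℕₚ.*-distribʳ-+ ((a + b) ^ 36) a b)))

half-max : ∀ {w Ω} → 2 * w ≤ Ω → w ≤ ℕ.⌊ Ω /2⌋
half-max {w} {Ω} le = ℕₚ.≤-trans (ℕₚ.≤-reflexive (ℕₚ.n≡⌊n+n/2⌋ w))
  (ℕₚ.⌊n/2⌋-mono (subst (λ z → w + z ≤ Ω) (ℕₚ.+-identityʳ w) le))

half-double : ∀ Ω → 2 * ℕ.⌊ Ω /2⌋ ≤ Ω
half-double Ω = ℕₚ.≤-trans (ℕₚ.+-monoʳ-≤ ℕ.⌊ Ω /2⌋
    (ℕₚ.≤-trans (ℕₚ.≤-reflexive (ℕₚ.+-identityʳ _)) (ℕₚ.⌊n/2⌋≤⌈n/2⌉ Ω)))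
  (ℕₚ.≤-reflexive (ℕₚ.⌊n/2⌋+⌈n/2⌉≡n Ω))

-- The alternative e ≡ 0 starts the search also for w = 0.
log-data : ∀ w → ∃[ e ] (e ≡ 0 ⊎ 2 ^ e ≤ w) × (∀ j → (j ≡ 0 ⊎ 2 ^ j ≤ w) → j ≤ e)
log-data w = greatest (λ e → e ≡ 0 ⊎ 2 ^ e ≤ w) (λ e → (e ℕₚ.≟ 0) ⊎-dec (2 ^ e ℕₚ.≤? w)) (inj₁ refl) w λ where
    k (inj₁ refl) → z≤n
    k (inj₂ le)   → ℕₚ.≤-trans (below k) le
  where
  below : ∀ k → k ≤ 2 ^ k
  below zero    = z≤n
  below (suc k) = ℕₚ.≤-trans (ℕₚ.+-mono-≤ (ℕₚ.m^n>0 2 k) (below k))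
    (ℕₚ.≤-reflexive (cong (2 ^ k +_) (≡sym (ℕₚ.+-identityʳ (2 ^ k)))))

log : ℕ → ℕ
log w = proj₁ (log-data w)

2^log≤ : ∀ {w} → 1 ≤ w → 2 ^ log w ≤ w
2^log≤ {w} 1≤w with log-data w
... | e , inj₁ refl , _ = 1≤w
... | e , inj₂ le   , _ = le

<2^log : ∀ w → w < 2 ^ suc (log w)
<2^log w = ℕₚ.≰⇒> λ le → ℕₚ.<-irrefl refl (proj₂ (proj₂ (log-data w)) (suc (log w)) (inj₂ le))

-- Maximal proper modules and the prime quotient

module Quotient (G : Graph) where
  open Modules G

  IsModule? : ∀ D W → Dec (IsModule D W)
  IsModule? D W = map′
    (λ (sub , h) → (λ {x} → sub x) , λ {y} {x} {x′} yW y∉ xD x′D → h y x x′ yW y∉ xD x′D)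
    (λ (sub , h) → (λ x → sub {x}) , λ y x x′ yW y∉ xD x′D → h yW y∉ xD x′D)
    ((Finₚ.all? λ x → mem D x →-dec mem W x) ×-dec
     (Finₚ.all? λ y → Finₚ.all? λ x → Finₚ.all? λ x′ →
       mem W y →-dec ¬? (mem D y) →-dec mem D x →-dec mem D x′ →-dec (A y x Bₚ.≟ A y x′)))

  module _ (W : Sub) (ct : Conn true W) (cf : Conn false W)
           (two : ∃[ x ] ∃[ y ] x ∈ W × y ∈ W × x ≢ y) where

    ProperModule : Sub → Set
    ProperModule D = IsModule D W × ∃ ⟦ W ∖ D ⟧

    -- If S ∪ T were W, all adjacencies between S and its complement would agree.
    proper-∪ : ∀ S T {x} → ProperModule S → ProperModule T → x ∈ S → x ∈ T → ProperModule (S ∪ T)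
    proper-∪ S T {x} ((S⊆ , mS) , b , bW , b∉S) ((T⊆ , mT) , a , aW , a∉T) xS xT = (sub , eq) , outside
      where
      sub : S ∪ T ⊆ W
      sub (inj₁ p) = S⊆ p
      sub (inj₂ p) = T⊆ p
      to-x : ∀ {y z} → y ∈ W → y ∉ S ∪ T → z ∈ S ∪ T → A y z ≡ A y x
      to-x yW y∉ (inj₁ zS) = mS yW (y∉ ∘ inj₁) zS xS
      to-x yW y∉ (inj₂ zT) = mT yW (y∉ ∘ inj₂) zT xT
      eq : ∀ {y z z′} → y ∈ W → y ∉ S ∪ T → z ∈ S ∪ T → z′ ∈ S ∪ T → A y z ≡ A y z′
      eq yW y∉ p q = trans (to-x yW y∉ p) (≡sym (to-x yW y∉ q))
      outside : ∃ ⟦ W ∖ (S ∪ T) ⟧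
      outside with inhab? (W ∖ (S ∪ T))
      ... | yes h = h
      ... | no none = ⊥-elim (uniform (A a b) refl)
        where
        in-∪ : ∀ {z} → z ∈ W → z ∈ S ⊎ z ∈ T
        in-∪ {z} zW = decidable-stable (mem (S ∪ T) z) λ h → none (z , zW , h)
        aS : a ∈ S
        aS = [ id , ⊥-elim ∘ a∉T ]′ (in-∪ aW)
        bT : b ∈ T
        bT = [ ⊥-elim ∘ b∉S , id ]′ (in-∪ bW)
        across : ∀ {e f} → e ∈ S → f ∈ W → f ∉ S → A e f ≡ A a b
        across {e} {f} eS fW f∉S = trans (trans (sym G e f) (trans (mS fW f∉S eS aS) (sym G f a)))
          (mT aW a∉T ([ ⊥-elim ∘ f∉S , id ]′ (in-∪ fW)) bT)
        uniform : ∀ β → A a b ≡ β → ⊥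
        uniform true  ab with cf S aW aS bW b∉S
        ... | e , f , (_ , eS) , (fW , f∉S) , ef = clash (trans (across eS fW f∉S) ab) ef
        uniform false ab with ct S aW aS bW b∉S
        ... | e , f , (_ , eS) , (fW , f∉S) , ef = clash ef (trans (across eS fW f∉S) ab)

    Maximal : V → Sub → Set₁
    Maximal x D = ProperModule D × x ∈ D × (∀ T → ProperModule T → x ∈ T → T ⊆ D)

    -- Starting from x alone, any proper module through x that sticks out is merged in, and
    -- `proper-∪` keeps the union proper. The result contains every proper module through x, so the
    -- classes partition W.
    maximal-module : ∀ {x} → x ∈ W → Σ Sub (Maximal x)
    maximal-module {x} xW = grow (n G) ｛ x ｝ (full-bound (W ∖ ｛ x ｝)) refl singleton
      where
      singleton : ProperModule ｛ x ｝
      singleton = ((λ { refl → xW }) , λ { _ _ refl refl → refl }) , other two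
        where
        other : (∃[ x ] ∃[ y ] x ∈ W × y ∈ W × x ≢ y) → ∃ ⟦ W ∖ ｛ x ｝ ⟧
        other (y , z , yW , zW , y≢z) with y Finₚ.≟ x
        ... | no y≢x   = y , yW , y≢x
        ... | yes refl = z , zW , ≢-sym y≢z
      grow : ∀ k D → W ∖ D ≲ k → x ∈ D → ProperModule D → Σ Sub (Maximal x)
      grow k D left xD D-proper with search Bigger Bigger? resp
        where
        Bigger : Sub → Set
        Bigger T = ProperModule T × x ∈ T × ∃ ⟦ T ∖ D ⟧
        Bigger? : ∀ T → Dec (Bigger T)
        Bigger? T = (IsModule? T W ×-dec inhab? (W ∖ T)) ×-dec mem T x ×-dec inhab? (T ∖ D)
        resp : ∀ S T → S ⊆ T → T ⊆ S → Bigger S → Bigger T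
        resp S T S⊆T T⊆S (((S⊆W , mS) , z , zW , z∉) , xS , y , yS , y∉) =
          ((S⊆W ∘ T⊆S , λ yW y∉T p q → mS yW (y∉T ∘ S⊆T) (T⊆S p) (T⊆S q)) , z , zW , z∉ ∘ T⊆S) ,
          S⊆T xS , y , S⊆T yS , y∉
      ... | no none = D , D-proper , xD , λ T T-proper xT {z} zT →
              decidable-stable (mem D z) λ z∉D → none (T , T-proper , xT , z , zT , z∉D)
      grow zero D left xD D-proper | yes (T , ((T⊆W , _) , _) , xT , z , zT , z∉D) =
        ⊥-elim (left (z , (T⊆W zT , z∉D) , tt))
      grow (suc k) D left xD D-proper | yes (T , T-proper@((T⊆W , _) , _) , xT , z , zT , z∉D) =
        grow k (D ∪ T) (shrink (W ∖ (D ∪ T)) (W ∖ D) z (T⊆W zT , z∉D) (λ (_ , h) → h (inj₂ zT))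
          (λ (yW , h) → yW , h ∘ inj₁) left) (inj₁ xD) (proper-∪ D T D-proper T-proper xD xT)

    abstract
      -- The singleton outside W keeps `cls-self` true for all vertices, so representatives are
      -- total.
      cls : V → Sub
      cls x with mem W x
      ... | yes xW = proj₁ (maximal-module xW)
      ... | no _   = ｛ x ｝

      cls-maximal : ∀ {x} → x ∈ W → Maximal x (cls x)
      cls-maximal {x} xW with mem W x
      ... | yes xW′ = proj₂ (maximal-module xW′)
      ... | no x∉   = ⊥-elim (x∉ xW)

      cls-self : ∀ x → x ∈ cls x
      cls-self x with mem W x
      ... | yes xW = proj₁ (proj₂ (proj₂ (maximal-module xW)))
      ... | no _   = refl

    cls⊆W : ∀ {x} → x ∈ W → cls x ⊆ W
    cls⊆W xW = proj₁ (proj₁ (proj₁ (cls-maximal xW)))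

    cls-⊆ : ∀ {x y} → x ∈ W → y ∈ cls x → cls x ⊆ cls y × cls y ⊆ cls x
    cls-⊆ {x} {y} xW y∈ = x⊆y , proj₂ (proj₂ (cls-maximal xW)) (cls y) (proj₁ (cls-maximal yW)) (x⊆y (cls-self x))
      where
      yW = cls⊆W xW y∈
      x⊆y : cls x ⊆ cls y
      x⊆y = proj₂ (proj₂ (cls-maximal yW)) (cls x) (proj₁ (cls-maximal xW)) y∈

    rep-data : ∀ x → Σ V λ r → r ∈ cls x × (∀ y → y ∈ cls x → r Fin.≤ y)
    rep-data x = least (λ y → y ∈ cls x) (mem (cls x)) (x , cls-self x)

    rep : V → V
    rep x = proj₁ (rep-data x)

    rep∈ : ∀ x → rep x ∈ cls x
    rep∈ x = proj₁ (proj₂ (rep-data x))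

    rep-same : ∀ {x y} → x ∈ W → y ∈ cls x → rep y ≡ rep x
    rep-same {x} {y} xW y∈ with cls-⊆ xW y∈
    ... | x⊆y , y⊆x = Finₚ.≤-antisym (proj₂ (proj₂ (rep-data y)) _ (x⊆y (rep∈ x)))
                                     (proj₂ (proj₂ (rep-data x)) _ (y⊆x (rep∈ y)))

    rep-W : ∀ {x} → x ∈ W → rep x ∈ W
    rep-W {x} xW = cls⊆W xW (rep∈ x)

    rep-rep : ∀ {x} → x ∈ W → rep (rep x) ≡ rep x
    rep-rep {x} xW = rep-same xW (rep∈ x)

    ∈-cls-rep : ∀ {x} → x ∈ W → x ∈ cls (rep x)
    ∈-cls-rep {x} xW = proj₁ (cls-⊆ xW (rep∈ x)) (cls-self x)

    R : Sub
    R = (λ x → x ∈ W × rep x ≡ x) ∣ λ x → mem W x ×-dec (rep x Finₚ.≟ x)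

    rep∈R : ∀ {x} → x ∈ W → rep x ∈ R
    rep∈R xW = rep-W xW , rep-rep xW

    one-side : ∀ {x y} → x ∈ W → y ∈ W → rep x ≢ rep y → A x y ≡ A x (rep y)
    one-side {x} {y} xW yW ne = proj₂ (proj₁ (proj₁ (cls-maximal (rep-W yW)))) xW
      (λ x∈ → ne (trans (rep-same (rep-W yW) x∈) (rep-rep yW))) (∈-cls-rep yW) (cls-self (rep y))

    quotient-adj : ∀ {x y} → x ∈ W → y ∈ W → rep x ≢ rep y → A x y ≡ A (rep x) (rep y)
    quotient-adj {x} {y} xW yW ne = trans (one-side xW yW ne) (trans (sym G x (rep y))
      (trans (one-side (rep-W yW) xW (λ e → ne (≡sym (trans (≡sym (rep-rep yW)) e)))) (sym G (rep y) (rep x))))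

    -- An unsplit D would make the union D̂ of its classes a proper module, as r stays outside.
    -- Maximality puts D̂ inside the class of x, so x and y have the same representative.
    R-prime : ∀ D {x y r} → D ⊆ R → x ∈ D → y ∈ D → x ≢ y → r ∈ R → r ∉ D →
              ∃[ q ] q ∈ R × q ∉ D × (∃[ e ] e ∈ D × q ~ e) × (∃[ f ] f ∈ D × q ≁ f)
    R-prime D {x} {y} {r} D⊆R xD yD x≢y (rW , rr) r∉D with Finₚ.any? (λ q → mem R q ×-dec ¬? (mem D q) ×-dec
        Finₚ.any? (λ e → mem D e ×-dec (A q e Bₚ.≟ true)) ×-dec Finₚ.any? (λ f → mem D f ×-dec (A q f Bₚ.≟ false)))
    ... | yes h = h
    ... | no none = ⊥-elim (x≢y (trans (≡sym (proj₂ (D⊆R xD))) (trans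
            (≡sym (rep-same (proj₁ (D⊆R xD)) (proj₂ (proj₂ (cls-maximal (proj₁ (D⊆R xD)))) D̂ D̂-proper (lift xD) (lift yD))))
            (proj₂ (D⊆R yD)))))
      where
      D̂ : Sub
      D̂ = (λ w → w ∈ W × rep w ∈ D) ∣ λ w → mem W w ×-dec mem D (rep w)
      lift : ∀ {z} → z ∈ D → z ∈ D̂
      lift zD = proj₁ (D⊆R zD) , subst (_∈ D) (≡sym (proj₂ (D⊆R zD))) zD
      uniform : ∀ {q e f} → q ∈ R → q ∉ D → e ∈ D → f ∈ D → A q e ≡ A q f
      uniform {q} {e} {f} qR q∉ eD fD with ~? q e | ~? q f
      ... | inj₁ a | inj₁ b = trans a (≡sym b)
      ... | inj₂ a | inj₂ b = trans a (≡sym b)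
      ... | inj₁ a | inj₂ b = ⊥-elim (none (q , qR , q∉ , (e , eD , a) , (f , fD , b)))
      ... | inj₂ a | inj₁ b = ⊥-elim (none (q , qR , q∉ , (f , fD , b) , (e , eD , a)))
      D̂-proper : ProperModule D̂
      D̂-proper = (proj₁ , eq) , r , rW , λ (_ , rD) → r∉D (subst (_∈ D) rr rD)
        where
        eq : ∀ {w a b} → w ∈ W → w ∉ D̂ → a ∈ D̂ → b ∈ D̂ → A w a ≡ A w b
        eq {w} wW w∉ (aW , aD) (bW , bD) = trans (quotient-adj wW aW (apart aD))
          (trans (uniform (rep∈R wW) w∉D aD bD) (≡sym (quotient-adj wW bW (apart bD))))
          where
          w∉D : rep w ∉ D
          w∉D h = w∉ (wW , h)
          apart : ∀ {a} → rep a ∈ D → rep w ≢ rep a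
          apart aD e = w∉D (subst (_∈ D) (≡sym e) aD)

    weight : V → ℕ
    weight r = ω (cls r)

    -- Replacing each representative by a clique of size j in its class bounds the clique number of
    -- a weight class by Ω / j.
    blow-up : ∀ k j {P : V → Set} → (∀ {r} → P r → r ∈ R × j ≤ weight r) → HasCl k P →
              HasCl (k * j) (λ x → x ∈ W × P (rep x))
    blow-up zero    j P⊆ _ = tt
    blow-up (suc k) j {P} P⊆ (r , pr , c) = HasCl-join j (k * j) joined
        (λ x∈ → cls⊆W rW x∈ , subst P (≡sym (rep-r x∈)) pr) (λ (xW , px , _) → xW , px)
        (HasCl-≤ (proj₂ (P⊆ pr)) (ω-has (cls r))) (blow-up k j (P⊆ ∘ proj₁) c)
      where
      rW = proj₁ (proj₁ (P⊆ pr))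
      rep-r : ∀ {x} → x ∈ cls r → rep x ≡ r
      rep-r x∈ = trans (rep-same rW x∈) (proj₂ (proj₁ (P⊆ pr)))
      joined : ∀ {x y} → x ∈ cls r → y ∈ W × P (rep y) × r ~ rep y → x ~ y
      joined {x} {y} x∈ (yW , _ , ry) = trans
        (quotient-adj (cls⊆W rW x∈) yW (λ e → irr (trans (≡sym (rep-r x∈)) e) ry))
        (subst (_~ rep y) (≡sym (rep-r x∈)) ry)

-- Substituting the modules back

module Main (G : Graph) (noBull : NoBull G) (noSunspot : NoSunspot G) (noSun : NoLongSun G) where
  open Modules G
  open PrimeSets G noBull noSunspot noSun using (Prime; peel)

  prime-colouring : ∀ R → Prime R → ∀ U → U ⊆ R → Col ⟦ U ⟧ (ω U ^ 10)
  prime-colouring R prime U U⊆R with 2 ℕₚ.≤? ω U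
  ... | yes 2≤ = col-≤ (prime-bound (ω U) 2≤) (peel R prime (ω U) (ω U) U U⊆R ℕₚ.≤-refl ℕₚ.≤-refl)
  ... | no  ≤1 = col-const 0 (λ xU → ℕₚ.^-monoˡ-≤ 10 (ω-pos U xU))
                   λ xU yU → not~ λ xy → ≤1 (ω-max U (_ , xU , _ , (yU , xy) , tt))

  module Weighted (W : Sub) (ct : Conn true W) (cf : Conn false W)
                  (two : ∃[ x ] ∃[ y ] x ∈ W × y ∈ W × x ≢ y)
                  (ih : ∀ U → U ⊆ W → ∃ ⟦ W ∖ U ⟧ → Col ⟦ U ⟧ (ω U ^ 37)) where
    private
      open module Q = Quotient G
      cl = cls W ct cf two
      ρ = rep W ct cf two
      wt = weight W ct cf two
      R′ = R W ct cf two
      Ω = ω W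

    inner : V → V → ℕ
    inner r with mem W r
    ... | yes rW = colour (ih (cl r) (cls⊆W W ct cf two rW) (proj₂ (proj₁ (cls-maximal W ct cf two rW))))
    ... | no _   = λ _ → 0

    inner-spec : ∀ {r} → r ∈ W → (∀ {x} → x ∈ cl r → inner r x < wt r ^ 37) × Proper ⟦ cl r ⟧ (inner r)
    inner-spec {r} rW with mem W r
    ... | yes rW′ = within c , is-proper c
      where c = ih (cl r) (cls⊆W W ct cf two rW′) (proj₂ (proj₁ (cls-maximal W ct cf two rW′)))
    ... | no r∉ = ⊥-elim (r∉ rW)

    Light : V → Set
    Light r = 2 * wt r ≤ Ω

    slot : V → ℕ
    slot r = log (wt r)

    Class : ℕ → Sub
    Class e = (λ r → r ∈ R′ × slot r ≡ e × Light r) ∣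
              λ r → mem R′ r ×-dec (slot r ℕₚ.≟ e) ×-dec (2 * wt r ℕₚ.≤? Ω)

    outer : ∀ e → Col ⟦ Class e ⟧ (ω (Class e) ^ 10)
    outer e = prime-colouring R′ (R-prime W ct cf two) (Class e) proj₁

    -- A bound on the weights of light modules in slot e, from the power of two and from lightness;
    -- both are needed in `slot-fits`.
    cap : ℕ → ℕ
    cap e = (2 * 2 ^ e) ℕ.⊓ ℕ.⌊ Ω /2⌋

    -- Slot e runs from 2 ^ (e - 1) to 2 ^ e in units of Ω ^ 36, slot 0 from zero. Its end is at
    -- most wt r units for every r in it, which is what heavy neighbours of r can afford.
    offset : ℕ → ℕ
    offset zero    = 0
    offset (suc e) = 2 ^ e * Ω ^ 36

    position : V → ℕ
    position x = offset e + (colour (outer e) r * cap e ^ 37 + inner r x)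
      where
      r = ρ x
      e = slot r

    wt-pos : ∀ {r} → 1 ≤ wt r
    wt-pos {r} = ω-pos (cl r) (cls-self W ct cf two r)

    class-fits : ∀ e → 2 * (ω (Class e) ^ 10 * cap e ^ 37) ≤ 2 ^ e * Ω ^ 36
    class-fits e = slot-fits (ω (Class e)) (2 ^ e) Ω (cap e)
      (ω-max W (HasCl-⊆ (ω (Class e) * 2 ^ e) proj₁
        (blow-up W ct cf two (ω (Class e)) (2 ^ e) (λ { (rR , refl , _) → rR , 2^log≤ wt-pos }) (ω-has (Class e)))))
      (ℕₚ.m⊓n≤m (2 * 2 ^ e) _)
      (ℕₚ.≤-trans (ℕₚ.*-monoʳ-≤ 2 (ℕₚ.m⊓n≤n (2 * 2 ^ e) _)) (half-double Ω))

    slot-end : ∀ e → offset e + ω (Class e) ^ 10 * cap e ^ 37 ≤ 2 ^ e * Ω ^ 36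
    slot-end zero    = ℕₚ.≤-trans (ℕₚ.m≤m+n _ _) (class-fits zero)
    slot-end (suc e) = ℕₚ.≤-trans (ℕₚ.+-monoʳ-≤ (2 ^ e * Ω ^ 36) (ℕₚ.*-cancelˡ-≤ 2
        (ℕₚ.≤-trans (class-fits (suc e)) (ℕₚ.≤-reflexive (ℕₚ.*-assoc 2 (2 ^ e) (Ω ^ 36))))))
      (ℕₚ.≤-reflexive (trans (cong (2 ^ e * Ω ^ 36 +_) (≡sym (ℕₚ.+-identityʳ _)))
        (≡sym (ℕₚ.*-assoc 2 (2 ^ e) (Ω ^ 36)))))

    module _ {x} (xW : x ∈ W) where
      private
        r = ρ x
        e = slot r
        r∈ : r ∈ R′
        r∈ = rep∈R W ct cf two xW

      inner-< : inner r x < wt r ^ 37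
      inner-< = proj₁ (inner-spec (proj₁ r∈)) (∈-cls-rep W ct cf two xW)

      module _ (light : Light r) where

        inner-<-cap : inner r x < cap e ^ 37
        inner-<-cap = ℕₚ.<-≤-trans inner-< (ℕₚ.^-monoˡ-≤ 37
          (ℕₚ.⊓-glb (ℕₚ.<⇒≤ (<2^log (wt r))) (half-max light)))

        position-< : position x < 2 ^ e * Ω ^ 36
        position-< = ℕₚ.<-≤-trans
          (ℕₚ.+-monoʳ-< (offset e) (encode-bound (within (outer e) (r∈ , refl , light)) inner-<-cap)) (slot-end e)

        position-<-wt : position x < wt r * Ω ^ 36
        position-<-wt = ℕₚ.<-≤-trans position-< (ℕₚ.*-monoˡ-≤ (Ω ^ 36) (2^log≤ wt-pos))

    wt≤Ω : ∀ {r} → r ∈ W → wt r ≤ Ω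
    wt≤Ω {r} rW = ω-mono (cl r) W (cls⊆W W ct cf two rW)

    position-<-Ω : ∀ {x} → x ∈ W → Light (ρ x) → position x < Ω ^ 37
    position-<-Ω xW light = ℕₚ.<-≤-trans (position-<-wt xW light)
      (ℕₚ.*-monoˡ-≤ (Ω ^ 36) (wt≤Ω (rep-W W ct cf two xW)))

    pair-weight : ∀ {r s} → r ∈ R′ → s ∈ R′ → r ~ s → wt r + wt s ≤ Ω
    pair-weight {r} {s} (rW , rr) (sW , ss) rs = ω-join (cl r) (cl s) W
      (λ x∈ y∈ → let ex = trans (rep-same W ct cf two rW x∈) rr ; ey = trans (rep-same W ct cf two sW y∈) ss in
        trans (quotient-adj W ct cf two (cls⊆W W ct cf two rW x∈) (cls⊆W W ct cf two sW y∈)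
                (λ e → irr (trans (≡sym ex) (trans e ey)) rs))
              (subst₂ _~_ (≡sym ex) (≡sym ey) rs))
      (cls⊆W W ct cf two rW) (cls⊆W W ct cf two sW)

    -- Light vertices are coloured from the top of the palette, so that the colours below
    -- (Ω - weight) ^ 37 remain available for the heavy neighbours.
    final : V → ℕ
    final x with 2 * wt (ρ x) ℕₚ.≤? Ω
    ... | yes _ = Ω ^ 37 ∸ suc (position x)
    ... | no _  = inner (ρ x) x

    final-< : ∀ {x} → x ∈ W → final x < Ω ^ 37
    final-< {x} xW with 2 * wt (ρ x) ℕₚ.≤? Ω
    ... | no _ = ℕₚ.<-≤-trans (inner-< xW) (ℕₚ.^-monoˡ-≤ 37 (wt≤Ω (rep-W W ct cf two xW)))
    ... | yes light = ℕₚ.≤-trans (ℕₚ.+-monoˡ-≤ (Ω ^ 37 ∸ suc (position x)) (s≤s (z≤n {position x})))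
            (ℕₚ.≤-reflexive (ℕₚ.m+[n∸m]≡n (position-<-Ω xW light)))

    -- In units of Ω ^ 36, x uses at most its weight from the bottom and y at most its weight from
    -- the top; adjacent weights sum to at most Ω.
    heavy-light : ∀ {x y} → x ∈ W → y ∈ W → (light : Light (ρ y)) → ρ x ~ ρ y →
                  inner (ρ x) x < Ω ^ 37 ∸ suc (position y)
    heavy-light {x} {y} xW yW light xy = ℕₚ.m+n≤o⇒m≤o∸n (suc (inner (ρ x) x))
      (ℕₚ.≤-trans (ℕₚ.+-mono-≤
          (ℕₚ.≤-trans (inner-< xW) (ℕₚ.*-monoʳ-≤ (wt (ρ x)) (ℕₚ.^-monoˡ-≤ 36 (wt≤Ω (rep-W W ct cf two xW)))))
          (position-<-wt yW light))
        (ℕₚ.≤-trans (ℕₚ.≤-reflexive (≡sym (ℕₚ.*-distribʳ-+ (Ω ^ 36) (wt (ρ x)) (wt (ρ y)))))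
          (ℕₚ.*-monoˡ-≤ (Ω ^ 36) (pair-weight (rep∈R W ct cf two xW) (rep∈R W ct cf two yW) xy))))

    slots-apart : ∀ {x y} → x ∈ W → y ∈ W → Light (ρ x) → slot (ρ x) < slot (ρ y) → position x < position y
    slots-apart {x} {y} xW yW light lt = ℕₚ.<-≤-trans (position-< xW light)
      (ℕₚ.≤-trans (earlier lt) (ℕₚ.m≤m+n (offset (slot (ρ y))) _))
      where
      earlier : ∀ {e e′} → e < e′ → 2 ^ e * Ω ^ 36 ≤ offset e′
      earlier {e} {suc e′} (s≤s le) = ℕₚ.*-monoˡ-≤ (Ω ^ 36) (ℕₚ.^-monoʳ-≤ 2 le)

    light-light : ∀ {x y} → x ∈ W → y ∈ W → Light (ρ x) → Light (ρ y) → ρ x ~ ρ y → position x ≢ position y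
    light-light {x} {y} xW yW lx ly xy eq with ℕₚ.<-cmp (slot (ρ x)) (slot (ρ y))
    ... | tri< lt _ _ = ℕₚ.<⇒≢ (slots-apart xW yW lx lt) eq
    ... | tri> _ _ gt = ℕₚ.<⇒≢ (slots-apart yW xW ly gt) (≡sym eq)
    ... | tri≈ _ e _ = same (slot (ρ x)) (slot (ρ y)) e refl refl (inner-<-cap xW lx) (inner-<-cap yW ly) eq
      where
      same : ∀ e e′ → e ≡ e′ → slot (ρ x) ≡ e → slot (ρ y) ≡ e′ →
             inner (ρ x) x < cap e ^ 37 → inner (ρ y) y < cap e′ ^ 37 →
             offset e + (colour (outer e) (ρ x) * cap e ^ 37 + inner (ρ x) x) ≢
             offset e′ + (colour (outer e′) (ρ y) * cap e′ ^ 37 + inner (ρ y) y)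
      same e .e refl sx sy ix iy eq = is-proper (outer e) (rep∈R W ct cf two xW , sx , lx) (rep∈R W ct cf two yW , sy , ly) xy
        (proj₁ (encode-injective (cap e ^ 37) ix iy (ℕₚ.+-cancelˡ-≡ (offset e) _ _ eq)))

    final-proper : Proper ⟦ W ⟧ final
    final-proper {x} {y} xW yW xy with ρ x Finₚ.≟ ρ y
    final-proper {x} {y} xW yW xy | yes same with 2 * wt (ρ x) ℕₚ.≤? Ω | 2 * wt (ρ y) ℕₚ.≤? Ω
    ... | yes lx | no ¬ly = ⊥-elim (¬ly (subst Light same lx))
    ... | no ¬lx | yes ly = ⊥-elim (¬lx (subst Light (≡sym same) ly))
    ... | no _ | no _ = λ e → inner-differs xW yW xy same e
      where
      inner-differs : ∀ {x y} → x ∈ W → y ∈ W → x ~ y → ρ x ≡ ρ y → inner (ρ x) x ≢ inner (ρ y) y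
      inner-differs {x} {y} xW yW xy same e = proj₂ (inner-spec (rep-W W ct cf two xW)) (∈-cls-rep W ct cf two xW)
        (subst (λ r → y ∈ cl r) (≡sym same) (∈-cls-rep W ct cf two yW)) xy
        (trans e (cong (λ r → inner r y) (≡sym same)))
    ... | yes lx | yes ly = λ e → position-differs (ρ x) (ρ y) same refl refl
              (ℕₚ.suc-injective (ℕₚ.∸-cancelˡ-≡ (position-<-Ω xW lx) (position-<-Ω yW ly) e))
      where
      position-differs : ∀ r s → r ≡ s → ρ x ≡ r → ρ y ≡ s →
        offset (slot r) + (colour (outer (slot r)) r * cap (slot r) ^ 37 + inner r x) ≢
        offset (slot s) + (colour (outer (slot s)) s * cap (slot s) ^ 37 + inner s y)
      position-differs r .r refl ex ey e = proj₂ (inner-spec (subst (_∈ W) ex (rep-W W ct cf two xW)))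
        (subst (λ r → x ∈ cl r) ex (∈-cls-rep W ct cf two xW)) (subst (λ r → y ∈ cl r) ey (∈-cls-rep W ct cf two yW)) xy
        (ℕₚ.+-cancelˡ-≡ (colour (outer (slot r)) r * cap (slot r) ^ 37) _ _ (ℕₚ.+-cancelˡ-≡ (offset (slot r)) _ _ e))
    final-proper {x} {y} xW yW xy | no differ with trans (≡sym (quotient-adj W ct cf two xW yW differ)) xy
                                                | 2 * wt (ρ x) ℕₚ.≤? Ω | 2 * wt (ρ y) ℕₚ.≤? Ω
    ... | q | yes lx | yes ly = λ e → light-light xW yW lx ly q
              (ℕₚ.suc-injective (ℕₚ.∸-cancelˡ-≡ (position-<-Ω xW lx) (position-<-Ω yW ly) e))
    ... | q | no _ | yes ly = ℕₚ.<⇒≢ (heavy-light xW yW ly q)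
    ... | q | yes lx | no _ = ≢-sym (ℕₚ.<⇒≢ (heavy-light yW xW lx (A-sym q)))
    -- Two adjacent heavy modules would together exceed Ω.
    ... | q | no hx | no hy = ⊥-elim (ℕₚ.<⇒≱ (ℕₚ.+-mono-< (ℕₚ.≰⇒> hx) (ℕₚ.≰⇒> hy))
            (ℕₚ.≤-trans (ℕₚ.≤-reflexive (≡sym (ℕₚ.*-distribˡ-+ 2 (wt (ρ x)) (wt (ρ y)))))
              (ℕₚ.≤-trans (ℕₚ.*-monoʳ-≤ 2 (pair-weight (rep∈R W ct cf two xW) (rep∈R W ct cf two yW) q))
                (ℕₚ.≤-reflexive (cong (Ω +_) (ℕₚ.+-identityʳ Ω))))))

    weighted-colouring : Col ⟦ W ⟧ (Ω ^ 37)
    weighted-colouring = colouring final final-< final-proper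

  chi-bound : ∀ W → Col ⟦ W ⟧ (ω W ^ 37)
  chi-bound = sub-induction (λ W → Col ⟦ W ⟧ (ω W ^ 37)) step
    where
    step : ∀ W → (∀ U → U ⊆ W → (∃[ z ] z ∈ W × z ∉ U) → Col ⟦ U ⟧ (ω U ^ 37)) → Col ⟦ W ⟧ (ω W ^ 37)
    step W ih with split-or-conn true W | split-or-conn false W
    ... | inj₁ (S , (x , xW , xS) , (y , yW , y∉S) , apart) | _ = col-apart S apart
      (col-≤ (ℕₚ.^-monoˡ-≤ 37 (ω-mono (W ∩ S) W proj₁)) (ih (W ∩ S) proj₁ (y , yW , y∉S ∘ proj₂)))
      (col-≤ (ℕₚ.^-monoˡ-≤ 37 (ω-mono (W ∖ S) W proj₁)) (ih (W ∖ S) proj₁ (x , xW , λ (_ , h) → h xS)))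
    ... | inj₂ _ | inj₁ (S , (x , xW , xS) , (y , yW , y∉S) , joined) = col-≤
      (ℕₚ.≤-trans (^37-superadditive (ω (W ∩ S)) (ω (W ∖ S))) (ℕₚ.^-monoˡ-≤ 37
        (ω-join (W ∩ S) (W ∖ S) W (λ (xW , xS) (yW , y∉S) → joined xW xS yW y∉S) proj₁ proj₁)))
      (col-∪ S (ih (W ∩ S) proj₁ (y , yW , y∉S ∘ proj₂)) (ih (W ∖ S) proj₁ (x , xW , λ (_ , h) → h xS)))
    ... | inj₂ ct | inj₂ cf with two? W
    ...   | yes two = Weighted.weighted-colouring W ct cf two ih
    ...   | no ¬two = col-const 0 (λ xW → ℕₚ.^-monoˡ-≤ 37 (ω-pos W xW))
                        λ {x} xW yW → subst (x ≁_) (one {W} ¬two xW yW) (irrefl G x)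

  HasCl⇒HasClique : ∀ k {P} → HasCl k P → Σ (Fin k → V) λ f → (∀ i → P (f i)) × (∀ i j → i ≢ j → f i ~ f j)
  HasCl⇒HasClique zero    _ = (λ ()) , (λ ()) , λ ()
  HasCl⇒HasClique (suc k) (x , px , c) with HasCl⇒HasClique k c
  ... | f , pf , adj-f = g , (λ { Fin.zero → px ; (Fin.suc i) → proj₁ (pf i) }) , adj-g
    where
    g : Fin (suc k) → V
    g Fin.zero    = x
    g (Fin.suc i) = f i
    adj-g : ∀ i j → i ≢ j → g i ~ g j
    adj-g Fin.zero    Fin.zero    ne = ⊥-elim (ne refl)
    adj-g Fin.zero    (Fin.suc j) _  = proj₂ (pf j)
    adj-g (Fin.suc i) Fin.zero    _  = A-sym (proj₂ (pf i))
    adj-g (Fin.suc i) (Fin.suc j) ne = adj-f i j (ne ∘ cong Fin.suc)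

  ω-full≤ : ∀ {w} → ¬ HasClique G (suc w) → ω full ≤ w
  ω-full≤ {w} none = ℕₚ.≮⇒≥ λ lt → none (let (f , _ , adj-f) = HasCl⇒HasClique (suc w) (HasCl-≤ lt (ω-has full)) in
    f , (λ {i} {j} e → decidable-stable (i Finₚ.≟ j) λ ne → irr e (adj-f i j ne)) , adj-f)

  colourable : ∀ {w} → ¬ HasClique G (suc w) → Colourable G (w ^ 37)
  colourable {w} none = (λ x → Fin.fromℕ< (within c {x} tt)) , λ x y xy e →
    is-proper c {x} {y} tt tt xy (trans (≡sym (Finₚ.toℕ-fromℕ< _)) (trans (cong toℕ e) (Finₚ.toℕ-fromℕ< _)))
    where
    c : Col ⟦ full ⟧ (w ^ 37)
    c = col-≤ (ℕₚ.^-monoˡ-≤ 37 (ω-full≤ none)) (chi-bound full)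

theorem1p4 : (G : Graph) → Free 5 bull G → Free (4 + 4 ∸ 1) (sunspot 4) G
    → (∀ t → 5 ≤ t → Free (t + t) (sun t) G)
    → (w : ℕ) → IsCliqueNumber G w → Colourable G (w ^ 37)
theorem1p4 G bull-free sunspot-free sun-free w (_ , no-larger) =
  Main.colourable G (Patterns.noBull G bull-free) (noSunspot G sunspot-free) sun-free no-larger
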